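{- Let $d\ge k\ge 1$ be integers with $d+k\ge 3$, and let $p\in(0,1)$ be constant. Let $\mathbb{T}_d$ denote the $(d+1)$-regular tree. Starting from the unit mass $\delta_\rho$ at the origin $\rho$ of the product of two regular trees $\mathbb{T}_d\times\mathbb{T}_k$, the minimum number of toppling moves needed to transport mass $p$ to distance at least $n$ from the origin is $$N_p(\mathbb{T}_d\times\mathbb{T}_k,B_n,\delta_\rho)=\theta(d,k)^{n(1+o(1))}\quad\text{as }n\to\infty,\qquad \theta(d,k)=d^{\frac{d-1}{d+k-2}}\cdot k^{\frac{k-1}{d+k-2}},$$ where the $o(1)$ term depends only on $n$, $d$, $k$ and $p$; that is, $\lim_{n\to\infty}\frac1n\log N_p(\mathbb{T}_d\times\mathbb{T}_k,B_n,\delta_\rho)=\log\theta(d,k)$.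
   Context: The Cartesian product $\mathbb{T}_d\times\mathbb{T}_k$ has vertex set $V(\mathbb{T}_d)\times V(\mathbb{T}_k)$, with $(u,v)\sim(u',v')$ iff either $u\sim u'$ and $v=v'$, or $u=u'$ and $v\sim v'$. The origin $\rho$ is an arbitrary fixed vertex (the graph is transitive). Toppling: let $G=(V,E)$ be a connected, locally finite graph, and write $y\sim v$ when $y,v$ are adjacent and $\mathcal{N}_v=\{y:y\sim v\}$. A mass distribution is a function $\mu:V\to[0,\infty)$. For a vertex $v$ with $\mu(v)>0$ and $0<m\le\mu(v)$, the toppling move $T_v^m$ topples mass $m$ at $v$ equally to its neighbours: $T_v^m\mu=\mu-m\delta_v+\frac{m}{|\mathcal{N}_v|}\sum_{y\sim v}\delta_y$. For $A\subset V$, $p>0$ and an initial mass distribution $\mu_0$, $N_p(G,A,\mu_0)$ is the minimum number of successive toppling moves needed to obtain from $\mu_0$ a mass distribution $\mu$ with $\sum_{v\notin A}\mu(v)\ge p$ (and $\infty$ if this is impossible). $B_n=\{u\in V: d_G(u,\rho)<n\}$ is the open ball of radius $n$ around $\rho$ in the graph distance $d_G$. -}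

module Defs where

open import Algebra.Bundles using (CommutativeRing; Semiring)
open import Data.Bool.Base using (if_then_else_; true; false)
open import Data.Integer.Base using (ℤ; +_; -[1+_])
open import Data.List.Base using (List; []; _∷_; _++_; length; map; foldr)
open import Data.List.Membership.Propositional using (_∈_)
open import Data.List.Membership.Propositional.Properties
  using (∈-++⁺ˡ; ∈-++⁺ʳ; ∈-++⁻; ∈-map⁺; ∈-map⁻)
open import Data.List.Relation.Unary.All using (All)
open import Data.List.Relation.Unary.Unique.Propositional using (Unique)
import Data.List.Relation.Unary.Unique.Propositional.Properties as Uniqueₚ
open import Data.Nat.Base as ℕ using (ℕ; suc; _∸_)
open import Data.Product.Base using (∃; ∃-syntax; Σ-syntax; _×_; _,_; proj₁; proj₂)
open import Data.Product.Properties using (≡-dec)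
open import Data.Rational.Base using (ℚ; ↥_; ↧ₙ_)
open import Data.Sum.Base using (_⊎_; inj₁; inj₂)
open import Level using (0ℓ)
open import Relation.Binary.Construct.Closure.ReflexiveTransitive using (Star; ε; _◅_)
import Relation.Binary.Construct.NonStrictToStrict as NonStrictToStrict
open import Relation.Binary.Definitions using (DecidableEquality; Symmetric)
open import Relation.Binary.PropositionalEquality.Core using (_≡_; refl; sym; cong)
open import Relation.Binary.Structures using (IsTotalOrder)
open import Relation.Nullary.Decidable.Core using (does)
open import Relation.Nullary.Negation.Core using (¬_)

-- The reals, axiomatised as a complete ordered field.  `_⁻¹` and `sup`
-- are total; nothing is assumed about `0# ⁻¹` beyond congruence, nor
-- about suprema of empty or unbounded sets.

record CompleteOrderedField : Set₁ where
  field
    commutativeRing : CommutativeRing 0ℓ 0ℓ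

  open CommutativeRing commutativeRing public

  infix  4 _≤_
  infix  8 _⁻¹

  field
    _≤_          : Carrier → Carrier → Set
    isTotalOrder : IsTotalOrder _≈_ _≤_
    +-monoˡ-≤    : ∀ z {x y} → x ≤ y → x + z ≤ y + z
    *-nonneg     : ∀ {x y} → 0# ≤ x → 0# ≤ y → 0# ≤ x * y
    0≉1          : ¬ 0# ≈ 1#
    _⁻¹          : Carrier → Carrier
    ⁻¹-cong      : ∀ {x y} → x ≈ y → x ⁻¹ ≈ y ⁻¹
    *-inverseʳ   : ∀ {x} → ¬ x ≈ 0# → x * x ⁻¹ ≈ 1#

  UpperBound : (Carrier → Set) → Carrier → Set
  UpperBound P b = ∀ {x} → P x → x ≤ b

  field
    sup       : (Carrier → Set) → Carrier
    sup-upper : ∀ P → ∃ P → ∃ (UpperBound P) → UpperBound P (sup P)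
    sup-least : ∀ P → ∃ P → ∃ (UpperBound P) →
                ∀ {b} → UpperBound P b → sup P ≤ b

  open IsTotalOrder isTotalOrder public
    using (total; antisym)
    renaming (refl to ≤-refl; reflexive to ≤-reflexive; trans to ≤-trans)
  open NonStrictToStrict _≈_ _≤_ public using (_<_)

  0≤1 : 0# ≤ 1#
  0≤1 with total 0# 1#
  ... | inj₁ 0≤1 = 0≤1
  ... | inj₂ 1≤0 = ≤-trans (*-nonneg 0≤-1 0≤-1) (≤-reflexive
        (≈-trans (-1*x≈-x (- 1#)) (-‿involutive 1#)))
    where
    open CommutativeRing commutativeRing using ()
      renaming (sym to ≈-sym; trans to ≈-trans)
    open import Algebra.Properties.Ring ring using (-1*x≈-x; -‿involutive)

    0≤-1 : 0# ≤ - 1#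
    0≤-1 = ≤-trans (≤-reflexive (≈-sym (-‿inverseʳ 1#)))
      (≤-trans (+-monoˡ-≤ (- 1#) 1≤0) (≤-reflexive (+-identityˡ (- 1#))))

module RealPowers (ℝ : CompleteOrderedField) where
  open CompleteOrderedField ℝ
  open import Algebra.Definitions.RawSemiring
    (Semiring.rawSemiring semiring) public using (_^_)
  open import Algebra.Definitions.RawSemiring
    (Semiring.rawSemiring semiring) using () renaming (_×_ to _·_)

  fromℕ : ℕ → Carrier
  fromℕ n = n · 1#

  fromℤ : ℤ → Carrier
  fromℤ (+ n)    = fromℕ n
  fromℤ -[1+ n ] = - fromℕ (suc n)

  fromℚ : ℚ → Carrier
  fromℚ q = fromℤ (↥ q) * fromℕ (↧ₙ q) ⁻¹

  infixr 8 _^ℤ_ _^ℚ_ _^ᴿ_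

  _^ℤ_ : Carrier → ℤ → Carrier
  x ^ℤ (+ n)    = x ^ n
  x ^ℤ -[1+ n ] = (x ^ suc n) ⁻¹

  -- The nonnegative n-th root, for 0 ≤ x and 1 ≤ n.
  root : ℕ → Carrier → Carrier
  root n x = sup λ t → 0# ≤ t × t ^ n ≤ x

  -- Rational powers of x > 0.
  _^ℚ_ : Carrier → ℚ → Carrier
  x ^ℚ q = root (↧ₙ q) (x ^ℤ (↥ q))

  -- Real powers, x ^ y = sup { x ^ q ∣ q rational, q ≤ y }.  This is the
  -- real power only for bases x ≥ 1, the only ones used below.
  _^ᴿ_ : Carrier → Carrier → Carrier
  x ^ᴿ y = sup λ t → ∃[ q ] fromℚ q ≤ y × t ≈ x ^ℚ q

  -- For d, k ≥ 1 and d + k ≥ 3 the subtractions are not truncated and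
  -- the denominator is nonzero.
  θ : ℕ → ℕ → Carrier
  θ d k = fromℕ d ^ᴿ (fromℕ (d ∸ 1) * fromℕ (d ℕ.+ k ∸ 2) ⁻¹)
        * fromℕ k ^ᴿ (fromℕ (k ∸ 1) * fromℕ (d ℕ.+ k ∸ 2) ⁻¹)

-- Locally finite simple graphs; `nbrs v` enumerates the neighbourhood
-- of v without repetition.

record Graph : Set₁ where
  infix 4 _~_ _≟_
  field
    V           : Set
    _≟_         : DecidableEquality V
    _~_         : V → V → Set
    ~-sym       : Symmetric _~_
    ~-irrefl    : ∀ {v} → ¬ v ~ v
    nbrs        : V → List V
    nbrs-unique : ∀ v → Unique (nbrs v)
    ∈-nbrs⁺     : ∀ {v y} → y ~ v → y ∈ nbrs v
    ∈-nbrs⁻     : ∀ {v y} → y ∈ nbrs v → y ~ v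

  degree : V → ℕ
  degree v = length (nbrs v)

  Walk : V → V → Set
  Walk = Star _~_

  vertices : ∀ {u v} → Walk u v → List V
  vertices {u} ε       = u ∷ []
  vertices {u} (_ ◅ w) = u ∷ vertices w

  Path : V → V → Set
  Path u v = Σ[ w ∈ Walk u v ] Unique (vertices w)

-- The number of edges of a walk (or of steps of any relation).
∣_∣ : ∀ {A : Set} {T : A → A → Set} {i j} → Star T i j → ℕ
∣ ε ∣     = 0
∣ _ ◅ w ∣ = suc ∣ w ∣

module _ (G : Graph) where
  open Graph G

  IsRegular : ℕ → Set
  IsRegular r = ∀ v → degree v ≡ r

  -- Any two vertices are joined by exactly one path.  Paths are compared
  -- by their vertex sequences, as `u ~ v` need not be a proposition.
  IsTree : Set
  IsTree = ∀ u v → Σ[ p ∈ Path u v ]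
    (∀ (q : Path u v) → vertices (proj₁ q) ≡ vertices (proj₁ p))

  IsDistance : V → V → ℕ → Set
  IsDistance u v n = (Σ[ w ∈ Walk u v ] ∣ w ∣ ≡ n) × (∀ (w : Walk u v) → n ℕ.≤ ∣ w ∣)

  Ball : V → ℕ → V → Set
  Ball ρ n u = ∃[ m ] IsDistance u ρ m × m ℕ.< n

record IsRegularTree (r : ℕ) (G : Graph) : Set where
  field
    isTree    : IsTree G
    isRegular : IsRegular G r

infixr 5 _□_

_□_ : Graph → Graph → Graph
G □ H = record
  { V           = G.V × H.V
  ; _≟_         = ≡-dec G._≟_ H._≟_
  ; _~_         = _~_
  ; ~-sym       = λ { (inj₁ (p , q)) → inj₁ (G.~-sym p , sym q)
                    ; (inj₂ (p , q)) → inj₂ (sym p , H.~-sym q) }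
  ; ~-irrefl    = λ { (inj₁ (p , _)) → G.~-irrefl p
                    ; (inj₂ (_ , q)) → H.~-irrefl q }
  ; nbrs        = nbrs
  ; nbrs-unique = λ { (u , v) → Uniqueₚ.++⁺
      (Uniqueₚ.map⁺ (cong proj₁) (G.nbrs-unique u))
      (Uniqueₚ.map⁺ (cong proj₂) (H.nbrs-unique v))
      disjoint }
  ; ∈-nbrs⁺     = ∈⁺
  ; ∈-nbrs⁻     = ∈⁻
  }
  where
  module G = Graph G
  module H = Graph H

  _~_ : G.V × H.V → G.V × H.V → Set
  (u , v) ~ (u′ , v′) = (u G.~ u′ × v ≡ v′) ⊎ (u ≡ u′ × v H.~ v′)

  nbrs : G.V × H.V → List (G.V × H.V)
  nbrs (u , v) = map (_, v) (G.nbrs u) ++ map (u ,_) (H.nbrs v)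

  disjoint : ∀ {u v x} →
    ¬ (x ∈ map (_, v) (G.nbrs u) × x ∈ map (u ,_) (H.nbrs v))
  disjoint (p , q) with ∈-map⁻ _ p | ∈-map⁻ _ q
  ... | _ , u∈ , refl | _ , _ , refl = G.~-irrefl (G.∈-nbrs⁻ u∈)

  ∈⁺ : ∀ {x y} → y ~ x → y ∈ nbrs x
  ∈⁺ (inj₁ (p , refl)) = ∈-++⁺ˡ (∈-map⁺ _ (G.∈-nbrs⁺ p))
  ∈⁺ (inj₂ (refl , q)) = ∈-++⁺ʳ _ (∈-map⁺ _ (H.∈-nbrs⁺ q))

  ∈⁻ : ∀ {x y} → y ∈ nbrs x → y ~ x
  ∈⁻ {u , v} y∈ with ∈-++⁻ (map (_, v) (G.nbrs u)) y∈
  ... | inj₁ p with ∈-map⁻ _ p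
  ...   | _ , u∈ , refl = inj₁ (G.∈-nbrs⁻ u∈ , refl)
  ∈⁻ {u , v} y∈ | inj₂ q with ∈-map⁻ _ q
  ...   | _ , v∈ , refl = inj₂ (refl , H.∈-nbrs⁻ v∈)

module Toppling (ℝ : CompleteOrderedField) (G : Graph) where
  open CompleteOrderedField ℝ hiding (refl; sym; trans)
  open RealPowers ℝ using (fromℕ)
  open Graph G

  record MassDistribution : Set where
    field
      mass   : V → Carrier
      nonneg : ∀ v → 0# ≤ mass v

  open MassDistribution public

  ∑ : List V → (V → Carrier) → Carrier
  ∑ vs f = foldr _+_ 0# (map f vs)

  indicator : V → V → Carrier
  indicator v w = if does (v ≟ w) then 1# else 0#

  δ : V → MassDistribution
  δ v .mass = indicator v
  δ v .nonneg w with does (v ≟ w)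
  ... | true  = 0≤1
  ... | false = ≤-refl

  topple : V → Carrier → (V → Carrier) → (V → Carrier)
  topple v m μ w = μ w - m * indicator v w
    + m * fromℕ (degree v) ⁻¹ * ∑ (nbrs v) (λ y → indicator y w)

  -- The condition m ≤ μ v keeps the new masses nonnegative.
  _⟶_ : MassDistribution → MassDistribution → Set
  μ ⟶ ν = ∃[ v ] ∃[ m ] 0# < m × m ≤ mass μ v
    × (∀ w → mass ν w ≈ topple v m (mass μ) w)

  -- Σ_{v ∉ A} μ(v) ≥ p, the sum of a nonnegative family being the
  -- supremum (possibly ∞) of its sums over finite sets of vertices.
  OutsideMass≥ : (V → Set) → MassDistribution → Carrier → Set
  OutsideMass≥ A μ p = ∀ q → q < p →
    ∃[ vs ] Unique vs × All (λ v → ¬ A v) vs × q < ∑ vs (mass μ)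

  CanTransport : Carrier → (V → Set) → MassDistribution → ℕ → Set
  CanTransport p A μ₀ N =
    ∃[ μ ] Σ[ s ∈ Star _⟶_ μ₀ μ ] ∣ s ∣ ≡ N × OutsideMass≥ A μ p

  -- N_p(G, A, μ₀) is finite and equal to N.
  IsToppleNumber : Carrier → (V → Set) → MassDistribution → ℕ → Set
  IsToppleNumber p A μ₀ N =
    CanTransport p A μ₀ N × (∀ M → CanTransport p A μ₀ M → N ℕ.≤ M)

{-# OPTIONS --safe #-}
-- A mass distribution reached from δ_ρ acts on functions of the vertices as a
-- positive functional E, and toppling does not increase E F when F is
-- superharmonic.  Write a and b for the distances to ρ in the two factors.  The
-- simple random walk drifts at rates proportional to d - 1 and k - 1, so mass
-- reaching distance n should sit where a : b is close to (d - 1) : (k - 1), and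
-- there dᵃ kᵇ is about θⁿ.  Exponential superharmonic weights that are large
-- where the ratio is off on one side bound the mass at such vertices.
--
-- Lower bound: the functions d^(- dist in T_d to s) k^(- dist in T_k to t) are
-- superharmonic, so at most d⁻ᵃ k⁻ᵇ mass can sit at a vertex (s , t).  Where a is
-- not too small this is about θ⁻ⁿ at most (as d ≥ k), and N topplings reach only
-- O(N) vertices.
--
-- Upper bound: topple, as long as possible, a vertex of the ball with mass above
-- a threshold t and with a not too large.  Each step raises E (a + b) by a multiple
-- of t and E (a + b) ≤ n, so this ends after O(n / t) steps.  About θⁿ vertices
-- are eligible, so t of order θ⁻ⁿ leaves little mass on them.
--
-- With M in place of 1 / ε the drift ratio is perturbed rationally, and all
-- estimates become integer inequalities between powers of N and of
-- X = d^(d - 1) k^(k - 1) = θ^(d + k - 2).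

module Submission where

open import Algebra.Bundles using (RawRing)
open import Axiom.ExcludedMiddle using (ExcludedMiddle)
open import Data.Empty using (⊥)
open import Data.Integer.Base as ℤ using (ℤ; +_; -[1+_])
import Data.Integer.Properties as ℤ
open import Data.List.Base
  using (List; []; _∷_; _++_; length; map; filter; foldr; concatMap; deduplicate; upTo)
import Data.List.Membership.DecPropositional as DecMembership
open import Data.List.Membership.Propositional using (_∈_; _∉_; find; lose)
open import Data.List.Membership.Propositional.Properties
  using (∈-++⁻; ∈-map⁺; ∈-map⁻; ∈-filter⁺; ∈-filter⁻; ∈-concatMap⁺; ∈-concatMap⁻;
         ∈-deduplicate⁺; ∈-deduplicate⁻; ∈-upTo⁺)
import Data.List.Properties as List
open import Data.List.Relation.Unary.All as All using (All; []; _∷_)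
import Data.List.Relation.Unary.All.Properties as All
open import Data.List.Relation.Unary.AllPairs using ([]; _∷_)
open import Data.List.Relation.Unary.Any using (here; there)
open import Data.List.Relation.Unary.Unique.DecPropositional.Properties using (deduplicate-!)
open import Data.List.Relation.Unary.Unique.Propositional using (Unique)
import Data.List.Relation.Unary.Unique.Propositional.Properties as Unique
open import Data.Maybe.Base using (just; nothing)
open import Data.Nat.Base as ℕ using (ℕ; zero; suc)
import Data.Nat.DivMod as ℕ
import Data.Nat.GCD as ℕ
import Data.Nat.Properties as ℕ
open import Data.Nat.Tactic.RingSolver using (solve-∀)
open import Data.Product.Base using (∃; ∃-syntax; Σ-syntax; _×_; _,_; proj₁; proj₂)
open import Data.Rational.Base as ℚ using (ℚ; ↥_; ↧ₙ_)
import Data.Rational.Properties as ℚ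
open import Data.Sum.Base using (_⊎_; inj₁; inj₂)
open import Level using (0ℓ)
open import Relation.Binary.Bundles using (Poset)
open import Relation.Binary.Construct.Closure.ReflexiveTransitive using (Star; ε; _◅_; _◅◅_; gmap; revApp)
import Relation.Binary.Construct.NonStrictToStrict as NonStrictToStrict
open import Relation.Binary.Definitions using (WeaklyDecidable)
open import Relation.Binary.PropositionalEquality.Core as ≡ using (_≡_; _≢_)
open import Relation.Binary.Structures using (IsTotalOrder)
open import Relation.Nullary.Decidable.Core using (Dec; yes; no)
open import Relation.Nullary.Negation.Core using (¬_; contradiction)
open import Defs

-- A mass distribution is a bare function on an infinite vertex set, so sums against it are not at
-- hand. Each distribution reached is therefore carried along with a finite list of weighted point
-- evaluations, whose length also bounds the number of vertices reached. The mass where the ratio is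
-- off only has to tend to 0, so Markov's inequality with a weight growing linearly in n suffices.
-- At the exact ratio (d - 1) : (k - 1) the first-order terms of the superharmonicity condition
-- cancel and the second-order terms have the wrong sign; the `+ 1` in `Q` tilts the ratio enough to
-- pay for them. Control on one side is enough for each bound: since d ≥ k, moving a unit from b to
-- a never decreases dᵃ kᵇ. Small a is the danger for the lower bound, which needs dᵃ kᵇ large, and
-- large a for the upper bound, which needs it small.

-- A ring solver with integer coefficients.

module FieldSolver (ℝ : CompleteOrderedField) where
  open CompleteOrderedField ℝ
    renaming (refl to ≈-refl; sym to ≈-sym; trans to ≈-trans)
  open RealPowers ℝ using (fromℕ)
  open import Algebra.Properties.Semiring.Mult semiring
    using (×-homo-+; ×1-homo-*)

  module Coefficients where
    open import Algebra.Properties.Monoid.Mult.TCOptimised +-monoid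
      using () renaming (×ᵤ≈× to ×≈×′)
    open import Algebra.Definitions.RawMonoid (RawRing.+-rawMonoid rawRing)
      using (_×′_)
    open import Algebra.Properties.Ring ring
      using (-‿involutive; -‿distribˡ-*; -‿distribʳ-*; -0#≈0#; -‿+-comm)
    open import Relation.Binary.Reasoning.Setoid setoid

    -- The optimised multiple `_×′_` makes `num 1` reduce to `1#`, whereas `fromℕ 1` is `1# + 0#`.
    -- Hence `con (+ 1)` can stand for a literal `1#` in the goals.
    num : ℕ → Carrier
    num n = n ×′ 1#

    num-suc : ∀ n → num (suc n) ≈ 1# + num n
    num-suc n = begin
      num (suc n)     ≈⟨ ×≈×′ (suc n) 1# ⟨
      1# + fromℕ n    ≈⟨ +-congˡ (×≈×′ n 1#) ⟩
      1# + num n      ∎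

    num-+ : ∀ m n → num (m ℕ.+ n) ≈ num m + num n
    num-+ m n = begin
      num (m ℕ.+ n)      ≈⟨ ×≈×′ (m ℕ.+ n) 1# ⟨
      fromℕ (m ℕ.+ n)    ≈⟨ ×-homo-+ 1# m n ⟩
      fromℕ m + fromℕ n  ≈⟨ +-cong (×≈×′ m 1#) (×≈×′ n 1#) ⟩
      num m + num n      ∎

    num-* : ∀ m n → num (m ℕ.* n) ≈ num m * num n
    num-* m n = begin
      num (m ℕ.* n)      ≈⟨ ×≈×′ (m ℕ.* n) 1# ⟨
      fromℕ (m ℕ.* n)    ≈⟨ ×1-homo-* m n ⟩
      fromℕ m * fromℕ n  ≈⟨ *-cong (×≈×′ m 1#) (×≈×′ n 1#) ⟩
      num m * num n      ∎

    ⟦_⟧ : ℤ → Carrier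
    ⟦ + n ⟧      = num n
    ⟦ -[1+ n ] ⟧ = - num (suc n)

    ⟦⊖⟧ : ∀ m n → ⟦ m ℤ.⊖ n ⟧ ≈ num m - num n
    ⟦⊖⟧ m       zero    = ≈-sym (≈-trans (+-congˡ -0#≈0#) (+-identityʳ _))
    ⟦⊖⟧ zero    (suc n) = ≈-sym (+-identityˡ _)
    ⟦⊖⟧ (suc m) (suc n) = begin
      ⟦ suc m ℤ.⊖ suc n ⟧                  ≡⟨ ≡.cong ⟦_⟧ (ℤ.[1+m]⊖[1+n]≡m⊖n m n) ⟩
      ⟦ m ℤ.⊖ n ⟧                          ≈⟨ ⟦⊖⟧ m n ⟩
      num m - num n                        ≈⟨ +-congʳ (+-identityʳ _) ⟨
      num m + 0# - num n                   ≈⟨ +-congʳ (+-congˡ (-‿inverseʳ 1#)) ⟨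
      num m + (1# - 1#) - num n            ≈⟨ +-congʳ (+-assoc _ _ _) ⟨
      num m + 1# - 1# - num n              ≈⟨ +-assoc _ _ _ ⟩
      num m + 1# + (- 1# - num n)          ≈⟨ +-cong (+-comm _ _) (-‿+-comm _ _) ⟩
      1# + num m - (1# + num n)            ≈⟨ +-cong (num-suc m) (-‿cong (num-suc n)) ⟨
      num (suc m) - num (suc n)            ∎

    ⟦-⟧ : ∀ i → ⟦ ℤ.- i ⟧ ≈ - ⟦ i ⟧
    ⟦-⟧ (+ zero)  = ≈-sym -0#≈0#
    ⟦-⟧ (+ suc n) = ≈-refl
    ⟦-⟧ -[1+ n ]  = ≈-sym (-‿involutive _)

    ⟦+⟧ : ∀ i j → ⟦ i ℤ.+ j ⟧ ≈ ⟦ i ⟧ + ⟦ j ⟧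
    ⟦+⟧ (+ m)    (+ n)    = num-+ m n
    ⟦+⟧ (+ m)    -[1+ n ] = ⟦⊖⟧ m (suc n)
    ⟦+⟧ -[1+ m ] (+ n)    = ≈-trans (⟦⊖⟧ n (suc m)) (+-comm _ _)
    ⟦+⟧ -[1+ m ] -[1+ n ] = begin
      - num (suc (suc (m ℕ.+ n)))       ≡⟨ ≡.cong (λ s → - num (suc s)) (ℕ.+-suc m n) ⟨
      - num (suc m ℕ.+ suc n)           ≈⟨ -‿cong (num-+ (suc m) (suc n)) ⟩
      - (num (suc m) + num (suc n))     ≈⟨ -‿+-comm _ _ ⟨
      - num (suc m) - num (suc n)       ∎

    ⟦*⟧ : ∀ i j → ⟦ i ℤ.* j ⟧ ≈ ⟦ i ⟧ * ⟦ j ⟧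
    ⟦*⟧ (+ m) (+ n) = begin
      ⟦ + m ℤ.* + n ⟧  ≡⟨ ≡.cong ⟦_⟧ (ℤ.pos-* m n) ⟨
      num (m ℕ.* n)    ≈⟨ num-* m n ⟩
      num m * num n    ∎
    ⟦*⟧ (+ m) -[1+ n ] = begin
      ⟦ + m ℤ.* -[1+ n ] ⟧        ≡⟨ ≡.cong ⟦_⟧ (ℤ.neg-distribʳ-* (+ m) (+ suc n)) ⟨
      ⟦ ℤ.- (+ m ℤ.* + suc n) ⟧   ≈⟨ ⟦-⟧ (+ m ℤ.* + suc n) ⟩
      - ⟦ + m ℤ.* + suc n ⟧       ≈⟨ -‿cong (⟦*⟧ (+ m) (+ suc n)) ⟩
      - (num m * num (suc n))     ≈⟨ -‿distribʳ-* _ _ ⟩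
      num m * - num (suc n)       ∎
    ⟦*⟧ -[1+ m ] (+ n) = begin
      ⟦ -[1+ m ] ℤ.* + n ⟧        ≡⟨ ≡.cong ⟦_⟧ (ℤ.neg-distribˡ-* (+ suc m) (+ n)) ⟨
      ⟦ ℤ.- (+ suc m ℤ.* + n) ⟧   ≈⟨ ⟦-⟧ (+ suc m ℤ.* + n) ⟩
      - ⟦ + suc m ℤ.* + n ⟧       ≈⟨ -‿cong (⟦*⟧ (+ suc m) (+ n)) ⟩
      - (num (suc m) * num n)     ≈⟨ -‿distribˡ-* _ _ ⟩
      - num (suc m) * num n       ∎
    ⟦*⟧ -[1+ m ] -[1+ n ] = begin
      num (suc m ℕ.* suc n)             ≈⟨ num-* (suc m) (suc n) ⟩
      num (suc m) * num (suc n)         ≈⟨ -‿involutive _ ⟨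
      - - (num (suc m) * num (suc n))   ≈⟨ -‿cong (-‿distribˡ-* _ _) ⟩
      - (- num (suc m) * num (suc n))   ≈⟨ -‿distribʳ-* _ _ ⟩
      - num (suc m) * - num (suc n)     ∎

  module Solver where
    open import Algebra.Solver.Ring.AlmostCommutativeRing
    open Coefficients

    private
      target : AlmostCommutativeRing 0ℓ 0ℓ
      target = fromCommutativeRing commutativeRing

      morphism : ℤ.+-*-rawRing -Raw-AlmostCommutative⟶ target
      morphism = record
        { ⟦_⟧ = ⟦_⟧ ; +-homo = ⟦+⟧ ; *-homo = ⟦*⟧ ; -‿homo = ⟦-⟧
        ; 0-homo = ≈-refl ; 1-homo = ≈-refl }

      _≟_ : WeaklyDecidable (Induced-equivalence morphism)
      i ≟ j with i ℤ.≟ j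
      ... | yes i≡j = just (reflexive (≡.cong ⟦_⟧ i≡j))
      ... | no  _   = nothing

    open import Algebra.Solver.Ring ℤ.+-*-rawRing target morphism _≟_ public
      using (solve; _:=_; _:+_; _:*_; _:-_; :-_; con)

-- Ordered-field arithmetic and the Archimedean property.

module OrderedField (em : ExcludedMiddle 0ℓ) (ℝ : CompleteOrderedField) where
  open CompleteOrderedField ℝ
    renaming (refl to ≈-refl; sym to ≈-sym; trans to ≈-trans)
  open RealPowers ℝ using (_^_; fromℕ)
  open import Algebra.Properties.Semiring.Exp semiring
    using (^-congˡ; ^-congʳ; ^-homo-*; ^-assocʳ) public
  open import Algebra.Properties.CommutativeSemiring.Exp commutativeSemiring
    using (^-distrib-*) public
  open import Algebra.Properties.Semiring.Mult semiring
    using (×-homo-+; ×-homo-1; ×1-homo-*)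
  open FieldSolver ℝ public
  open Solver

  poset : Poset 0ℓ 0ℓ 0ℓ
  poset = record { isPartialOrder = IsTotalOrder.isPartialOrder isTotalOrder }

  module ≤-Reasoning where
    open import Relation.Binary.Reasoning.PartialOrder poset public

  open Poset poset using (≤-respʳ-≈; ≤-respˡ-≈) public

  private module Strict = NonStrictToStrict _≈_ _≤_

  ≈⇒≤ : ∀ {x y} → x ≈ y → x ≤ y
  ≈⇒≤ = ≤-reflexive

  ≈⇒≥ : ∀ {x y} → x ≈ y → y ≤ x
  ≈⇒≥ x≈y = ≤-reflexive (≈-sym x≈y)

  <⇒≤ : ∀ {x y} → x < y → x ≤ y
  <⇒≤ = proj₁

  <-≤-trans : ∀ {x y z} → x < y → y ≤ z → x < z
  <-≤-trans = Strict.<-≤-trans ≈-sym ≤-trans antisym ≤-respʳ-≈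

  ≤-<-trans : ∀ {x y z} → x ≤ y → y < z → x < z
  ≤-<-trans = Strict.≤-<-trans ≤-trans antisym ≤-respˡ-≈

  ≤⇒≯ : ∀ {x y} → x ≤ y → ¬ y < x
  ≤⇒≯ x≤y (y≤x , y≉x) = y≉x (antisym y≤x x≤y)

  ≰⇒> : ∀ {x y} → ¬ x ≤ y → y < x
  ≰⇒> {x} {y} x≰y with total x y
  ... | inj₁ x≤y = contradiction x≤y x≰y
  ... | inj₂ y≤x = y≤x , λ y≈x → x≰y (≈⇒≥ y≈x)

  ≤⊎> : ∀ x y → x ≤ y ⊎ y < x
  ≤⊎> x y with em {x ≤ y}
  ... | yes x≤y = inj₁ x≤y
  ... | no  x≰y = inj₂ (≰⇒> x≰y)

  ≮⇒≥ : ∀ {x y} → ¬ x < y → y ≤ x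
  ≮⇒≥ {x} {y} x≮y with ≤⊎> y x
  ... | inj₁ y≤x = y≤x
  ... | inj₂ x<y = contradiction x<y x≮y

  0<1 : 0# < 1#
  0<1 = 0≤1 , 0≉1

  +-monoʳ-≤ : ∀ z {x y} → x ≤ y → z + x ≤ z + y
  +-monoʳ-≤ z x≤y = ≤-respˡ-≈ (+-comm _ _) (≤-respʳ-≈ (+-comm _ _) (+-monoˡ-≤ z x≤y))

  +-mono-≤ : ∀ {x y u v} → x ≤ y → u ≤ v → x + u ≤ y + v
  +-mono-≤ {y = y} {u} x≤y u≤v = ≤-trans (+-monoˡ-≤ u x≤y) (+-monoʳ-≤ y u≤v)

  x≤y⇒0≤y-x : ∀ {x y} → x ≤ y → 0# ≤ y - x
  x≤y⇒0≤y-x {x} x≤y = ≤-respˡ-≈ (-‿inverseʳ x) (+-monoˡ-≤ (- x) x≤y)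

  -- The standard route to polynomial inequalities below: the slack `e` is written out as a visibly
  -- nonnegative expression, and an identity for the ring solver remains.
  ≤-excess : ∀ {x y e} → 0# ≤ e → x + e ≈ y → x ≤ y
  ≤-excess {x} 0≤e x+e≈y = ≤-respˡ-≈ (+-identityʳ x) (≤-respʳ-≈ x+e≈y (+-monoʳ-≤ x 0≤e))

  +-nonneg : ∀ {x y} → 0# ≤ x → 0# ≤ y → 0# ≤ x + y
  +-nonneg 0≤x 0≤y = ≤-respˡ-≈ (+-identityʳ 0#) (+-mono-≤ 0≤x 0≤y)

  neg-mono-≤ : ∀ {x y} → x ≤ y → - y ≤ - x
  neg-mono-≤ {x} {y} x≤y = ≤-excess (x≤y⇒0≤y-x x≤y)
    (solve 2 (λ x y → :- y :+ (y :- x) := :- x) ≈-refl x y)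

  +-cancelˡ-≤ : ∀ z {x y} → z + x ≤ z + y → x ≤ y
  +-cancelˡ-≤ z {x} {y} le = ≤-excess (x≤y⇒0≤y-x le)
    (solve 3 (λ x y z → x :+ (z :+ y :- (z :+ x)) := y) ≈-refl x y z)

  +-mono-<-≤ : ∀ {x y u v} → x < y → u ≤ v → x + u < y + v
  +-mono-<-≤ {x} {y} {u} {v} x<y u≤v = ≰⇒> λ le → ≤⇒≯ (+-cancelˡ-≤ u
    (≤-trans (+-monoˡ-≤ y u≤v) (≤-respˡ-≈ (+-comm y v) (≤-respʳ-≈ (+-comm x u) le)))) x<y

  0<y-x : ∀ {x y} → x < y → 0# < y - x
  0<y-x {x} x<y = ≤-<-trans (≈⇒≥ (-‿inverseʳ x)) (+-mono-<-≤ x<y ≤-refl)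

  *-monoˡ-≤ : ∀ {z x y} → 0# ≤ z → x ≤ y → z * x ≤ z * y
  *-monoˡ-≤ {z} {x} {y} 0≤z x≤y = ≤-excess (*-nonneg 0≤z (x≤y⇒0≤y-x x≤y))
    (solve 3 (λ x y z → z :* x :+ z :* (y :- x) := z :* y) ≈-refl x y z)

  *-monoʳ-≤ : ∀ {z x y} → 0# ≤ z → x ≤ y → x * z ≤ y * z
  *-monoʳ-≤ 0≤z x≤y = ≤-respˡ-≈ (*-comm _ _) (≤-respʳ-≈ (*-comm _ _) (*-monoˡ-≤ 0≤z x≤y))

  *-mono-≤ : ∀ {x y u v} → 0# ≤ y → 0# ≤ u → x ≤ y → u ≤ v → x * u ≤ y * v
  *-mono-≤ 0≤y 0≤u x≤y u≤v = ≤-trans (*-monoʳ-≤ 0≤u x≤y) (*-monoˡ-≤ 0≤y u≤v)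

  >⇒≉ : ∀ {x} → 0# < x → ¬ x ≈ 0#
  >⇒≉ 0<x x≈0 = proj₂ 0<x (≈-sym x≈0)

  *-inverse : ∀ {x} → 0# < x → x * x ⁻¹ ≈ 1#
  *-inverse 0<x = *-inverseʳ (>⇒≉ 0<x)

  *-pos : ∀ {x y} → 0# < x → 0# < y → 0# < x * y
  *-pos {x} {y} 0<x 0<y = *-nonneg (<⇒≤ 0<x) (<⇒≤ 0<y) , λ 0≈xy → proj₂ 0<y (begin-equality
    0#                ≈⟨ zeroˡ _ ⟨
    0# * x ⁻¹         ≈⟨ *-congʳ 0≈xy ⟩
    x * y * x ⁻¹      ≈⟨ solve 3 (λ x y z → x :* y :* z := y :* (x :* z)) ≈-refl x y (x ⁻¹) ⟩
    y * (x * x ⁻¹)    ≈⟨ *-congˡ (*-inverse 0<x) ⟩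
    y * 1#            ≈⟨ *-identityʳ y ⟩
    y                 ∎)
    where open ≤-Reasoning

  ⁻¹-pos : ∀ {x} → 0# < x → 0# < x ⁻¹
  ⁻¹-pos {x} 0<x = ≰⇒> λ x⁻¹≤0 → ≤⇒≯ (begin
    1#         ≈⟨ *-inverse 0<x ⟨
    x * x ⁻¹   ≤⟨ *-monoˡ-≤ (<⇒≤ 0<x) x⁻¹≤0 ⟩
    x * 0#     ≈⟨ zeroʳ x ⟩
    0#         ∎) 0<1
    where open ≤-Reasoning

  ⁻¹-cancelˡ : ∀ {x} y → 0# < x → x ⁻¹ * (x * y) ≈ y
  ⁻¹-cancelˡ {x} y 0<x = ≈-trans (≈-sym (*-assoc _ _ _))
    (≈-trans (*-congʳ (≈-trans (*-comm _ _) (*-inverse 0<x))) (*-identityˡ y))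

  *⁻¹-cancel : ∀ {x} y → 0# < x → y * x ⁻¹ * x ≈ y
  *⁻¹-cancel {x} y 0<x = ≈-trans (*-assoc _ _ _)
    (≈-trans (*-congˡ (≈-trans (*-comm _ _) (*-inverse 0<x))) (*-identityʳ y))

  *-cancelˡ-≤ : ∀ {z x y} → 0# < z → z * x ≤ z * y → x ≤ y
  *-cancelˡ-≤ {z} {x} {y} 0<z le = ≤-respˡ-≈ (⁻¹-cancelˡ x 0<z)
    (≤-respʳ-≈ (⁻¹-cancelˡ y 0<z) (*-monoˡ-≤ (<⇒≤ (⁻¹-pos 0<z)) le))

  *-cancelʳ-≤ : ∀ {z x y} → 0# < z → x * z ≤ y * z → x ≤ y
  *-cancelʳ-≤ 0<z le = *-cancelˡ-≤ 0<z (≤-respˡ-≈ (*-comm _ _) (≤-respʳ-≈ (*-comm _ _) le))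

  *-monoˡ-< : ∀ {z x y} → 0# < z → x < y → z * x < z * y
  *-monoˡ-< 0<z x<y = ≰⇒> λ le → ≤⇒≯ (*-cancelˡ-≤ 0<z le) x<y

  x≤y*z⇒x*y⁻¹≤z : ∀ {x y z} → 0# < y → x ≤ z * y → x * y ⁻¹ ≤ z
  x≤y*z⇒x*y⁻¹≤z 0<y le = *-cancelʳ-≤ 0<y (≤-respˡ-≈ (≈-sym (*⁻¹-cancel _ 0<y)) le)

  x*y≤z⇒x≤z*y⁻¹ : ∀ {x y z} → 0# < y → x * y ≤ z → x ≤ z * y ⁻¹
  x*y≤z⇒x≤z*y⁻¹ 0<y le = *-cancelʳ-≤ 0<y (≤-respʳ-≈ (≈-sym (*⁻¹-cancel _ 0<y)) le)

  x≤z*y⁻¹⇒x*y≤z : ∀ {x y z} → 0# < y → x ≤ z * y ⁻¹ → x * y ≤ z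
  x≤z*y⁻¹⇒x*y≤z 0<y le = ≤-respʳ-≈ (*⁻¹-cancel _ 0<y) (*-monoʳ-≤ (<⇒≤ 0<y) le)

  x*y⁻¹≤z⇒x≤z*y : ∀ {x y z} → 0# < y → x * y ⁻¹ ≤ z → x ≤ z * y
  x*y⁻¹≤z⇒x≤z*y 0<y le = ≤-respˡ-≈ (*⁻¹-cancel _ 0<y) (*-monoʳ-≤ (<⇒≤ 0<y) le)

  1^n≈1 : ∀ n → 1# ^ n ≈ 1#
  1^n≈1 zero    = ≈-refl
  1^n≈1 (suc n) = ≈-trans (*-identityˡ _) (1^n≈1 n)

  ^-nonneg : ∀ {x} n → 0# ≤ x → 0# ≤ x ^ n
  ^-nonneg zero    0≤x = 0≤1
  ^-nonneg (suc n) 0≤x = *-nonneg 0≤x (^-nonneg n 0≤x)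

  ^-pos : ∀ {x} n → 0# < x → 0# < x ^ n
  ^-pos zero    0<x = 0<1
  ^-pos (suc n) 0<x = *-pos 0<x (^-pos n 0<x)

  ^-monoˡ-≤ : ∀ {x y} n → 0# ≤ x → x ≤ y → x ^ n ≤ y ^ n
  ^-monoˡ-≤ zero    0≤x x≤y = ≤-refl
  ^-monoˡ-≤ (suc n) 0≤x x≤y =
    *-mono-≤ (≤-trans 0≤x x≤y) (^-nonneg n 0≤x) x≤y (^-monoˡ-≤ n 0≤x x≤y)

  ^-cancel-≤ : ∀ {x y} n → 1 ℕ.≤ n → 0# ≤ y → x ^ n ≤ y ^ n → x ≤ y
  ^-cancel-≤ {x} {y} (suc n) _ 0≤y le = ≮⇒≥ λ y<x → ≤⇒≯ le (begin-strict
    y * y ^ n   ≤⟨ *-monoˡ-≤ 0≤y (^-monoˡ-≤ n 0≤y (<⇒≤ y<x)) ⟩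
    y * x ^ n   ≈⟨ *-comm _ _ ⟩
    x ^ n * y   <⟨ *-monoˡ-< (^-pos n (≤-<-trans 0≤y y<x)) y<x ⟩
    x ^ n * x   ≈⟨ *-comm _ _ ⟩
    x * x ^ n   ∎)
    where open ≤-Reasoning

  ^-cancel-≈ : ∀ {x y} n → 1 ℕ.≤ n → 0# ≤ x → 0# ≤ y → x ^ n ≈ y ^ n → x ≈ y
  ^-cancel-≈ n 1≤n 0≤x 0≤y e =
    antisym (^-cancel-≤ n 1≤n 0≤y (≈⇒≤ e)) (^-cancel-≤ n 1≤n 0≤x (≈⇒≥ e))

  1≤^ : ∀ {x} n → 1# ≤ x → 1# ≤ x ^ n
  1≤^ n 1≤x = ≤-respˡ-≈ (1^n≈1 n) (^-monoˡ-≤ n 0≤1 1≤x)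

  ^-monoʳ-≤ : ∀ {x m n} → 1# ≤ x → m ℕ.≤ n → x ^ m ≤ x ^ n
  ^-monoʳ-≤ {x} {m} {n} 1≤x m≤n = begin
    x ^ m                  ≈⟨ *-identityʳ _ ⟨
    x ^ m * 1#             ≤⟨ *-monoˡ-≤ (^-nonneg m (≤-trans 0≤1 1≤x)) (1≤^ (n ℕ.∸ m) 1≤x) ⟩
    x ^ m * x ^ (n ℕ.∸ m)  ≈⟨ ^-homo-* x m (n ℕ.∸ m) ⟨
    x ^ (m ℕ.+ (n ℕ.∸ m))  ≡⟨ ≡.cong (x ^_) (ℕ.m+[n∸m]≡n m≤n) ⟩
    x ^ n                  ∎
    where open ≤-Reasoning

  ^-cancelʳ-≤ : ∀ {x m n} → 1# < x → x ^ m ≤ x ^ n → m ℕ.≤ n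
  ^-cancelʳ-≤ {x} {m} {n} 1<x le with m ℕ.≤? n
  ... | yes m≤n = m≤n
  ... | no  m≰n = contradiction (begin-strict
      x ^ n        ≈⟨ *-identityʳ _ ⟨
      x ^ n * 1#   <⟨ *-monoˡ-< (^-pos n (<-≤-trans 0<1 (<⇒≤ 1<x))) 1<x ⟩
      x ^ n * x    ≈⟨ *-comm _ _ ⟩
      x ^ suc n    ≤⟨ ^-monoʳ-≤ (<⇒≤ 1<x) (ℕ.≰⇒> m≰n) ⟩
      x ^ m        ∎) (≤⇒≯ le)
    where open ≤-Reasoning

  fromℕ-+ : ∀ m n → fromℕ (m ℕ.+ n) ≈ fromℕ m + fromℕ n
  fromℕ-+ = ×-homo-+ 1#

  fromℕ-* : ∀ m n → fromℕ (m ℕ.* n) ≈ fromℕ m * fromℕ n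
  fromℕ-* = ×1-homo-*

  fromℕ-1 : fromℕ 1 ≈ 1#
  fromℕ-1 = ×-homo-1 1#

  fromℕ-^ : ∀ m n → fromℕ (m ℕ.^ n) ≈ fromℕ m ^ n
  fromℕ-^ m zero    = fromℕ-1
  fromℕ-^ m (suc n) = ≈-trans (fromℕ-* m (m ℕ.^ n)) (*-congˡ (fromℕ-^ m n))

  fromℕ-nonneg : ∀ n → 0# ≤ fromℕ n
  fromℕ-nonneg zero    = ≤-refl
  fromℕ-nonneg (suc n) = +-nonneg 0≤1 (fromℕ-nonneg n)

  fromℕ-mono-≤ : ∀ {m n} → m ℕ.≤ n → fromℕ m ≤ fromℕ n
  fromℕ-mono-≤ {n = n} ℕ.z≤n = fromℕ-nonneg n
  fromℕ-mono-≤ (ℕ.s≤s m≤n)   = +-monoʳ-≤ 1# (fromℕ-mono-≤ m≤n)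

  fromℕ-mono-< : ∀ {m n} → m ℕ.< n → fromℕ m < fromℕ n
  fromℕ-mono-< {m} m<n = <-≤-trans
    (≤-<-trans (≈⇒≥ (+-identityˡ _)) (+-mono-<-≤ 0<1 (≤-refl {fromℕ m}))) (fromℕ-mono-≤ m<n)

  fromℕ-cancel-≤ : ∀ {m n} → fromℕ m ≤ fromℕ n → m ℕ.≤ n
  fromℕ-cancel-≤ {m} {n} le with m ℕ.≤? n
  ... | yes m≤n = m≤n
  ... | no  m≰n = contradiction (fromℕ-mono-< (ℕ.≰⇒> m≰n)) (≤⇒≯ le)

  fromℕ-pos : ∀ {n} → 1 ℕ.≤ n → 0# < fromℕ n
  fromℕ-pos 1≤n = fromℕ-mono-< 1≤n

  1≤fromℕ : ∀ {n} → 1 ℕ.≤ n → 1# ≤ fromℕ n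
  1≤fromℕ 1≤n = ≤-respˡ-≈ fromℕ-1 (fromℕ-mono-≤ 1≤n)

  bernoulli : ∀ {h} n → 0# ≤ h → 1# + fromℕ n * h ≤ (1# + h) ^ n
  bernoulli {h} zero    0≤h = ≈⇒≤ (≈-trans (+-congˡ (zeroˡ h)) (+-identityʳ 1#))
  bernoulli {h} (suc n) 0≤h = begin
    1# + (1# + fromℕ n) * h           ≤⟨ ≤-excess (*-nonneg (fromℕ-nonneg n) (*-nonneg 0≤h 0≤h))
      (solve 2 (λ m h → con (+ 1) :+ (con (+ 1) :+ m) :* h :+ m :* (h :* h)
                     := (con (+ 1) :+ h) :* (con (+ 1) :+ m :* h)) ≈-refl (fromℕ n) h) ⟩
    (1# + h) * (1# + fromℕ n * h)     ≤⟨ *-monoˡ-≤ (+-nonneg 0≤1 0≤h) (bernoulli n 0≤h) ⟩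
    (1# + h) * (1# + h) ^ n           ∎
    where open ≤-Reasoning

  -- If the naturals were bounded with supremum `s`, then `n + 1 ≤ s` for all `n` would make
  -- `s - 1#` a smaller upper bound.
  archimedean : ∀ x → ∃[ n ] x < fromℕ n
  archimedean x with em {∃[ n ] x < fromℕ n}
  ... | yes p = p
  ... | no ¬p = contradiction (begin-strict
      s             ≈⟨ +-identityˡ s ⟨
      0# + s        <⟨ +-mono-<-≤ 0<1 ≤-refl ⟩
      1# + s        ≈⟨ +-comm 1# s ⟩
      s + 1#        ≤⟨ +-monoˡ-≤ 1# (sup-least Nat (0# , 0 , ≈-refl) bounded s-1-bound) ⟩
      s - 1# + 1#   ≈⟨ solve 1 (λ s → s :- con (+ 1) :+ con (+ 1) := s) ≈-refl s ⟩
      s             ∎) (≤⇒≯ ≤-refl)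
    where
    open ≤-Reasoning
    Nat : Carrier → Set
    Nat y = ∃[ n ] y ≈ fromℕ n
    bounded : ∃ (UpperBound Nat)
    bounded = x , λ { (n , y≈n) → ≤-trans (≈⇒≤ y≈n) (≮⇒≥ λ x<n → ¬p (n , x<n)) }
    s : Carrier
    s = sup Nat
    s-1-bound : UpperBound Nat (s - 1#)
    s-1-bound {y} (n , y≈n) = begin
      y                   ≈⟨ y≈n ⟩
      fromℕ n             ≈⟨ solve 1 (λ n → n := con (+ 1) :+ n :- con (+ 1)) ≈-refl _ ⟩
      fromℕ (suc n) - 1#  ≤⟨ +-monoˡ-≤ (- 1#) (sup-upper Nat (0# , 0 , ≈-refl) bounded (suc n , ≈-refl)) ⟩
      s - 1#              ∎

  ^-unbounded : ∀ {x} → 1# < x → ∀ y → ∃[ n ] y < x ^ n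
  ^-unbounded {x} 1<x y with archimedean (y * (x - 1#) ⁻¹)
  ... | n , lt = n , (begin-strict
      y                           ≈⟨ *⁻¹-cancel y 0<h ⟨
      y * (x - 1#) ⁻¹ * (x - 1#)  ≈⟨ *-comm _ _ ⟩
      (x - 1#) * (y * (x - 1#) ⁻¹) <⟨ *-monoˡ-< 0<h lt ⟩
      (x - 1#) * fromℕ n          ≤⟨ ≤-excess 0≤1
        (solve 2 (λ x n → (x :- con (+ 1)) :* n :+ con (+ 1) := con (+ 1) :+ n :* (x :- con (+ 1))) ≈-refl x _) ⟩
      1# + fromℕ n * (x - 1#)     ≤⟨ bernoulli n (<⇒≤ 0<h) ⟩
      (1# + (x - 1#)) ^ n         ≈⟨ ^-congˡ n (solve 1 (λ x → con (+ 1) :+ (x :- con (+ 1)) := x) ≈-refl x) ⟩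
      x ^ n                       ∎)
    where
    open ≤-Reasoning
    0<h : 0# < x - 1#
    0<h = 0<y-x 1<x

-- Roots, rational and real powers, logarithms.

module RealPowersProperties (em : ExcludedMiddle 0ℓ) (ℝ : CompleteOrderedField) where
  open CompleteOrderedField ℝ
    renaming (refl to ≈-refl; sym to ≈-sym; trans to ≈-trans)
  open RealPowers ℝ
  open OrderedField em ℝ
  open Solver
  open ≤-Reasoning

  ^-swap : ∀ x m n → (x ^ m) ^ n ≈ (x ^ n) ^ m
  ^-swap x m n = begin-equality
    (x ^ m) ^ n    ≈⟨ ^-assocʳ x m n ⟩
    x ^ (m ℕ.* n)  ≡⟨ ≡.cong (x ^_) (ℕ.*-comm m n) ⟩
    x ^ (n ℕ.* m)  ≈⟨ ^-assocʳ x n m ⟨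
    (x ^ n) ^ m    ∎

  -- A quantitative substitute for continuity: one constant `C` serves every `t` up to `s` and every
  -- step `h` up to 1.
  ^-lipschitz : ∀ {s} n → 0# ≤ s → ∃[ C ] 0# ≤ C ×
    (∀ {t h} → 0# ≤ t → t ≤ s → 0# ≤ h → h ≤ 1# → (t + h) ^ n ≤ t ^ n + h * C)
  ^-lipschitz zero 0≤s = 0# , ≤-refl ,
    λ {t} {h} _ _ _ _ → ≈⇒≥ (≈-trans (+-congˡ (zeroʳ h)) (+-identityʳ _))
  ^-lipschitz {s} (suc n) 0≤s with ^-lipschitz n 0≤s
  ... | C , 0≤C , bound = s ^ n + (s + 1#) * C ,
    +-nonneg (^-nonneg n 0≤s) (*-nonneg (+-nonneg 0≤s 0≤1) 0≤C) ,
    λ {t} {h} 0≤t t≤s 0≤h h≤1 → begin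
      (t + h) * (t + h) ^ n                  ≤⟨ *-monoˡ-≤ (+-nonneg 0≤t 0≤h) (bound 0≤t t≤s 0≤h h≤1) ⟩
      (t + h) * (t ^ n + h * C)              ≈⟨ solve 4 (λ t h u c → (t :+ h) :* (u :+ h :* c)
                                                  := t :* u :+ h :* (u :+ (t :+ h) :* c)) ≈-refl t h (t ^ n) C ⟩
      t * t ^ n + h * (t ^ n + (t + h) * C)  ≤⟨ +-monoʳ-≤ _ (*-monoˡ-≤ 0≤h
                                                  (+-mono-≤ (^-monoˡ-≤ n 0≤t t≤s) (*-monoʳ-≤ 0≤C (+-mono-≤ t≤s h≤1)))) ⟩
      t * t ^ n + h * (s ^ n + (s + 1#) * C) ∎

  -- The quotient `e / (e + 1# + C)` meets all three bounds at once, without a minimum.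
  small-multiplier : ∀ {C e} → 0# ≤ C → 0# < e → ∃[ h ] 0# < h × h ≤ 1# × h * C < e
  small-multiplier {C} {e} 0≤C 0<e = h , 0<h , *-cancelʳ-≤ 0<den (begin
      h * den  ≈⟨ h*den ⟩
      e        ≤⟨ ≤-excess (+-nonneg 0≤C 0≤1) (solve 2 (λ c e → e :+ (c :+ con (+ 1)) := con (+ 1) :* (e :+ con (+ 1) :+ c)) ≈-refl C e) ⟩
      1# * den ∎) , (begin-strict
      h * C    <⟨ *-monoˡ-< 0<h (≤-<-trans (≈⇒≥ (+-identityˡ C)) (+-mono-<-≤ (<-≤-trans 0<e (≤-excess 0≤1 ≈-refl)) ≤-refl)) ⟩
      h * den  ≈⟨ h*den ⟩
      e        ∎)
    where
    den : Carrier
    den = e + 1# + C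
    0<den : 0# < den
    0<den = <-≤-trans 0<e (≤-excess (+-nonneg 0≤1 0≤C) (≈-sym (+-assoc _ _ _)))
    h : Carrier
    h = e * den ⁻¹
    0<h : 0# < h
    0<h = *-pos 0<e (⁻¹-pos 0<den)
    h*den : h * den ≈ e
    h*den = *⁻¹-cancel e 0<den

  module _ {x : Carrier} {n : ℕ} (1≤n : 1 ℕ.≤ n) (0≤x : 0# ≤ x) where
    private
      P : Carrier → Set
      P t = 0# ≤ t × t ^ n ≤ x

      s : Carrier
      s = root n x

      0∈P : ∃ P
      0∈P = 0# , ≤-refl , ≤-trans (≈⇒≤ (0^ n 1≤n)) 0≤x
        where
        0^ : ∀ n → 1 ℕ.≤ n → 0# ^ n ≈ 0#
        0^ (suc n) _ = zeroˡ _

      bounded : ∃ (UpperBound P)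
      bounded = 1# + x , λ {t} (0≤t , tⁿ≤x) → ^-cancel-≤ n 1≤n (+-nonneg 0≤1 0≤x) (begin
        t ^ n                 ≤⟨ tⁿ≤x ⟩
        x                     ≈⟨ *-identityˡ x ⟨
        1# * x                ≤⟨ *-monoʳ-≤ 0≤x (1≤fromℕ 1≤n) ⟩
        fromℕ n * x           ≤⟨ ≤-excess 0≤1 (+-comm _ _) ⟩
        1# + fromℕ n * x      ≤⟨ bernoulli n 0≤x ⟩
        (1# + x) ^ n          ∎)

    root-nonneg : 0# ≤ root n x
    root-nonneg = sup-upper P 0∈P bounded (proj₂ 0∈P)

    -- A gap between `s ^ n` and `x` leaves room to move `s` by a small `h`: upwards to a larger
    -- member of the set, or downwards to a smaller upper bound.
    root-^ : root n x ^ n ≈ x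
    root-^ = antisym (≮⇒≥ too-large) (≮⇒≥ too-small)
      where
      C : Carrier
      C = proj₁ (^-lipschitz n root-nonneg)
      0≤C : 0# ≤ C
      0≤C = proj₁ (proj₂ (^-lipschitz n root-nonneg))
      lip : ∀ {t h} → 0# ≤ t → t ≤ s → 0# ≤ h → h ≤ 1# → (t + h) ^ n ≤ t ^ n + h * C
      lip = proj₂ (proj₂ (^-lipschitz n root-nonneg))

      too-small : ¬ s ^ n < x
      too-small lt =
        let h , 0<h , h≤1 , hC<e = small-multiplier 0≤C (0<y-x lt) in ≤⇒≯ (sup-upper P 0∈P bounded
              (+-nonneg root-nonneg (<⇒≤ 0<h) , (begin
                (s + h) ^ n            ≤⟨ lip root-nonneg ≤-refl (<⇒≤ 0<h) h≤1 ⟩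
                s ^ n + h * C          ≤⟨ +-monoʳ-≤ _ (<⇒≤ hC<e) ⟩
                s ^ n + (x - s ^ n)    ≈⟨ solve 2 (λ a b → a :+ (b :- a) := b) ≈-refl (s ^ n) x ⟩
                x                      ∎)))
              (begin-strict
                s        ≈⟨ +-identityˡ s ⟨
                0# + s   <⟨ +-mono-<-≤ 0<h ≤-refl ⟩
                h + s    ≈⟨ +-comm h s ⟩
                s + h    ∎)

      too-large : ¬ x < s ^ n
      too-large lt =
        let h , 0<h , h≤1 , hC<e = small-multiplier 0≤C (0<y-x lt) in
        ≤⇒≯ (sup-least P 0∈P bounded (s-h-bound 0<h h≤1 hC<e)) (begin-strict
              s - h            ≈⟨ +-identityˡ _ ⟨
              0# + (s - h)     <⟨ +-mono-<-≤ 0<h ≤-refl ⟩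
              h + (s - h)      ≈⟨ solve 2 (λ s h → h :+ (s :- h) := s) ≈-refl s h ⟩
              s                ∎)
        where
        s-h-bound : ∀ {h} → 0# < h → h ≤ 1# → h * C < s ^ n - x → UpperBound P (s - h)
        s-h-bound {h} 0<h h≤1 hC<e {t} (0≤t , tⁿ≤x) = ≮⇒≥ λ s-h<t →
          let t≤s = sup-upper P 0∈P bounded (0≤t , tⁿ≤x)
              0≤s-t = x≤y⇒0≤y-x t≤s
              s-t≤h = ≤-excess (x≤y⇒0≤y-x (<⇒≤ s-h<t))
                (solve 3 (λ s h t → s :- t :+ (t :- (s :- h)) := h) ≈-refl s h t)
          in ≤⇒≯ ≤-refl (begin-strict
            s ^ n                  ≈⟨ ^-congˡ n (solve 2 (λ s t → s := t :+ (s :- t)) ≈-refl s t) ⟩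
            (t + (s - t)) ^ n      ≤⟨ lip 0≤t t≤s 0≤s-t (≤-trans s-t≤h h≤1) ⟩
            t ^ n + (s - t) * C    ≤⟨ +-mono-≤ tⁿ≤x (*-monoʳ-≤ 0≤C s-t≤h) ⟩
            x + h * C              ≈⟨ +-comm _ _ ⟩
            h * C + x              <⟨ +-mono-<-≤ hC<e ≤-refl ⟩
            s ^ n - x + x          ≈⟨ solve 2 (λ a b → a :- b :+ b := a) ≈-refl (s ^ n) x ⟩
            s ^ n                  ∎)

  private
    0<base : ∀ {x} → 1# ≤ x → 0# < x
    0<base = <-≤-trans 0<1

  ^ℤ-pos : ∀ {x} i → 0# < x → 0# < x ^ℤ i
  ^ℤ-pos (+ n)    0<x = ^-pos n 0<x
  ^ℤ-pos -[1+ n ] 0<x = ⁻¹-pos (^-pos (suc n) 0<x)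

  module _ {x : Carrier} (0<x : 0# < x) (q : ℚ) where
    ^ℚ-nonneg : 0# ≤ x ^ℚ q
    ^ℚ-nonneg = root-nonneg (ℕ.>-nonZero⁻¹ (↧ₙ q)) (<⇒≤ (^ℤ-pos (↥ q) 0<x))

    ^ℚ-^ : (x ^ℚ q) ^ ↧ₙ q ≈ x ^ℤ (↥ q)
    ^ℚ-^ = root-^ (ℕ.>-nonZero⁻¹ (↧ₙ q)) (<⇒≤ (^ℤ-pos (↥ q) 0<x))

  -- Rationals are stored in lowest terms, so `a / m` comes back with another numerator and
  -- denominator; the cross-multiplied equation is all that is used of them.
  reduced : ∀ a m → 1 ℕ.≤ m → ∃[ q ] ∃[ a′ ] ↥ q ≡ + a′ × a′ ℕ.* m ≡ a ℕ.* ↧ₙ q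
  reduced a m@(suc _) _ = q , ℤ.∣ ↥ q ∣ , ↥q≡ ,
    ≡.trans (≡.cong (ℤ.∣ ↥ q ∣ ℕ.*_) (≡.sym bg≡m))
      (≡.trans (rearrange ℤ.∣ ↥ q ∣ (↧ₙ q) g) (≡.cong (ℕ._* ↧ₙ q) a′g≡a))
    where
    q : ℚ
    q = + a ℚ./ m
    g : ℕ
    g = ℕ.gcd a m
    numerator-nonneg : ∀ r → ℚ.NonNegative r → ℤ.NonNegative (↥ r)
    numerator-nonneg (ℚ.mkℚ _ _ _) r≥0 = r≥0
    ↥q≡ : ↥ q ≡ + ℤ.∣ ↥ q ∣
    ↥q≡ = ≡.sym (ℤ.0≤i⇒+∣i∣≡i (ℤ.nonNegative⁻¹ (↥ q) {{numerator-nonneg q (ℚ.normalize-nonNeg a m)}}))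
    a′g≡a : ℤ.∣ ↥ q ∣ ℕ.* g ≡ a
    a′g≡a = ℤ.+-injective (≡.trans (ℤ.pos-* ℤ.∣ ↥ q ∣ g)
      (≡.trans (≡.cong (ℤ._* + g) (≡.sym ↥q≡)) (ℚ.↥-/ (+ a) m)))
    bg≡m : ↧ₙ q ℕ.* g ≡ m
    bg≡m = ℤ.+-injective (≡.trans (ℤ.pos-* (↧ₙ q) g) (ℚ.↧-/ (+ a) m))
    rearrange : ∀ x y z → x ℕ.* (y ℕ.* z) ≡ x ℕ.* z ℕ.* y
    rearrange = solve-∀

  module _ {q : ℚ} {a′ : ℕ} (↥q≡ : ↥ q ≡ + a′) where
    private
      b : ℕ
      b = ↧ₙ q
      1≤b : 1 ℕ.≤ b
      1≤b = ℕ.>-nonZero⁻¹ b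

    fromℚ≤⇒ : ∀ {y} → fromℚ q ≤ y → fromℕ a′ ≤ y * fromℕ b
    fromℚ≤⇒ {y} q≤y = x*y⁻¹≤z⇒x≤z*y (fromℕ-pos 1≤b)
      (≡.subst (λ i → fromℤ i * fromℕ b ⁻¹ ≤ y) ↥q≡ q≤y)

    ^ℚ-^ℕ : ∀ {x} → 0# < x → (x ^ℚ q) ^ b ≈ x ^ a′
    ^ℚ-^ℕ {x} 0<x = ≡.subst (λ i → (x ^ℚ q) ^ b ≈ x ^ℤ i) ↥q≡ (^ℚ-^ 0<x q)

    module _ {a m : ℕ} (a′m≡ab : a′ ℕ.* m ≡ a ℕ.* b) (1≤m : 1 ℕ.≤ m) where
      reduced-^ : ∀ {x} → 0# < x → (x ^ℚ q) ^ m ≈ x ^ a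
      reduced-^ {x} 0<x = ^-cancel-≈ b 1≤b (^-nonneg m (^ℚ-nonneg 0<x q)) (^-nonneg a (<⇒≤ 0<x))
        (begin-equality
          ((x ^ℚ q) ^ m) ^ b  ≈⟨ ^-swap (x ^ℚ q) m b ⟩
          ((x ^ℚ q) ^ b) ^ m  ≈⟨ ^-congˡ m (^ℚ-^ℕ 0<x) ⟩
          (x ^ a′) ^ m        ≈⟨ ^-assocʳ x a′ m ⟩
          x ^ (a′ ℕ.* m)      ≡⟨ ≡.cong (x ^_) a′m≡ab ⟩
          x ^ (a ℕ.* b)       ≈⟨ ^-assocʳ x a b ⟨
          (x ^ a) ^ b         ∎)

      reduced-≤ : ∀ {y} → fromℕ a ≤ y * fromℕ m → fromℚ q ≤ y
      reduced-≤ {y} a≤ym = ≡.subst (λ i → fromℤ i * fromℕ b ⁻¹ ≤ y) (≡.sym ↥q≡)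
        (x≤y*z⇒x*y⁻¹≤z (fromℕ-pos 1≤b) (*-cancelʳ-≤ (fromℕ-pos 1≤m) (begin
          fromℕ a′ * fromℕ m       ≈⟨ fromℕ-* a′ m ⟨
          fromℕ (a′ ℕ.* m)         ≡⟨ ≡.cong fromℕ a′m≡ab ⟩
          fromℕ (a ℕ.* b)          ≈⟨ fromℕ-* a b ⟩
          fromℕ a * fromℕ b        ≤⟨ *-monoʳ-≤ (fromℕ-nonneg b) a≤ym ⟩
          y * fromℕ m * fromℕ b    ≈⟨ solve 3 (λ x y z → x :* y :* z := x :* z :* y) ≈-refl y (fromℕ m) (fromℕ b) ⟩
          y * fromℕ b * fromℕ m    ∎)))

  module _ {x y z : Carrier} (1≤x : 1# ≤ x) (0≤y : 0# ≤ y) (1≤z : 1# ≤ z)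
    -- Together these express `z = x ^ y` through integer exponents only. The extra factor `x` in
    -- `lower` pays for rounding `y * m` down to an integer.
    (upper : ∀ a b → 1 ℕ.≤ b → fromℕ a ≤ y * fromℕ b → x ^ a ≤ z ^ b)
    (lower : ∀ m → 1 ℕ.≤ m → ∃[ a ] fromℕ a ≤ y * fromℕ m × z ^ m ≤ x * x ^ a)
    where
    private
      0<x : 0# < x
      0<x = 0<base 1≤x
      0≤z : 0# ≤ z
      0≤z = ≤-trans 0≤1 1≤z

      P : Carrier → Set
      P t = ∃[ q ] fromℚ q ≤ y × t ≈ x ^ℚ q

      s : Carrier
      s = x ^ᴿ y

      ^ℤ≤ : ∀ q i → ↥ q ≡ i → fromℚ q ≤ y → x ^ℤ i ≤ z ^ ↧ₙ q
      ^ℤ≤ q (+ a) ↥q≡ q≤y = upper a (↧ₙ q) (ℕ.>-nonZero⁻¹ (↧ₙ q)) (fromℚ≤⇒ {q} ↥q≡ q≤y)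
      ^ℤ≤ q -[1+ a ] ↥q≡ q≤y = ≤-trans (begin
        (x ^ suc a) ⁻¹        ≈⟨ *-identityˡ _ ⟨
        1# * (x ^ suc a) ⁻¹   ≤⟨ x≤y*z⇒x*y⁻¹≤z (^-pos (suc a) 0<x) (≤-respʳ-≈ (≈-sym (*-identityˡ _)) (1≤^ (suc a) 1≤x)) ⟩
        1#                    ∎) (1≤^ (↧ₙ q) 1≤z)

      P≤z : UpperBound P z
      P≤z (q , q≤y , t≈) = ≤-trans (≈⇒≤ t≈) (^-cancel-≤ (↧ₙ q) (ℕ.>-nonZero⁻¹ (↧ₙ q)) 0≤z
        (≤-trans (≈⇒≤ (^ℚ-^ 0<x q)) (^ℤ≤ q (↥ q) ≡.refl q≤y)))

      bounded : ∃ (UpperBound P)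
      bounded = z , P≤z

      point : ∀ a m → 1 ℕ.≤ m → fromℕ a ≤ y * fromℕ m → ∃[ t ] P t × 0# ≤ t × t ^ m ≈ x ^ a
      point a m 1≤m a≤ym =
        let q , a′ , ↥q≡ , e = reduced a m 1≤m in
        x ^ℚ q , (q , reduced-≤ {q} ↥q≡ {a} e 1≤m a≤ym , ≈-refl) ,
        ^ℚ-nonneg 0<x q , reduced-^ {q} ↥q≡ {a} e 1≤m 0<x

      one : ∃[ t ] P t × 0# ≤ t × t ^ 1 ≈ x ^ 0
      one = point 0 1 ℕ.≤-refl (*-nonneg 0≤y (fromℕ-nonneg 1))

      nonempty : ∃ P
      nonempty = proj₁ one , proj₁ (proj₂ one)

      1≤s : 1# ≤ s
      1≤s = ≤-trans (≈⇒≥ (≈-trans (≈-sym (*-identityʳ _)) (proj₂ (proj₂ (proj₂ one)))))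
        (sup-upper P nonempty bounded (proj₁ (proj₂ one)))

      0<s : 0# < s
      0<s = 0<base 1≤s

      z^m≤ : ∀ m → 1 ℕ.≤ m → z ^ m ≤ x * s ^ m
      z^m≤ m 1≤m =
        let a , a≤ym , zᵐ≤ = lower m 1≤m
            t , t∈P , 0≤t , tᵐ≈ = point a m 1≤m a≤ym
        in begin
          z ^ m        ≤⟨ zᵐ≤ ⟩
          x * x ^ a    ≈⟨ *-congˡ tᵐ≈ ⟨
          x * t ^ m    ≤⟨ *-monoˡ-≤ (<⇒≤ 0<x) (^-monoˡ-≤ m 0≤t (sup-upper P nonempty bounded t∈P)) ⟩
          x * s ^ m    ∎

      s≮z : ¬ s < z
      s≮z s<z =
        let m , x<rᵐ = ^-unbounded 1<r x in ≤⇒≯ (z^m≤ (suc m) (ℕ.s≤s ℕ.z≤n)) (begin-strict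
          x * s ^ suc m        ≈⟨ *-comm _ _ ⟩
          s ^ suc m * x        <⟨ *-monoˡ-< (^-pos (suc m) 0<s)
                                    (<-≤-trans x<rᵐ (^-monoʳ-≤ (<⇒≤ 1<r) (ℕ.n≤1+n m))) ⟩
          s ^ suc m * r ^ suc m ≈⟨ ^-distrib-* s r (suc m) ⟨
          (s * r) ^ suc m      ≈⟨ ^-congˡ (suc m) (≈-trans (*-comm _ _) (*⁻¹-cancel z 0<s)) ⟩
          z ^ suc m            ∎)
        where
        r : Carrier
        r = z * s ⁻¹
        1<r : 1# < r
        1<r = ≰⇒> λ r≤1 → ≤⇒≯ (≤-respʳ-≈ (*-identityˡ s) (x*y⁻¹≤z⇒x≤z*y 0<s r≤1)) s<z

    -- `upper` makes `z` an upper bound of the rational powers. `lower` gives `z ^ m ≤ x * s ^ m`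
    -- for the supremum `s` and all `m ≥ 1`; if `s < z`, the powers of `z / s` would outgrow the
    -- fixed factor `x`.
    ^ᴿ-unique : x ^ᴿ y ≈ z
    ^ᴿ-unique = antisym (sup-least P nonempty bounded P≤z) (≮⇒≥ s≮z)

  module _ {c} (1≤c : 1 ℕ.≤ c) (m D : ℕ) (1≤D : 1 ℕ.≤ D) where
    private
      x z : Carrier
      x = fromℕ c
      z = root D (x ^ m)
      1≤x : 1# ≤ x
      1≤x = 1≤fromℕ 1≤c
      0≤xᵐ : 0# ≤ x ^ m
      0≤xᵐ = ^-nonneg m (fromℕ-nonneg c)
      0≤z : 0# ≤ z
      0≤z = root-nonneg 1≤D 0≤xᵐ
      z^D : z ^ D ≈ x ^ m
      z^D = root-^ 1≤D 0≤xᵐ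
      y : Carrier
      y = fromℕ m * fromℕ D ⁻¹
      0<D : 0# < fromℕ D
      0<D = fromℕ-pos 1≤D

      y*n*D : ∀ n → y * fromℕ n * fromℕ D ≈ fromℕ (m ℕ.* n)
      y*n*D n = begin-equality
        y * fromℕ n * fromℕ D              ≈⟨ solve 4 (λ a b c d → a :* b :* c :* d := a :* b :* d :* c) ≈-refl _ _ _ _ ⟩
        y * fromℕ D * fromℕ n              ≈⟨ *-congʳ (*⁻¹-cancel _ 0<D) ⟩
        fromℕ m * fromℕ n                  ≈⟨ fromℕ-* m n ⟨
        fromℕ (m ℕ.* n)                    ∎

      z^nD : ∀ n → (z ^ n) ^ D ≈ x ^ (m ℕ.* n)
      z^nD n = begin-equality
        (z ^ n) ^ D    ≈⟨ ^-swap z n D ⟩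
        (z ^ D) ^ n    ≈⟨ ^-congˡ n z^D ⟩
        (x ^ m) ^ n    ≈⟨ ^-assocʳ x m n ⟩
        x ^ (m ℕ.* n)  ∎

      1≤z : 1# ≤ z
      1≤z = ^-cancel-≤ D 1≤D 0≤z (≤-trans (≈⇒≤ (1^n≈1 D)) (≤-trans (1≤^ m 1≤x) (≈⇒≥ z^D)))

      upper : ∀ a b → 1 ℕ.≤ b → fromℕ a ≤ y * fromℕ b → x ^ a ≤ z ^ b
      upper a b _ a≤yb = ^-cancel-≤ D 1≤D (^-nonneg b 0≤z) (begin
        (x ^ a) ^ D     ≈⟨ ^-assocʳ x a D ⟩
        x ^ (a ℕ.* D)   ≤⟨ ^-monoʳ-≤ 1≤x (fromℕ-cancel-≤ {a ℕ.* D} {m ℕ.* b} aD≤mb) ⟩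
        x ^ (m ℕ.* b)   ≈⟨ z^nD b ⟨
        (z ^ b) ^ D     ∎)
        where
        aD≤mb : fromℕ (a ℕ.* D) ≤ fromℕ (m ℕ.* b)
        aD≤mb = begin
          fromℕ (a ℕ.* D)         ≈⟨ fromℕ-* a D ⟩
          fromℕ a * fromℕ D       ≤⟨ *-monoʳ-≤ (fromℕ-nonneg D) a≤yb ⟩
          y * fromℕ b * fromℕ D   ≈⟨ y*n*D b ⟩
          fromℕ (m ℕ.* b)         ∎

      lower : ∀ n → 1 ℕ.≤ n → ∃[ a ] fromℕ a ≤ y * fromℕ n × z ^ n ≤ x * x ^ a
      lower n _ = a , *-cancelʳ-≤ 0<D (begin
          fromℕ a * fromℕ D       ≈⟨ fromℕ-* a D ⟨
          fromℕ (a ℕ.* D)         ≤⟨ fromℕ-mono-≤ (ℕ.m/n*n≤m (m ℕ.* n) D) ⟩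
          fromℕ (m ℕ.* n)         ≈⟨ y*n*D n ⟨
          y * fromℕ n * fromℕ D   ∎) , ^-cancel-≤ D 1≤D (^-nonneg (suc a) (fromℕ-nonneg c)) (begin
          (z ^ n) ^ D             ≈⟨ z^nD n ⟩
          x ^ (m ℕ.* n)           ≤⟨ ^-monoʳ-≤ 1≤x mn≤ ⟩
          x ^ (suc a ℕ.* D)       ≈⟨ ^-assocʳ x (suc a) D ⟨
          (x ^ suc a) ^ D         ∎)
        where
        instance
          D≢0 : ℕ.NonZero D
          D≢0 = ℕ.>-nonZero 1≤D
        a : ℕ
        a = (m ℕ.* n) ℕ./ D
        mn≤ : m ℕ.* n ℕ.≤ suc a ℕ.* D
        mn≤ = ℕ.≤-trans (ℕ.≤-reflexive (ℕ.m≡m%n+[m/n]*n (m ℕ.* n) D))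
          (ℕ.+-monoˡ-≤ _ (ℕ.<⇒≤ (ℕ.m%n<n (m ℕ.* n) D)))

      value : x ^ᴿ y ≈ z
      value = ^ᴿ-unique 1≤x (*-nonneg (fromℕ-nonneg m) (<⇒≤ (⁻¹-pos 0<D))) 1≤z upper lower

    -- For the exponent `m / D` the supremum is the `D`-th root of `x ^ m`, so the `D`-th power
    -- leads back to integers.
    fromℕ^ᴿ-^ : (fromℕ c ^ᴿ (fromℕ m * fromℕ D ⁻¹)) ^ D ≈ fromℕ c ^ m
    fromℕ^ᴿ-^ = ≈-trans (^-congˡ D value) z^D

    1≤fromℕ^ᴿ : 1# ≤ fromℕ c ^ᴿ (fromℕ m * fromℕ D ⁻¹)
    1≤fromℕ^ᴿ = ≤-trans 1≤z (≈⇒≥ value)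

  module _ {x z : Carrier} (1<x : 1# < x) (1≤z : 1# ≤ z) where
    private
      1≤x : 1# ≤ x
      1≤x = <⇒≤ 1<x
      0<x : 0# < x
      0<x = 0<base 1≤x
      0<z : 0# < z
      0<z = 0<base 1≤z

      P : Carrier → Set
      P r = ∃[ a ] ∃[ b ] 1 ℕ.≤ b × x ^ a ≤ z ^ b × r ≈ fromℕ a * fromℕ b ⁻¹

    -- The logarithm of `z` to base `x`. Natural numerators are enough because `1# ≤ z`.
    log : Carrier
    log = sup P

    private
      comparison : ∀ {a b a′ b′} → z ^ b ≤ x ^ a → x ^ a′ ≤ z ^ b′ → a′ ℕ.* b ℕ.≤ a ℕ.* b′
      comparison {a} {b} {a′} {b′} zᵇ≤xᵃ xᵃ′≤zᵇ′ = ^-cancelʳ-≤ 1<x (begin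
        x ^ (a′ ℕ.* b)   ≈⟨ ^-assocʳ x a′ b ⟨
        (x ^ a′) ^ b     ≤⟨ ^-monoˡ-≤ b (^-nonneg a′ (<⇒≤ 0<x)) xᵃ′≤zᵇ′ ⟩
        (z ^ b′) ^ b     ≈⟨ ^-swap z b′ b ⟩
        (z ^ b) ^ b′     ≤⟨ ^-monoˡ-≤ b′ (^-nonneg b (<⇒≤ 0<z)) zᵇ≤xᵃ ⟩
        (x ^ a) ^ b′     ≈⟨ ^-assocʳ x a b′ ⟩
        x ^ (a ℕ.* b′)   ∎)

      bound : ∀ {a b} → 1 ℕ.≤ b → z ^ b ≤ x ^ a → UpperBound P (fromℕ a * fromℕ b ⁻¹)
      bound {a} {b} 1≤b zᵇ≤xᵃ {r} (a′ , b′ , 1≤b′ , le , r≈) = ≤-trans (≈⇒≤ r≈)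
        (x≤y*z⇒x*y⁻¹≤z (fromℕ-pos 1≤b′) (*-cancelʳ-≤ (fromℕ-pos 1≤b) (begin
          fromℕ a′ * fromℕ b                     ≈⟨ fromℕ-* a′ b ⟨
          fromℕ (a′ ℕ.* b)                       ≤⟨ fromℕ-mono-≤ (comparison {a} {b} {a′} {b′} zᵇ≤xᵃ le) ⟩
          fromℕ (a ℕ.* b′)                       ≈⟨ fromℕ-* a b′ ⟩
          fromℕ a * fromℕ b′                     ≈⟨ *-congʳ (*⁻¹-cancel _ (fromℕ-pos 1≤b)) ⟨
          fromℕ a * fromℕ b ⁻¹ * fromℕ b * fromℕ b′  ≈⟨ solve 4 (λ a b c d → a :* b :* c :* d := a :* b :* d :* c) ≈-refl _ _ _ _ ⟩
          fromℕ a * fromℕ b ⁻¹ * fromℕ b′ * fromℕ b  ∎)))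

      0∈P : P 0#
      0∈P = 0 , 1 , ℕ.≤-refl , 1≤^ 1 1≤z , ≈-sym (zeroˡ _)

      nonempty : ∃ P
      nonempty = 0# , 0∈P

      bounded : ∃ (UpperBound P)
      bounded = let c , z<xᶜ = ^-unbounded 1<x z in
        fromℕ c * fromℕ 1 ⁻¹ , bound {c} {1} ℕ.≤-refl (≤-trans (≈⇒≤ (*-identityʳ z)) (<⇒≤ z<xᶜ))

    log-nonneg : 0# ≤ log
    log-nonneg = sup-upper P nonempty bounded 0∈P

    ≤log : ∀ {a b} → 1 ℕ.≤ b → x ^ a ≤ z ^ b → fromℕ a ≤ log * fromℕ b
    ≤log {a} {b} 1≤b le = x*y⁻¹≤z⇒x≤z*y (fromℕ-pos 1≤b)
      (sup-upper P nonempty bounded (a , b , 1≤b , le , ≈-refl))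

    log≤ : ∀ {a b} → 1 ℕ.≤ b → z ^ b ≤ x ^ a → log * fromℕ b ≤ fromℕ a
    log≤ {a} {b} 1≤b le = x≤z*y⁻¹⇒x*y≤z (fromℕ-pos 1≤b) (sup-least P nonempty bounded (bound {a} {b} 1≤b le))

    private
      largest : ∀ m c → z ^ m < x ^ c → ∃[ a ] x ^ a ≤ z ^ m × z ^ m ≤ x * x ^ a
      largest m zero lt = contradiction lt (≤⇒≯ (1≤^ m 1≤z))
      largest m (suc c) lt with ≤⊎> (x ^ c) (z ^ m)
      ... | inj₁ le = c , le , <⇒≤ lt
      ... | inj₂ gt = largest m c gt

      -- If z ^ b < x ^ a, a power of x ^ a / z ^ b exceeds x, which keeps the
      -- logarithm a definite amount below a / b.
      upper : ∀ a b → 1 ℕ.≤ b → fromℕ a ≤ log * fromℕ b → x ^ a ≤ z ^ b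
      upper a b 1≤b a≤ = ≮⇒≥ λ zᵇ<xᵃ →
        let r = x ^ a * (z ^ b) ⁻¹
            0<zᵇ = ^-pos b 0<z
            1<r = ≰⇒> λ r≤1 → ≤⇒≯ (≤-respʳ-≈ (*-identityˡ _) (x*y⁻¹≤z⇒x≤z*y 0<zᵇ r≤1)) zᵇ<xᵃ
            m , x<rᵐ = ^-unbounded 1<r x
            M = suc m
            le : z ^ (b ℕ.* M) * x ≤ x ^ (a ℕ.* M)
            le = begin
              z ^ (b ℕ.* M) * x          ≈⟨ *-congʳ (^-assocʳ z b M) ⟨
              (z ^ b) ^ M * x            ≤⟨ *-monoˡ-≤ (^-nonneg M (<⇒≤ 0<zᵇ))
                (≤-trans (<⇒≤ x<rᵐ) (^-monoʳ-≤ (<⇒≤ 1<r) (ℕ.n≤1+n m))) ⟩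
              (z ^ b) ^ M * r ^ M        ≈⟨ ^-distrib-* (z ^ b) r M ⟨
              (z ^ b * r) ^ M            ≈⟨ ^-congˡ M (≈-trans (*-comm _ _) (*⁻¹-cancel _ 0<zᵇ)) ⟩
              (x ^ a) ^ M                ≈⟨ ^-assocʳ x a M ⟩
              x ^ (a ℕ.* M)              ∎
        in contradiction-from a b M (ℕ.s≤s ℕ.z≤n) 1≤b a≤ le
        where
        contradiction-from : ∀ a b M → 1 ℕ.≤ M → 1 ℕ.≤ b → fromℕ a ≤ log * fromℕ b →
          z ^ (b ℕ.* M) * x ≤ x ^ (a ℕ.* M) → ⊥
        contradiction-from a b M 1≤M 1≤b a≤ le = ≤⇒≯ ≤-refl (begin-strict
            log * (fromℕ b * fromℕ M)        ≈⟨ +-identityˡ _ ⟨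
            0# + log * (fromℕ b * fromℕ M)   <⟨ +-mono-<-≤ 0<1 ≤-refl ⟩
            1# + log * (fromℕ b * fromℕ M)   ≈⟨ +-comm _ _ ⟩
            log * (fromℕ b * fromℕ M) + 1#   ≤⟨ +-monoˡ-≤ 1# (≤-respʳ-≈ c*bM (*-monoʳ-≤ (<⇒≤ 0<bM) log≤c)) ⟩
            fromℕ a * fromℕ M - 1# + 1#      ≈⟨ solve 2 (λ a b → a :* b :- con (+ 1) :+ con (+ 1) := a :* b) ≈-refl _ _ ⟩
            fromℕ a * fromℕ M                ≤⟨ *-monoʳ-≤ (fromℕ-nonneg M) a≤ ⟩
            log * fromℕ b * fromℕ M          ≈⟨ *-assoc _ _ _ ⟩
            log * (fromℕ b * fromℕ M)        ∎)
          where
          0<bM : 0# < fromℕ b * fromℕ M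
          0<bM = *-pos (fromℕ-pos 1≤b) (fromℕ-pos 1≤M)
          -- The hypothesis `le` says that the logarithm is at most `(a M - 1) / (b M)`, which is
          -- `1 / (b M)` below `a / b`.
          c : Carrier
          c = (fromℕ a * fromℕ M - 1#) * (fromℕ b * fromℕ M) ⁻¹
          c*bM : c * (fromℕ b * fromℕ M) ≈ fromℕ a * fromℕ M - 1#
          c*bM = *⁻¹-cancel _ 0<bM
          exponents : ∀ {a′ b′} → x ^ a′ ≤ z ^ b′ → b′ ℕ.+ a′ ℕ.* (b ℕ.* M) ℕ.≤ a ℕ.* M ℕ.* b′
          exponents {a′} {b′} le′ = ^-cancelʳ-≤ 1<x (begin
            x ^ (b′ ℕ.+ a′ ℕ.* (b ℕ.* M))        ≈⟨ ^-homo-* x b′ _ ⟩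
            x ^ b′ * x ^ (a′ ℕ.* (b ℕ.* M))      ≈⟨ *-congˡ (^-assocʳ x a′ _) ⟨
            x ^ b′ * (x ^ a′) ^ (b ℕ.* M)        ≤⟨ *-monoˡ-≤ (^-nonneg b′ (<⇒≤ 0<x)) (^-monoˡ-≤ (b ℕ.* M) (^-nonneg a′ (<⇒≤ 0<x)) le′) ⟩
            x ^ b′ * (z ^ b′) ^ (b ℕ.* M)        ≈⟨ *-congˡ (^-swap z b′ (b ℕ.* M)) ⟩
            x ^ b′ * (z ^ (b ℕ.* M)) ^ b′        ≈⟨ *-comm _ _ ⟩
            (z ^ (b ℕ.* M)) ^ b′ * x ^ b′        ≈⟨ ^-distrib-* _ _ b′ ⟨
            (z ^ (b ℕ.* M) * x) ^ b′             ≤⟨ ^-monoˡ-≤ b′ (*-nonneg (^-nonneg (b ℕ.* M) (<⇒≤ 0<z)) (<⇒≤ 0<x)) le ⟩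
            (x ^ (a ℕ.* M)) ^ b′                 ≈⟨ ^-assocʳ x (a ℕ.* M) b′ ⟩
            x ^ (a ℕ.* M ℕ.* b′)                 ∎)
          log≤c : log ≤ c
          log≤c = sup-least P nonempty bounded λ { (a′ , b′ , 1≤b′ , le′ , r≈) → ≤-trans (≈⇒≤ r≈)
            (x≤y*z⇒x*y⁻¹≤z (fromℕ-pos 1≤b′) (*-cancelʳ-≤ 0<bM (+-cancelˡ-≤ (fromℕ b′) (begin
              fromℕ b′ + fromℕ a′ * (fromℕ b * fromℕ M)    ≈⟨ +-congˡ (≈-trans (fromℕ-* a′ _) (*-congˡ (fromℕ-* b M))) ⟨
              fromℕ b′ + fromℕ (a′ ℕ.* (b ℕ.* M))          ≈⟨ fromℕ-+ b′ _ ⟨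
              fromℕ (b′ ℕ.+ a′ ℕ.* (b ℕ.* M))              ≤⟨ fromℕ-mono-≤ (exponents {a′} {b′} le′) ⟩
              fromℕ (a ℕ.* M ℕ.* b′)                       ≈⟨ ≈-trans (fromℕ-* (a ℕ.* M) b′) (*-congʳ (fromℕ-* a M)) ⟩
              fromℕ a * fromℕ M * fromℕ b′                 ≈⟨ solve 3 (λ a m b → a :* m :* b := b :+ (a :* m :- con (+ 1)) :* b) ≈-refl _ _ _ ⟩
              fromℕ b′ + (fromℕ a * fromℕ M - 1#) * fromℕ b′ ≈⟨ +-congˡ (*-congʳ c*bM) ⟨
              fromℕ b′ + c * (fromℕ b * fromℕ M) * fromℕ b′ ≈⟨ solve 4 (λ b c x y → b :+ c :* (x :* y) :* b := b :+ c :* b :* (x :* y)) ≈-refl _ _ _ _ ⟩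
              fromℕ b′ + c * fromℕ b′ * (fromℕ b * fromℕ M) ∎)))) }

    ^ᴿ-log : ∀ {y} → y ≈ log → x ^ᴿ y ≈ z
    ^ᴿ-log {y} y≈log = ^ᴿ-unique 1≤x (≤-trans log-nonneg (≈⇒≥ y≈log)) 1≤z
      (λ a b 1≤b a≤ → upper a b 1≤b (≤-trans a≤ (≈⇒≤ (*-congʳ y≈log))))
      (λ m 1≤m → let c , lt = ^-unbounded 1<x (z ^ m)
                     a , le , ge = largest m c lt
                 in a , ≤-trans (≤log {a} {m} 1≤m le) (≈⇒≥ (*-congʳ y≈log)) , ge)

-- Lengths of lists and walks.

length-concatMap : ∀ {A B : Set} (f : A → List B) c xs → (∀ {x} → x ∈ xs → length (f x) ℕ.≤ c) →
  length (concatMap f xs) ℕ.≤ length xs ℕ.* c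
length-concatMap f c []       _  = ℕ.z≤n
length-concatMap f c (x ∷ xs) le = ℕ.≤-trans (ℕ.≤-reflexive (List.length-++ (f x)))
  (ℕ.+-mono-≤ (le (here ≡.refl)) (length-concatMap f c xs λ x∈ → le (there x∈)))

module _ {A B : Set} where
  guarded : Dec A → List B → List B
  guarded (yes _) xs = xs
  guarded (no  _) xs = []

  ∈-guarded⁺ : ∀ (a? : Dec A) {xs x} → A → x ∈ xs → x ∈ guarded a? xs
  ∈-guarded⁺ (yes _) _ x∈ = x∈
  ∈-guarded⁺ (no ¬a) a _  = contradiction a ¬a

  ∈-guarded⁻ : ∀ (a? : Dec A) xs {x} → x ∈ guarded a? xs → A × x ∈ xs
  ∈-guarded⁻ (yes a) xs x∈ = a , x∈

  length-guarded : ∀ (a? : Dec A) xs {c} → (A → length xs ℕ.≤ c) → length (guarded a? xs) ℕ.≤ c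
  length-guarded (yes a) xs le = le a
  length-guarded (no  _) xs le = ℕ.z≤n

module _ {A B : Set} {S : A → A → Set} {T : B → B → Set} where
  ∣gmap∣ : ∀ (f : A → B) (g : ∀ {x y} → S x y → T (f x) (f y)) {x y} (w : Star S x y) →
    ∣ gmap {U = T} f g w ∣ ≡ ∣ w ∣
  ∣gmap∣ f g ε       = ≡.refl
  ∣gmap∣ f g (_ ◅ w) = ≡.cong suc (∣gmap∣ f g w)

module _ {A : Set} {T : A → A → Set} where
  ∣◅◅∣ : ∀ {x y z} (w : Star T x y) (w′ : Star T y z) → ∣ w ◅◅ w′ ∣ ≡ ∣ w ∣ ℕ.+ ∣ w′ ∣
  ∣◅◅∣ ε       w′ = ≡.refl
  ∣◅◅∣ (_ ◅ w) w′ = ≡.cong suc (∣◅◅∣ w w′)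

  ∣revApp∣ : ∀ (r : ∀ {x y} → T x y → T y x) {x y z} (w : Star T y x) (w′ : Star T y z) →
    ∣ revApp r w w′ ∣ ≡ ∣ w ∣ ℕ.+ ∣ w′ ∣
  ∣revApp∣ r ε       w′ = ≡.refl
  ∣revApp∣ r (e ◅ w) w′ = ≡.trans (∣revApp∣ r w (r e ◅ w′)) (ℕ.+-suc ∣ w ∣ ∣ w′ ∣)

-- Distance from a root in a tree, and the sizes of spheres.

module TreeDistance (T : Graph) (isTree : IsTree T) (o : Graph.V T) where
  open Graph T
  open DecMembership _≟_ using (_∈?_)

  path : ∀ u → Walk u o
  path u = proj₁ (proj₁ (isTree u o))

  path-simple : ∀ u → Unique (vertices (path u))
  path-simple u = proj₂ (proj₁ (isTree u o))

  path-unique : ∀ {u} (w : Walk u o) → Unique (vertices w) → vertices w ≡ vertices (path u)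
  path-unique {u} w w! = proj₂ (isTree u o) (w , w!)

  dist : V → ℕ
  dist u = ∣ path u ∣

  length-vertices : ∀ {u v} (w : Walk u v) → length (vertices w) ≡ suc ∣ w ∣
  length-vertices ε       = ≡.refl
  length-vertices (_ ◅ w) = ≡.cong suc (length-vertices w)

  dist-simple : ∀ {u} (w : Walk u o) → Unique (vertices w) → dist u ≡ ∣ w ∣
  dist-simple {u} w w! = ℕ.suc-injective (≡.trans (≡.sym (length-vertices (path u)))
    (≡.trans (≡.cong length (≡.sym (path-unique w w!))) (length-vertices w)))

  dist-o : dist o ≡ 0
  dist-o = dist-simple ε ([] ∷ [])

  dist≡0⇒≡o : ∀ {u} → dist u ≡ 0 → u ≡ o
  dist≡0⇒≡o {u} eq with path u
  ... | ε = ≡.refl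

  vertices-head : ∀ {u u′ v v′} (w : Walk u v) (w′ : Walk u′ v′) → vertices w ≡ vertices w′ → u ≡ u′
  vertices-head ε       ε       eq = List.∷-injectiveˡ eq
  vertices-head ε       (_ ◅ _) eq = List.∷-injectiveˡ eq
  vertices-head (_ ◅ _) ε       eq = List.∷-injectiveˡ eq
  vertices-head (_ ◅ _) (_ ◅ _) eq = List.∷-injectiveˡ eq

  suffix : ∀ {x y} (w : Walk x o) → Unique (vertices w) → y ∈ vertices w →
    Σ[ w′ ∈ Walk y o ] Unique (vertices w′) × (∀ {z} → z ∈ vertices w′ → z ∈ vertices w)
  suffix ε       w!       (here ≡.refl) = ε , w! , λ z∈ → z∈
  suffix (e ◅ w) w!       (here ≡.refl) = e ◅ w , w! , λ z∈ → z∈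
  suffix (e ◅ w) (_ ∷ w!) (there y∈) with suffix w w! y∈
  ... | w′ , w′! , ⊆w = w′ , w′! , λ z∈ → there (⊆w z∈)

  cons-simple : ∀ {y u} (e : y ~ u) (w : Walk u o) → y ∉ vertices w → Unique (vertices w) →
    Unique (vertices (e ◅ w))
  cons-simple e w y∉ w! = All.¬Any⇒All¬ _ y∉ ∷ w!

  -- The path equation is kept beside the distances because it determines `y`, which makes the
  -- parent unique.
  Parent : V → V → Set
  Parent u y = dist u ≡ suc (dist y) × vertices (path u) ≡ u ∷ vertices (path y)

  -- If y lies on the path from u to o, the rest of that path from y on is the path
  -- from y, and putting u in front of it gives back the path from u.
  neighbour-cases : ∀ {y u} → y ~ u → dist y ≡ suc (dist u) ⊎ Parent u y
  neighbour-cases {y} {u} y~u with y ∈? vertices (path u)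
  ... | no  y∉ = inj₁ (dist-simple (y~u ◅ path u) (cons-simple y~u (path u) y∉ (path-simple u)))
  ... | yes y∈ = inj₂ (parent (path u) (path-simple u) y∈)
    where
    parent : (w : Walk u o) → Unique (vertices w) → y ∈ vertices w → Parent u y
    parent ε       _        (here ≡.refl) = contradiction y~u ~-irrefl
    parent (_ ◅ _) _        (here ≡.refl) = contradiction y~u ~-irrefl
    parent (e ◅ w) (u≢ ∷ w!) (there y∈w) =
      ≡.trans (dist-simple (~-sym y~u ◅ w′) simple) (≡.cong suc (≡.sym (dist-simple w′ w′!))) ,
      ≡.trans (≡.sym (path-unique (~-sym y~u ◅ w′) simple)) (≡.cong (u ∷_) (path-unique w′ w′!))
      where
      w′ : Walk y o
      w′ = proj₁ (suffix w w! y∈w)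
      w′! : Unique (vertices w′)
      w′! = proj₁ (proj₂ (suffix w w! y∈w))
      simple : Unique (u ∷ vertices w′)
      simple = cons-simple (~-sym y~u) w′
        (λ u∈ → All.All¬⇒¬Any u≢ (proj₂ (proj₂ (suffix w w! y∈w)) u∈)) w′!

  parent-unique : ∀ {u y y′} → Parent u y → Parent u y′ → y ≡ y′
  parent-unique {y = y} {y′} (_ , e) (_ , e′) =
    vertices-head (path y) (path y′) (List.∷-injectiveʳ (≡.trans (≡.sym e) e′))

  parent-exists : ∀ {u m} → dist u ≡ suc m → ∃[ y ] y ~ u × dist y ≡ m
  parent-exists {u} eq with path u | path-simple u
  ... | _◅_ {j = y} e w | _ ∷ w! = y , ~-sym e , ≡.trans (dist-simple w w!) (ℕ.suc-injective eq)

  -- The nearer neighbour `p` is the parent of `u`; another neighbour that failed to be farther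
  -- would be a second parent.
  farther : ∀ {u p y} → p ~ u → dist u ≡ suc (dist p) → y ~ u → y ≢ p → dist y ≡ suc (dist u)
  farther p~u up y~u y≢p with neighbour-cases p~u | neighbour-cases y~u
  ... | _            | inj₁ yu = yu
  ... | inj₂ parent  | inj₂ parent′ = contradiction (parent-unique parent′ parent) y≢p
  ... | inj₁ pu      | inj₂ _ = contradiction (≡.trans pu (≡.cong suc up)) (ℕ.m≢1+n+m _ {1})

  neighbour-of-o : ∀ {y} → y ~ o → dist y ≡ 1
  neighbour-of-o y~o with neighbour-cases y~o
  ... | inj₁ eq       = ≡.trans eq (≡.cong suc dist-o)
  ... | inj₂ (eq , _) = contradiction (≡.trans (≡.sym dist-o) eq) λ ()

  dist-step : ∀ {y u} → y ~ u → dist y ℕ.≤ suc (dist u)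
  dist-step y~u with neighbour-cases y~u
  ... | inj₁ eq       = ℕ.≤-reflexive eq
  ... | inj₂ (eq , _) = ℕ.m≤n⇒m≤1+n (ℕ.≤-trans (ℕ.n≤1+n _) (ℕ.≤-reflexive (≡.sym eq)))

  dist-minimal : ∀ {u} (w : Walk u o) → dist u ℕ.≤ ∣ w ∣
  dist-minimal ε       = ℕ.≤-reflexive dist-o
  dist-minimal (e ◅ w) = ℕ.≤-trans (dist-step e) (ℕ.s≤s (dist-minimal w))

  module _ {d : ℕ} (1≤d : 1 ℕ.≤ d) (regular : IsRegular T (d ℕ.+ 1)) where

    child? : ∀ u y → Dec (dist y ≡ suc (dist u))
    child? u y = dist y ℕ.≟ suc (dist u)

    children : V → List V
    children u = filter (child? u) (nbrs u)

    sphere : ℕ → List V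
    sphere zero    = o ∷ []
    sphere (suc a) = concatMap children (sphere a)

    ∈-sphere : ∀ {a v} → dist v ≡ a → v ∈ sphere a
    ∈-sphere {zero}  eq = here (dist≡0⇒≡o eq)
    ∈-sphere {suc a} eq with parent-exists eq
    ... | u , u~v , eq′ = ∈-concatMap⁺ children (lose (∈-sphere eq′)
      (∈-filter⁺ (child? u) (∈-nbrs⁺ (~-sym u~v)) (≡.trans eq (≡.cong suc (≡.sym eq′)))))

    sphere-dist : ∀ a {v} → v ∈ sphere a → dist v ≡ a
    sphere-dist zero    (here ≡.refl) = dist-o
    sphere-dist (suc a) v∈ with find (∈-concatMap⁻ children {xs = sphere a} v∈)
    ... | u , u∈ , v∈′ = ≡.trans (proj₂ (∈-filter⁻ (child? u) {xs = nbrs u} v∈′)) (≡.cong suc (sphere-dist a u∈))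

    length-children : ∀ {u m} → dist u ≡ suc m → length (children u) ℕ.≤ d
    length-children {u} eq with parent-exists eq
    ... | p , p~u , eq′ = ℕ.s≤s⁻¹ (ℕ.≤-trans
      -- The parent is a neighbour that the filter drops, leaving at most `d` of the `d + 1`.
      (List.filter-notAll (child? u) (nbrs u) (lose (∈-nbrs⁺ p~u) λ eq″ →
        ℕ.m≢1+n+m _ {1} (≡.trans eq″ (≡.cong suc (≡.trans eq (≡.cong suc (≡.sym eq′)))))))
      (ℕ.≤-reflexive (≡.trans (regular u) (ℕ.+-comm d 1))))

    length-sphere-suc : ∀ a → length (sphere (suc a)) ℕ.≤ suc d ℕ.* d ℕ.^ a
    length-sphere-suc zero = ℕ.≤-trans
      (ℕ.≤-reflexive (≡.cong length (List.++-identityʳ (children o))))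
      (ℕ.≤-trans (List.length-filter (child? o) (nbrs o))
        (ℕ.≤-reflexive (≡.trans (regular o) (≡.trans (ℕ.+-comm d 1) (≡.sym (ℕ.*-identityʳ (suc d)))))))
    length-sphere-suc (suc a) = ℕ.≤-trans
      (length-concatMap children d (sphere (suc a)) λ u∈ → length-children (sphere-dist (suc a) u∈))
      (ℕ.≤-trans (ℕ.*-monoˡ-≤ d (length-sphere-suc a))
        (ℕ.≤-reflexive (≡.trans (ℕ.*-assoc (suc d) (d ℕ.^ a) d) (≡.cong (suc d ℕ.*_) (ℕ.*-comm (d ℕ.^ a) d)))))

    -- For `a ≥ 1` the power could be `d ^ (a - 1)`; giving away a factor `d` lets one formula cover
    -- `a = 0` too.
    length-sphere : ∀ a → length (sphere a) ℕ.≤ suc d ℕ.* d ℕ.^ a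
    length-sphere zero    = ℕ.s≤s ℕ.z≤n
    length-sphere (suc a) = ℕ.≤-trans (length-sphere-suc a)
      (ℕ.*-monoʳ-≤ (suc d) (ℕ.^-monoʳ-≤ d {{ℕ.>-nonZero 1≤d}} (ℕ.n≤1+n a)))

module _ (T : Graph) (isTree : IsTree T) where
  open Graph T using (~-sym)

  private module From o = TreeDistance T isTree o

  dist-sym-≤ : ∀ u v → From.dist u v ℕ.≤ From.dist v u
  dist-sym-≤ u v = ℕ.≤-trans (From.dist-minimal u (revApp ~-sym (From.path v u) ε))
    (ℕ.≤-reflexive (≡.trans (∣revApp∣ ~-sym (From.path v u) ε) (ℕ.+-identityʳ _)))

  -- Each `dist` is tied to its root. Symmetry is wanted when a function centred at another vertex
  -- is evaluated at `ρ`.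
  dist-sym : ∀ u v → From.dist u v ≡ From.dist v u
  dist-sym u v = ℕ.≤-antisym (dist-sym-≤ u v) (dist-sym-≤ v u)

-- Finite sums.

module ListSums (em : ExcludedMiddle 0ℓ) (ℝ : CompleteOrderedField) where
  open CompleteOrderedField ℝ
    renaming (refl to ≈-refl; sym to ≈-sym; trans to ≈-trans)
  open RealPowers ℝ using (fromℕ)
  open OrderedField em ℝ
  open Solver

  ∑ₗ : ∀ {A : Set} → List A → (A → Carrier) → Carrier
  ∑ₗ xs f = foldr _+_ 0# (map f xs)

  module _ {A : Set} where
    ∑ₗ-cong : ∀ {f g : A → Carrier} xs → (∀ {x} → x ∈ xs → f x ≈ g x) → ∑ₗ xs f ≈ ∑ₗ xs g
    ∑ₗ-cong []       _  = ≈-refl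
    ∑ₗ-cong (x ∷ xs) eq = +-cong (eq (here ≡.refl)) (∑ₗ-cong xs λ x∈ → eq (there x∈))

    ∑ₗ-mono : ∀ {f g : A → Carrier} xs → (∀ {x} → x ∈ xs → f x ≤ g x) → ∑ₗ xs f ≤ ∑ₗ xs g
    ∑ₗ-mono []       _  = ≤-refl
    ∑ₗ-mono (x ∷ xs) le = +-mono-≤ (le (here ≡.refl)) (∑ₗ-mono xs λ x∈ → le (there x∈))

    ∑ₗ-nonneg : ∀ {f : A → Carrier} xs → (∀ {x} → x ∈ xs → 0# ≤ f x) → 0# ≤ ∑ₗ xs f
    ∑ₗ-nonneg []       _  = ≤-refl
    ∑ₗ-nonneg (x ∷ xs) le = +-nonneg (le (here ≡.refl)) (∑ₗ-nonneg xs λ x∈ → le (there x∈))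

    ∑ₗ-const : ∀ c (xs : List A) → ∑ₗ xs (λ _ → c) ≈ fromℕ (length xs) * c
    ∑ₗ-const c []       = ≈-sym (zeroˡ c)
    ∑ₗ-const c (x ∷ xs) = ≈-trans (+-congˡ (∑ₗ-const c xs))
      (solve 2 (λ c n → c :+ n :* c := (con (+ 1) :+ n) :* c) ≈-refl c _)

    ∑ₗ-zero : ∀ {f : A → Carrier} xs → (∀ {x} → x ∈ xs → f x ≈ 0#) → ∑ₗ xs f ≈ 0#
    ∑ₗ-zero xs eq = ≈-trans (∑ₗ-cong xs eq) (≈-trans (∑ₗ-const 0# xs) (zeroʳ _))

    ∑ₗ-+ : ∀ (f g : A → Carrier) xs → ∑ₗ xs (λ x → f x + g x) ≈ ∑ₗ xs f + ∑ₗ xs g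
    ∑ₗ-+ f g []       = ≈-sym (+-identityˡ 0#)
    ∑ₗ-+ f g (x ∷ xs) = ≈-trans (+-congˡ (∑ₗ-+ f g xs))
      (solve 4 (λ a b c d → a :+ b :+ (c :+ d) := a :+ c :+ (b :+ d)) ≈-refl _ _ _ _)

    ∑ₗ-*ˡ : ∀ c (f : A → Carrier) xs → ∑ₗ xs (λ x → c * f x) ≈ c * ∑ₗ xs f
    ∑ₗ-*ˡ c f []       = ≈-sym (zeroʳ c)
    ∑ₗ-*ˡ c f (x ∷ xs) = ≈-trans (+-congˡ (∑ₗ-*ˡ c f xs)) (≈-sym (distribˡ c _ _))

    ∑ₗ-++ : ∀ (f : A → Carrier) xs ys → ∑ₗ (xs ++ ys) f ≈ ∑ₗ xs f + ∑ₗ ys f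
    ∑ₗ-++ f []       ys = ≈-sym (+-identityˡ _)
    ∑ₗ-++ f (x ∷ xs) ys = ≈-trans (+-congˡ (∑ₗ-++ f xs ys)) (≈-sym (+-assoc _ _ _))

    ∑ₗ-map : ∀ {B : Set} (h : B → A) (f : A → Carrier) xs → ∑ₗ (map h xs) f ≡ ∑ₗ xs (λ x → f (h x))
    ∑ₗ-map h f xs = ≡.cong (foldr _+_ 0#) (≡.sym (List.map-∘ xs))

    -- c is added to both sides so that no predecessor of the length occurs.
    ∑ₗ-one-exception : ∀ {f : A → Carrier} {c p xs} → Unique xs → p ∈ xs →
      (∀ {y} → y ∈ xs → y ≢ p → f y ≈ c) → ∑ₗ xs f + c ≈ f p + fromℕ (length xs) * c
    ∑ₗ-one-exception {f} {c} {p} {_ ∷ xs} (p≢ ∷ _) (here ≡.refl) eq = ≈-trans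
      (+-congʳ (+-congˡ (≈-trans (∑ₗ-cong xs λ y∈ → eq (there y∈) λ y≡p → All.lookup p≢ y∈ (≡.sym y≡p))
        (∑ₗ-const c xs))))
      (solve 3 (λ a n c → a :+ n :* c :+ c := a :+ (con (+ 1) :+ n) :* c) ≈-refl _ _ _)
    ∑ₗ-one-exception {f} {c} {p} {x ∷ xs} (x≢ ∷ xs!) (there p∈) eq = ≈-trans (+-assoc _ _ _) (≈-trans
      (+-cong (eq (here ≡.refl) (All.lookup x≢ p∈)) (∑ₗ-one-exception xs! p∈ λ y∈ → eq (there y∈)))
      (solve 3 (λ a n c → c :+ (a :+ n :* c) := a :+ (con (+ 1) :+ n) :* c) ≈-refl _ _ _))

-- Mass distributions as positive functionals, and greedy toppling.

module ToppleFunctional (em : ExcludedMiddle 0ℓ) (ℝ : CompleteOrderedField)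
  (G : Graph) {r : ℕ} (1≤r : 1 ℕ.≤ r) (regular : IsRegular G r) where
  open CompleteOrderedField ℝ
    renaming (refl to ≈-refl; sym to ≈-sym; trans to ≈-trans)
  open RealPowers ℝ using (fromℕ)
  open OrderedField em ℝ
  open ListSums em ℝ
  open Solver
  open ≤-Reasoning
  open Graph G
  open Toppling ℝ G
  open DecMembership _≟_ using (_∈?_)

  indicator-refl : ∀ v → indicator v v ≈ 1#
  indicator-refl v with v ≟ v
  ... | yes _  = ≈-refl
  ... | no v≢v = contradiction ≡.refl v≢v

  indicator-≢ : ∀ {v w} → v ≢ w → indicator v w ≈ 0#
  indicator-≢ {v} {w} v≢w with v ≟ w
  ... | yes v≡w = contradiction v≡w v≢w
  ... | no  _   = ≈-refl

  indicator-nonneg : ∀ v w → 0# ≤ indicator v w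
  indicator-nonneg v = nonneg (δ v)

  ∑-indicator-∉ : ∀ {v} (f : V → Carrier) xs → v ∉ xs → ∑ₗ xs (λ w → indicator v w * f w) ≈ 0#
  ∑-indicator-∉ f xs v∉ = ∑ₗ-zero xs λ {w} w∈ →
    ≈-trans (*-congʳ (indicator-≢ λ { ≡.refl → v∉ w∈ })) (zeroˡ (f w))

  ∑-indicator : ∀ {v} (f : V → Carrier) {xs} → Unique xs → v ∈ xs →
    ∑ₗ xs (λ w → indicator v w * f w) ≈ f v
  ∑-indicator {v} f {_ ∷ xs} (v≢ ∷ _) (here ≡.refl) = ≈-trans (+-cong
    (≈-trans (*-congʳ (indicator-refl v)) (*-identityˡ _))
    (∑-indicator-∉ f xs (All.All¬⇒¬Any v≢))) (+-identityʳ _)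
  ∑-indicator {v} f {x ∷ _} (x≢ ∷ xs!) (there v∈) = ≈-trans (+-cong
    (≈-trans (*-congʳ (indicator-≢ λ v≡x → All.lookup x≢ v∈ (≡.sym v≡x))) (zeroˡ _))
    (∑-indicator f xs! v∈)) (+-identityˡ _)

  count : List V → V → Carrier
  count xs v = ∑ₗ xs (indicator v)

  count-nonneg : ∀ xs v → 0# ≤ count xs v
  count-nonneg xs v = ∑ₗ-nonneg xs λ {w} _ → indicator-nonneg v w

  count-∉ : ∀ {v} xs → v ∉ xs → count xs v ≈ 0#
  count-∉ xs v∉ = ∑ₗ-zero xs λ w∈ → indicator-≢ λ { ≡.refl → v∉ w∈ }

  1≤count : ∀ {v} xs → v ∈ xs → 1# ≤ count xs v
  1≤count {v} (_ ∷ xs) (here ≡.refl) = ≤-excess (count-nonneg xs v) (+-congʳ (≈-sym (indicator-refl v)))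
  1≤count {v} (x ∷ xs) (there v∈) = ≤-trans (1≤count xs v∈) (≤-excess (indicator-nonneg v x) (+-comm _ _))

  count≤1 : ∀ {xs} v → Unique xs → count xs v ≤ 1#
  count≤1 {xs} v xs! with v ∈? xs
  ... | no  v∉ = ≤-trans (≈⇒≤ (count-∉ xs v∉)) 0≤1
  ... | yes v∈ = ≈⇒≤ (≈-trans (∑ₗ-cong xs λ _ → ≈-sym (*-identityʳ _)) (∑-indicator (λ _ → 1#) xs! v∈))

  -- A finite combination of point evaluations, representing a mass
  -- distribution; entries for one vertex may repeat and be negative.
  Charge : Set
  Charge = List (V × Carrier)

  support : Charge → List V
  support = map proj₁

  E : Charge → (V → Carrier) → Carrier
  E l f = ∑ₗ l λ (v , c) → c * f v

  Represents : Charge → MassDistribution → Set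
  Represents l μ = ∀ w → mass μ w ≈ E l (λ v → indicator v w)

  E-cong : ∀ {f g} l → (∀ v → f v ≈ g v) → E l f ≈ E l g
  E-cong l eq = ∑ₗ-cong l λ {x} _ → *-congˡ (eq (proj₁ x))

  E-+ : ∀ l f g → E l (λ v → f v + g v) ≈ E l f + E l g
  E-+ l f g = ≈-trans (∑ₗ-cong l λ _ → distribˡ _ _ _) (∑ₗ-+ _ _ l)

  E-*ˡ : ∀ l c f → E l (λ v → c * f v) ≈ c * E l f
  E-*ˡ l c f = ≈-trans (∑ₗ-cong l λ { {v , a} _ → solve 3 (λ a c x → a :* (c :* x) := c :* (a :* x)) ≈-refl a c (f v) })
    (∑ₗ-*ˡ c _ l)

  E-∑ : ∀ {A : Set} l (h : A → V → Carrier) xs →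
    E l (λ v → ∑ₗ xs (λ x → h x v)) ≈ ∑ₗ xs (λ x → E l (h x))
  E-∑ l h []       = ∑ₗ-zero l λ _ → zeroʳ _
  E-∑ l h (x ∷ xs) = ≈-trans (E-+ l (h x) _) (+-congˡ (E-∑ l h xs))

  -- Collects the entries of the charge vertex by vertex. For a charge representing a distribution
  -- the collected coefficients are its masses, hence nonnegative although single entries may not
  -- be: this is where positivity of `E` comes from.
  E-expand : ∀ {xs} l f → Unique xs → (∀ {v} → v ∈ support l → v ∈ xs) →
    E l f ≈ ∑ₗ xs (λ w → E l (λ v → indicator v w) * f w)
  E-expand {xs} [] f _ _ = ≈-sym (∑ₗ-zero xs λ _ → zeroˡ _)
  E-expand {xs} ((v , c) ∷ l) f xs! ⊆ = begin-equality
    c * f v + E l f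
      ≈⟨ +-cong (*-congˡ (≈-sym (∑-indicator f xs! (⊆ (here ≡.refl))))) (E-expand l f xs! λ v∈ → ⊆ (there v∈)) ⟩
    c * ∑ₗ xs (λ w → indicator v w * f w) + ∑ₗ xs (λ w → E l (λ v → indicator v w) * f w)
      ≈⟨ +-congʳ (∑ₗ-*ˡ c _ xs) ⟨
    ∑ₗ xs (λ w → c * (indicator v w * f w)) + ∑ₗ xs (λ w → E l (λ v → indicator v w) * f w)
      ≈⟨ ∑ₗ-+ _ _ xs ⟨
    ∑ₗ xs (λ w → c * (indicator v w * f w) + E l (λ v → indicator v w) * f w)
      ≈⟨ ∑ₗ-cong xs (λ {w} _ → solve 4 (λ c i x e → c :* (i :* x) :+ e :* x := (c :* i :+ e) :* x) ≈-refl c (indicator v w) (f w) _) ⟩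
    ∑ₗ xs (λ w → (c * indicator v w + E l (λ v → indicator v w)) * f w)
      ∎

  module _ {l μ} (rep : Represents l μ) where
    vertex-list : List V
    vertex-list = deduplicate _≟_ (support l)

    vertex-list! : Unique vertex-list
    vertex-list! = deduplicate-! _≟_ (support l)

    ∈-vertex-list : ∀ {v} → v ∈ support l → v ∈ vertex-list
    ∈-vertex-list = ∈-deduplicate⁺ _≟_

    E-nonneg : ∀ {f} → (∀ {v} → v ∈ support l → 0# ≤ f v) → 0# ≤ E l f
    E-nonneg {f} 0≤f = ≤-respʳ-≈ (≈-sym (E-expand l f vertex-list! ∈-vertex-list))
      (∑ₗ-nonneg vertex-list λ {w} w∈ → *-nonneg (≤-respʳ-≈ (rep w) (nonneg μ w))
        (0≤f (∈-deduplicate⁻ _≟_ (support l) w∈)))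

    E-mono : ∀ {f g} → (∀ {v} → v ∈ support l → f v ≤ g v) → E l f ≤ E l g
    E-mono {f} {g} f≤g = ≤-excess (E-nonneg λ v∈ → x≤y⇒0≤y-x (f≤g v∈)) (≈-trans (≈-sym (E-+ l _ _))
      (E-cong l λ v → solve 2 (λ a b → a :+ (b :- a) := b) ≈-refl (f v) (g v)))

    E-count : ∀ xs → E l (count xs) ≈ ∑ₗ xs (mass μ)
    E-count xs = ≈-trans (E-∑ l (λ w v → indicator v w) xs) (∑ₗ-cong xs λ {w} _ → ≈-sym (rep w))

    ∑-mass≤ : ∀ {t} xs → 0# ≤ t → (∀ {v} → v ∈ xs → mass μ v ≤ t) → ∀ {n} → length xs ℕ.≤ n →
      E l (count xs) ≤ fromℕ n * t
    ∑-mass≤ {t} xs 0≤t ≤t {n} len = begin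
      E l (count xs)          ≈⟨ E-count xs ⟩
      ∑ₗ xs (mass μ)          ≤⟨ ∑ₗ-mono xs ≤t ⟩
      ∑ₗ xs (λ _ → t)         ≈⟨ ∑ₗ-const t xs ⟩
      fromℕ (length xs) * t   ≤⟨ *-monoʳ-≤ 0≤t (fromℕ-mono-≤ len) ⟩
      fromℕ n * t             ∎

    module _ {A : V → Set} {F : V → Carrier} (0≤F : ∀ v → 0# ≤ F v) {c : Carrier} (0≤c : 0# ≤ c) where
      -- Light vertices in the support number at most `length l`; at the heavy ones outside `A`,
      -- `c * F` is at least 1 and Markov's inequality applies. Both estimates are comparisons of
      -- functions under the monotone `E`.
      outside-mass-bound : ∀ {t} → 0# ≤ t → (∀ v → ¬ A v → mass μ v ≤ t ⊎ 1# ≤ c * F v) →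
        ∀ {vs} → Unique vs → All (λ v → ¬ A v) vs → ∑ₗ vs (mass μ) ≤ fromℕ (length l) * t + c * E l F
      outside-mass-bound {t} 0≤t good⊎bad {vs} vs! vs∉A = begin
        ∑ₗ vs (mass μ)                            ≈⟨ E-count vs ⟨
        E l (count vs)                            ≤⟨ E-mono pointwise ⟩
        E l (λ v → count goods v + c * F v)       ≈⟨ E-+ l _ _ ⟩
        E l (count goods) + E l (λ v → c * F v)   ≤⟨ +-mono-≤
          (∑-mass≤ goods 0≤t (λ v∈ → proj₂ (∈-filter⁻ good? {xs = support l} v∈))
            (ℕ.≤-trans (List.length-filter good? (support l)) (ℕ.≤-reflexive (List.length-map proj₁ l))))
          (≈⇒≤ (E-*ˡ l c F)) ⟩
        fromℕ (length l) * t + c * E l F          ∎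
        where
        good? : ∀ v → Dec (mass μ v ≤ t)
        good? v = em
        goods : List V
        goods = filter good? (support l)
        0≤cF : ∀ v → 0# ≤ c * F v
        0≤cF v = *-nonneg 0≤c (0≤F v)
        covered : ∀ {v} → v ∈ support l → mass μ v ≤ t ⊎ 1# ≤ c * F v → 1# ≤ count goods v + c * F v
        covered {v} v∈ (inj₁ good) = ≤-trans (1≤count goods (∈-filter⁺ good? v∈ good)) (≤-excess (0≤cF v) ≈-refl)
        covered {v} v∈ (inj₂ bad)  = ≤-trans bad (≤-excess (count-nonneg goods v) (+-comm _ _))
        pointwise : ∀ {v} → v ∈ support l → count vs v ≤ count goods v + c * F v
        pointwise {v} v∈ with v ∈? vs
        ... | no  v∉vs = ≤-trans (≈⇒≤ (count-∉ vs v∉vs)) (+-nonneg (count-nonneg goods v) (0≤cF v))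
        ... | yes v∈vs = ≤-trans (count≤1 v vs!) (covered v∈ (good⊎bad v (All.lookup vs∉A v∈vs)))

      -- The total mass is shared out: `ws` is the part of the support outside `A`, the vertices of
      -- `vs` carry at most `t` each, and Markov's inequality bounds the rest through `F`.
      outside-mass-large : ∀ {t} → 0# ≤ t → ∀ vs → (∀ {v} → v ∈ vs → mass μ v ≤ t) →
        (∀ {v} → v ∈ support l → ¬ A v ⊎ v ∈ vs ⊎ 1# ≤ c * F v) → 1# ≤ E l (λ _ → 1#) →
        ∃[ ws ] Unique ws × All (λ v → ¬ A v) ws ×
          1# ≤ ∑ₗ ws (mass μ) + (fromℕ (length vs) * t + c * E l F)
      outside-mass-large {t} 0≤t vs vs≤t cases 1≤E1 = ws , Unique.filter⁺ out? vertex-list! ,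
        All.all-filter out? vertex-list , (begin
        1#                                                    ≤⟨ 1≤E1 ⟩
        E l (λ _ → 1#)                                        ≤⟨ E-mono (λ v∈ → pointwise v∈ (cases v∈)) ⟩
        E l (λ v → count ws v + (count vs v + c * F v))       ≈⟨ ≈-trans (E-+ l _ _) (+-congˡ (E-+ l _ _)) ⟩
        E l (count ws) + (E l (count vs) + E l (λ v → c * F v)) ≤⟨ +-mono-≤ (≈⇒≤ (E-count ws))
          (+-mono-≤ (∑-mass≤ vs 0≤t vs≤t ℕ.≤-refl) (≈⇒≤ (E-*ˡ l c F))) ⟩
        ∑ₗ ws (mass μ) + (fromℕ (length vs) * t + c * E l F)  ∎)
        where
        out? : ∀ v → Dec (¬ A v)
        out? v = em
        ws : List V
        ws = filter out? vertex-list
        0≤cF : ∀ v → 0# ≤ c * F v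
        0≤cF v = *-nonneg 0≤c (0≤F v)
        pointwise : ∀ {v} → v ∈ support l → ¬ A v ⊎ v ∈ vs ⊎ 1# ≤ c * F v →
          1# ≤ count ws v + (count vs v + c * F v)
        pointwise {v} v∈ (inj₁ v∉A) = ≤-trans (1≤count ws (∈-filter⁺ out? (∈-vertex-list v∈) v∉A))
          (≤-excess (+-nonneg (count-nonneg vs v) (0≤cF v)) ≈-refl)
        pointwise {v} v∈ (inj₂ (inj₁ v∈vs)) = ≤-trans (1≤count vs v∈vs) (≤-excess
          (+-nonneg (count-nonneg ws v) (0≤cF v))
          (solve 3 (λ a b c → b :+ (a :+ c) := a :+ (b :+ c)) ≈-refl _ _ _))
        pointwise {v} v∈ (inj₂ (inj₂ bad)) = ≤-trans bad (≤-excess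
          (+-nonneg (count-nonneg ws v) (count-nonneg vs v))
          (solve 3 (λ a b c → c :+ (a :+ b) := a :+ (b :+ c)) ≈-refl _ _ _))

  Superharmonic : (V → Carrier) → Set
  Superharmonic F = ∀ v → ∑ₗ (nbrs v) F ≤ fromℕ r * F v

  -- Nothing is merged, so every toppling adds exactly `r + 1` entries and the length of a charge
  -- records the number of topplings.
  toppled : V → Carrier → Charge → Charge
  toppled v m l = (v , - m) ∷ map (λ y → y , m * fromℕ r ⁻¹) (nbrs v) ++ l

  E-toppled : ∀ v m l f → E (toppled v m l) f ≈ E l f + m * (fromℕ r ⁻¹ * ∑ₗ (nbrs v) f - f v)
  E-toppled v m l f = begin-equality
    - m * f v + ∑ₗ (map (λ y → y , m * r⁻¹) (nbrs v) ++ l) (λ (v , c) → c * f v)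
      ≈⟨ +-congˡ (∑ₗ-++ _ (map (λ y → y , m * r⁻¹) (nbrs v)) l) ⟩
    - m * f v + (∑ₗ (map (λ y → y , m * r⁻¹) (nbrs v)) (λ (v , c) → c * f v) + E l f)
      ≡⟨ ≡.cong (λ s → - m * f v + (s + E l f)) (∑ₗ-map _ _ (nbrs v)) ⟩
    - m * f v + (∑ₗ (nbrs v) (λ y → m * r⁻¹ * f y) + E l f)
      ≈⟨ +-congˡ (+-congʳ (∑ₗ-*ˡ (m * r⁻¹) f (nbrs v))) ⟩
    - m * f v + (m * r⁻¹ * ∑ₗ (nbrs v) f + E l f)
      ≈⟨ solve 5 (λ m i s x e → (:- m) :* x :+ (m :* i :* s :+ e) := e :+ m :* (i :* s :- x)) ≈-refl m r⁻¹ _ (f v) _ ⟩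
    E l f + m * (r⁻¹ * ∑ₗ (nbrs v) f - f v) ∎
    where
    r⁻¹ : Carrier
    r⁻¹ = fromℕ r ⁻¹

  topple-represents : ∀ {l μ ν v m} → Represents l μ →
    (∀ w → mass ν w ≈ topple v m (mass μ) w) → Represents (toppled v m l) ν
  topple-represents {l} {μ} {ν} {v} {m} rep ν≈ w = begin-equality
    mass ν w ≈⟨ ν≈ w ⟩
    mass μ w - m * indicator v w + m * fromℕ (degree v) ⁻¹ * ∑ₗ (nbrs v) (λ y → indicator y w)
      ≡⟨ ≡.cong (λ k → mass μ w - m * indicator v w + m * fromℕ k ⁻¹ * ∑ₗ (nbrs v) (λ y → indicator y w)) (regular v) ⟩
    mass μ w - m * indicator v w + m * fromℕ r ⁻¹ * ∑ₗ (nbrs v) (λ y → indicator y w)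
      ≈⟨ +-congʳ (+-congʳ (rep w)) ⟩
    E l (λ v → indicator v w) - m * indicator v w + m * fromℕ r ⁻¹ * ∑ₗ (nbrs v) (λ y → indicator y w)
      ≈⟨ solve 5 (λ e m i c s → e :- m :* i :+ m :* c :* s := e :+ m :* (c :* s :- i)) ≈-refl _ m _ _ _ ⟩
    E l (λ v → indicator v w) + m * (fromℕ r ⁻¹ * ∑ₗ (nbrs v) (λ y → indicator y w) - indicator v w)
      ≈⟨ E-toppled v m l (λ v → indicator v w) ⟨
    E (toppled v m l) (λ v → indicator v w) ∎

  0<r : 0# < fromℕ r
  0<r = fromℕ-pos 1≤r

  E-superharmonic : ∀ {v m F} l → 0# ≤ m → Superharmonic F → E (toppled v m l) F ≤ E l F
  E-superharmonic {v} {m} {F} l 0≤m sup = begin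
    E (toppled v m l) F                                ≈⟨ E-toppled v m l F ⟩
    E l F + m * (fromℕ r ⁻¹ * ∑ₗ (nbrs v) F - F v)     ≤⟨ ≤-excess
      (*-nonneg 0≤m (x≤y⇒0≤y-x (≤-respʳ-≈ (⁻¹-cancelˡ (F v) 0<r) (*-monoˡ-≤ (<⇒≤ (⁻¹-pos 0<r)) (sup v)))))
      (solve 4 (λ e m s x → e :+ m :* (s :- x) :+ m :* (x :- s) := e) ≈-refl _ m _ (F v)) ⟩
    E l F                                              ∎

  point-charge : V → Charge
  point-charge ρ = (ρ , 1#) ∷ []

  E-point : ∀ ρ f → E (point-charge ρ) f ≈ f ρ
  E-point ρ f = ≈-trans (+-identityʳ _) (*-identityˡ _)

  δ-represents : ∀ ρ → Represents (point-charge ρ) (δ ρ)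
  δ-represents ρ w = ≈-sym (E-point ρ (λ v → indicator v w))

  length-toppled : ∀ v m l → length (toppled v m l) ≡ suc r ℕ.+ length l
  length-toppled v m l = ≡.cong suc (≡.trans (List.length-++ (map (λ y → y , m * fromℕ r ⁻¹) (nbrs v)))
    (≡.cong (ℕ._+ length l) (≡.trans (List.length-map _ (nbrs v)) (regular v))))

  represent-run : ∀ {l μ ν} → Represents l μ → (s : Star _⟶_ μ ν) → ∃[ l′ ] Represents l′ ν ×
    length l′ ≡ ∣ s ∣ ℕ.* suc r ℕ.+ length l × (∀ {F} → Superharmonic F → E l′ F ≤ E l F)
  represent-run {l} rep ε = l , rep , ≡.refl , λ _ → ≤-refl
  represent-run {l} {μ} rep (_◅_ {j = μ′} (v , m , 0<m , _ , μ′≈) s)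
    = let l′ , rep′ , len , sup =
            represent-run {toppled v m l} {μ′} (topple-represents {l} {μ} {μ′} rep μ′≈) s
      in l′ , rep′ ,
         ≡.trans len (≡.trans (≡.cong (∣ s ∣ ℕ.* suc r ℕ.+_) (length-toppled v m l))
           (rearrange (∣ s ∣ ℕ.* suc r) (suc r) (length l))) ,
         λ superharmonic → ≤-trans (sup superharmonic) (E-superharmonic l (<⇒≤ 0<m) superharmonic)
    where
    rearrange : ∀ a b c → a ℕ.+ (b ℕ.+ c) ≡ b ℕ.+ a ℕ.+ c
    rearrange = solve-∀

  topple-all : MassDistribution → V → MassDistribution
  topple-all μ v .mass = topple v (mass μ v) (mass μ)
  topple-all μ v .nonneg w = +-nonneg remaining (*-nonneg
    (*-nonneg (nonneg μ v) (<⇒≤ (⁻¹-pos (≡.subst (λ k → 0# < fromℕ k) (≡.sym (regular v)) 0<r))))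
    (∑ₗ-nonneg (nbrs v) λ {y} _ → indicator-nonneg y w))
    where
    remaining : 0# ≤ mass μ w - mass μ v * indicator v w
    remaining with v ≟ w
    ... | yes ≡.refl = ≈⇒≥ (≈-trans (+-congˡ (-‿cong (*-identityʳ _))) (-‿inverseʳ _))
    ... | no  _      = ≤-respʳ-≈ (solve 2 (λ a b → a := a :- b :* con (+ 0)) ≈-refl _ _) (nonneg μ w)

  -- Toppling a vertex of R of mass at least t raises E φ by at least t / r,
  -- and E φ never exceeds c, so that fewer than J topplings can occur.
  module Greedy {R B : V → Set} {φ : V → Carrier} {c t : Carrier} (J : ℕ) (0<t : 0# < t)
    (gain : ∀ v → R v → fromℕ r * φ v + 1# ≤ ∑ₗ (nbrs v) φ)
    (stays : ∀ {v y} → R v → y ~ v → B y) (R⊆B : ∀ {v} → R v → B v)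
    (φ≤c : ∀ {v} → B v → φ v ≤ c)
    (c<J : fromℕ r * c < fromℕ J * t)
    where

    Stuck : Charge → MassDistribution → ℕ → Set
    Stuck l μ fuel = ∃[ ν ] Σ[ s ∈ Star _⟶_ μ ν ] ∣ s ∣ ℕ.≤ fuel × ∃[ l′ ] Represents l′ ν ×
      (∀ {v} → v ∈ support l′ → B v) × (∀ {F} → Superharmonic F → E l′ F ≤ E l F) ×
      (∀ v → R v → mass ν v ≤ t)

    support-toppled : ∀ {v m l} → R v → (∀ {y} → y ∈ support l → B y) →
      ∀ {y} → y ∈ support (toppled v m l) → B y
    support-toppled {v} {m} {l} v∈R ⊆B (here ≡.refl) = R⊆B v∈R
    support-toppled {v} {m} {l} v∈R ⊆B (there y∈)
      with ∈-++⁻ (map proj₁ (map (λ y → y , m * fromℕ r ⁻¹) (nbrs v)))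
             (≡.subst (_ ∈_) (List.map-++ proj₁ (map (λ y → y , m * fromℕ r ⁻¹) (nbrs v)) l) y∈)
    ... | inj₂ y∈l = ⊆B y∈l
    ... | inj₁ y∈n with ∈-map⁻ proj₁ y∈n
    ...   | _ , z∈ , ≡.refl with ∈-map⁻ _ z∈
    ...     | _ , y∈′ , ≡.refl = stays v∈R (∈-nbrs⁻ y∈′)

    -- `j` counts the topplings made and `fuel` those still allowed. At `fuel = 0` the accumulated
    -- `progress` contradicts `c<J`; before that, excluded middle either finds a heavy vertex of `R`
    -- or shows that there is none.
    greedy : ∀ fuel {j l μ} → fuel ℕ.+ j ≡ J → Represents l μ → (∀ {v} → v ∈ support l → B v) →
      E l (λ _ → 1#) ≈ 1# → fromℕ j * t ≤ fromℕ r * E l φ → Stuck l μ fuel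
    greedy zero {j} {l} {μ} ≡.refl rep ⊆B total-mass progress = contradiction (begin
      fromℕ j * t               ≤⟨ progress ⟩
      fromℕ r * E l φ           ≤⟨ *-monoˡ-≤ (<⇒≤ 0<r) (E-mono {l} {μ} rep λ v∈ → ≤-trans (φ≤c (⊆B v∈)) (≈⇒≥ (*-identityʳ c))) ⟩
      fromℕ r * E l (λ _ → c * 1#) ≈⟨ *-congˡ (≈-trans (E-*ˡ l c _) (≈-trans (*-congˡ total-mass) (*-identityʳ c))) ⟩
      fromℕ r * c               ∎) λ le → ≤⇒≯ le c<J
    greedy (suc fuel) {j} {l} {μ} eq rep ⊆B total-mass progress with em {∃[ v ] R v × t < mass μ v}
    ... | no none = μ , ε , ℕ.z≤n , l , rep , ⊆B , (λ _ → ≤-refl) , λ v v∈R → ≮⇒≥ λ lt → none (v , v∈R , lt)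
    ... | yes (v , v∈R , t<m) = let
        ν , s , len , l′ , rep′ , ⊆B′ , sup , stuck = greedy fuel {suc j} {toppled v m l} {topple-all μ v}
          (≡.trans (ℕ.+-suc fuel j) eq) (topple-represents {l} {μ} {topple-all μ v} rep λ _ → ≈-refl)
          (support-toppled {v} {m} {l} v∈R ⊆B) total-mass′ progress′
        in ν , (v , m , 0<m , ≤-refl , (λ _ → ≈-refl)) ◅ s , ℕ.s≤s len , l′ , rep′ , ⊆B′ ,
           (λ h → ≤-trans (sup h) (E-superharmonic l (<⇒≤ 0<m) h)) , stuck
      where
      m : Carrier
      m = mass μ v
      0<m : 0# < m
      0<m = ≤-<-trans (<⇒≤ 0<t) t<m
      total-mass′ : E (toppled v m l) (λ _ → 1#) ≈ 1#
      total-mass′ = begin-equality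
        E (toppled v m l) (λ _ → 1#)                                  ≈⟨ E-toppled v m l _ ⟩
        E l (λ _ → 1#) + m * (fromℕ r ⁻¹ * ∑ₗ (nbrs v) (λ _ → 1#) - 1#) ≈⟨ +-cong total-mass
          (*-congˡ (+-congʳ (*-congˡ (≈-trans (∑ₗ-const 1# (nbrs v)) (*-congʳ (reflexive (≡.cong fromℕ (regular v)))))))) ⟩
        1# + m * (fromℕ r ⁻¹ * (fromℕ r * 1#) - 1#)                   ≈⟨ +-congˡ (*-congˡ (+-congʳ (⁻¹-cancelˡ 1# 0<r))) ⟩
        1# + m * (1# - 1#)                                            ≈⟨ solve 1 (λ m → con (+ 1) :+ m :* (con (+ 1) :- con (+ 1)) := con (+ 1)) ≈-refl m ⟩
        1#                                                            ∎
      progress′ : fromℕ (suc j) * t ≤ fromℕ r * E (toppled v m l) φ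
      progress′ = begin
        (1# + fromℕ j) * t        ≈⟨ solve 2 (λ j t → (con (+ 1) :+ j) :* t := t :+ j :* t) ≈-refl _ t ⟩
        t + fromℕ j * t           ≤⟨ +-mono-≤ (<⇒≤ t<m) progress ⟩
        m + fromℕ r * E l φ       ≤⟨ ≤-excess
          (*-nonneg (<⇒≤ 0<m) (x≤y⇒0≤y-x (gain v v∈R)))
          (≈-trans (solve 5 (λ m r e s x → m :+ r :* e :+ m :* (s :- (r :* x :+ con (+ 1))) := r :* e :+ m :* (s :- r :* x)) ≈-refl m (fromℕ r) (E l φ) (∑ₗ (nbrs v) φ) (φ v))
            (+-congˡ (*-congˡ (+-congʳ (≈-sym (≈-trans (≈-sym (*-assoc _ _ _)) (≈-trans (*-congʳ (*-inverse 0<r)) (*-identityˡ _)))))))) ⟩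
        fromℕ r * E l φ + m * (fromℕ r * (fromℕ r ⁻¹ * ∑ₗ (nbrs v) φ) - fromℕ r * φ v)
          ≈⟨ solve 5 (λ m r e s x → r :* e :+ m :* (r :* s :- r :* x) := r :* (e :+ m :* (s :- x))) ≈-refl m (fromℕ r) (E l φ) (fromℕ r ⁻¹ * ∑ₗ (nbrs v) φ) (φ v) ⟩
        fromℕ r * (E l φ + m * (fromℕ r ⁻¹ * ∑ₗ (nbrs v) φ - φ v)) ≈⟨ *-congˡ (E-toppled v m l φ) ⟨
        fromℕ r * E (toppled v m l) φ ∎

-- Superharmonic functions of the two distances.

module RadialFunctions (em : ExcludedMiddle 0ℓ) (ℝ : CompleteOrderedField) where
  open CompleteOrderedField ℝ
    renaming (refl to ≈-refl; sym to ≈-sym; trans to ≈-trans)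
  open RealPowers ℝ using (_^_; fromℕ)
  open OrderedField em ℝ
  open Solver
  open ≤-Reasoning

  -- The sum over the neighbours, in the (d + 1)-regular tree, of a vertex at
  -- distance a from the root, of a function f of the distance.
  neighbour-sum : ℕ → (ℕ → Carrier) → ℕ → Carrier
  neighbour-sum d f zero    = fromℕ (suc d) * f 1
  neighbour-sum d f (suc a) = f a + fromℕ d * f (suc (suc a))

  RadialSuperharmonic : ℕ → ℕ → (ℕ → ℕ → Carrier) → Set
  RadialSuperharmonic d k g = ∀ a b →
    neighbour-sum d (λ a → g a b) a + neighbour-sum k (g a) b ≤ fromℕ (suc d ℕ.+ suc k) * g a b

  superharmonic-swap : ∀ {d k g} → RadialSuperharmonic d k g → RadialSuperharmonic k d (λ b a → g a b)
  superharmonic-swap {d} {k} {g} sup b a = begin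
    neighbour-sum k (g a) b + neighbour-sum d (λ a → g a b) a ≈⟨ +-comm _ _ ⟩
    neighbour-sum d (λ a → g a b) a + neighbour-sum k (g a) b ≤⟨ sup a b ⟩
    fromℕ (suc d ℕ.+ suc k) * g a b                           ≡⟨ ≡.cong (λ n → fromℕ n * g a b) (ℕ.+-comm (suc d) (suc k)) ⟩
    fromℕ (suc k ℕ.+ suc d) * g a b                           ∎

  neighbour-sum-*ʳ : ∀ d f c a → neighbour-sum d (λ a → f a * c) a ≈ neighbour-sum d f a * c
  neighbour-sum-*ʳ d f c zero    = ≈-sym (*-assoc _ _ _)
  neighbour-sum-*ʳ d f c (suc a) = solve 4 (λ x m y c → x :* c :+ m :* (y :* c) := (x :+ m :* y) :* c) ≈-refl _ _ _ _

  neighbour-sum-*ˡ : ∀ d f c a → neighbour-sum d (λ a → c * f a) a ≈ c * neighbour-sum d f a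
  neighbour-sum-*ˡ d f c zero    = solve 3 (λ m c y → m :* (c :* y) := c :* (m :* y)) ≈-refl _ _ _
  neighbour-sum-*ˡ d f c (suc a) = solve 4 (λ x m y c → c :* x :+ m :* (c :* y) := c :* (x :+ m :* y)) ≈-refl _ _ _ _

  ⁻¹≤1 : ∀ {x} → 1# ≤ x → x ⁻¹ ≤ 1#
  ⁻¹≤1 {x} 1≤x = ≤-respˡ-≈ (*-identityˡ _) (x≤y*z⇒x*y⁻¹≤z (<-≤-trans 0<1 1≤x) (≤-respʳ-≈ (≈-sym (*-identityˡ x)) 1≤x))

  module _ {d : ℕ} (1≤d : 1 ℕ.≤ d) where
    private
      x : Carrier
      x = fromℕ d ⁻¹
      0<x : 0# < x
      0<x = ⁻¹-pos (fromℕ-pos 1≤d)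
      d*x : fromℕ d * x ≈ 1#
      d*x = *-inverse (fromℕ-pos 1≤d)

    -- `x ^ a` is the probability that simple random walk started at distance `a` ever hits the
    -- root: harmonic off the root, and at the root no neighbour has a larger value.
    geometric : ∀ a → neighbour-sum d (x ^_) a ≤ fromℕ (suc d) * x ^ a
    geometric zero    = *-monoˡ-≤ (fromℕ-nonneg (suc d)) (≤-trans (≈⇒≤ (*-identityʳ x)) (⁻¹≤1 (1≤fromℕ 1≤d)))
    geometric (suc a) = ≈⇒≤ (begin-equality
      x ^ a + fromℕ d * (x * (x * x ^ a))     ≈⟨ solve 3 (λ p m x → p :+ m :* (x :* (x :* p)) := p :+ m :* x :* (x :* p)) ≈-refl (x ^ a) (fromℕ d) x ⟩
      x ^ a + fromℕ d * x * (x * x ^ a)       ≈⟨ +-congˡ (≈-trans (*-congʳ d*x) (*-identityˡ _)) ⟩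
      x ^ a + x * x ^ a                       ≈⟨ +-congʳ (≈-trans (*-congʳ d*x) (*-identityˡ _)) ⟨
      fromℕ d * x * x ^ a + x * x ^ a         ≈⟨ solve 3 (λ p m x → m :* x :* p :+ x :* p := (con (+ 1) :+ m) :* (x :* p)) ≈-refl (x ^ a) (fromℕ d) x ⟩
      fromℕ (suc d) * (x * x ^ a)             ∎)

  product-superharmonic : ∀ {d k f h} → (∀ a → 0# ≤ f a) → (∀ b → 0# ≤ h b) →
    (∀ a → neighbour-sum d f a ≤ fromℕ (suc d) * f a) →
    (∀ b → neighbour-sum k h b ≤ fromℕ (suc k) * h b) →
    RadialSuperharmonic d k (λ a b → f a * h b)
  product-superharmonic {d} {k} {f} {h} 0≤f 0≤h sup-f sup-h a b = begin
    neighbour-sum d (λ a → f a * h b) a + neighbour-sum k (λ b → f a * h b) b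
      ≈⟨ +-cong (neighbour-sum-*ʳ d f (h b) a) (neighbour-sum-*ˡ k h (f a) b) ⟩
    neighbour-sum d f a * h b + f a * neighbour-sum k h b
      ≤⟨ +-mono-≤ (*-monoʳ-≤ (0≤h b) (sup-f a)) (*-monoˡ-≤ (0≤f a) (sup-h b)) ⟩
    fromℕ (suc d) * f a * h b + f a * (fromℕ (suc k) * h b)
      ≈⟨ solve 4 (λ m n x y → m :* x :* y :+ x :* (n :* y) := (m :+ n) :* (x :* y)) ≈-refl _ _ _ _ ⟩
    (fromℕ (suc d) + fromℕ (suc k)) * (f a * h b)
      ≈⟨ *-congʳ (fromℕ-+ (suc d) (suc k)) ⟨
    fromℕ (suc d ℕ.+ suc k) * (f a * h b) ∎

  -- An upper counterpart of Bernoulli's inequality without division. The induction asks for no sign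
  -- of `1# - fromℕ n * σ`, since each step only drops a term `(n + 1) σ² (1 + σ)ⁿ`.
  power-upper : ∀ {σ} → 0# ≤ σ → ∀ n → (1# - fromℕ n * σ) * (1# + σ) ^ n ≤ 1#
  power-upper {σ} 0≤σ zero    = ≈⇒≤ (solve 1 (λ s → (con (+ 1) :- con (+ 0) :* s) :* con (+ 1) := con (+ 1)) ≈-refl σ)
  power-upper {σ} 0≤σ (suc n) = begin
    (1# - (1# + fromℕ n) * σ) * ((1# + σ) * (1# + σ) ^ n)
      ≤⟨ ≤-excess (*-nonneg (*-nonneg (fromℕ-nonneg (suc n)) (*-nonneg 0≤σ 0≤σ)) (^-nonneg n (+-nonneg 0≤1 0≤σ)))
         (solve 3 (λ n s p → (con (+ 1) :- (con (+ 1) :+ n) :* s) :* ((con (+ 1) :+ s) :* p)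
             :+ (con (+ 1) :+ n) :* (s :* s) :* p := (con (+ 1) :- n :* s) :* p) ≈-refl (fromℕ n) σ _) ⟩
    (1# - fromℕ n * σ) * (1# + σ) ^ n ≤⟨ power-upper 0≤σ n ⟩
    1# ∎

  -- Tailored to Markov's inequality: divided by `n * rate`, the weight is at least 1 wherever
  -- `Q a + n ≤ P b`, so at most `weight 0 0 / (n * rate)` mass can sit there.
  record EscapeWeight (d k P Q : ℕ) : Set where
    field
      weight        : ℕ → ℕ → Carrier
      rate          : Carrier
      nonneg        : ∀ a b → 0# ≤ weight a b
      superharmonic : RadialSuperharmonic d k weight
      rate-pos      : 0# < rate
      growth        : ∀ {a b n} → Q ℕ.* a ℕ.+ n ℕ.≤ P ℕ.* b → fromℕ n * rate ≤ weight a b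

  -- The weight u⁻ᵃ (vᵇ + C) with u = (1 + σ) ^ Q and v = (1 + σ) ^ P, where the
  -- ratio P / Q is slightly below (d - 1) / (k - 1): along the walk a grows at
  -- rate d - 1 and b at rate k - 1.  For small σ the weight is then superharmonic
  -- where b > 0, and the constant C makes it so where b = 0.
  module Escape {d′ k′ : ℕ} (1≤d′ : 1 ℕ.≤ d′) (M : ℕ) where
    d k P Q N : ℕ
    d = suc d′
    k = suc k′
    P = M ℕ.* d′
    Q = M ℕ.* k′ ℕ.+ 1
    N = P ℕ.+ Q

    δ κ μ p q K τ σ w u α v y : Carrier
    δ = fromℕ d′
    κ = fromℕ k′
    μ = fromℕ M
    p = fromℕ P
    q = fromℕ Q
    -- `τ` will bound `u - 1` and `v - 1`, and `σ` is chosen to make `1 - N σ = 1 / (1 + τ)`, whence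
    -- `w ^ N ≤ 1 + τ`. `K` collects the coefficients of the error terms in `key`, which then total
    -- at most `τ * K ≤ 1 ≤ δ`.
    K = q + (1# + 1# + 1#) * p * (1# + κ)
    τ = (1# + K) ⁻¹
    σ = τ * (fromℕ N * (1# + τ)) ⁻¹
    w = 1# + σ
    u = w ^ Q
    α = u ⁻¹
    v = w ^ P
    y = v ⁻¹

    0≤κ : 0# ≤ κ
    0≤κ = fromℕ-nonneg k′
    0≤p : 0# ≤ p
    0≤p = fromℕ-nonneg P
    1≤Q : 1 ℕ.≤ Q
    1≤Q = ℕ.m≤n+m 1 (M ℕ.* k′)
    0<q : 0# < q
    0<q = fromℕ-pos 1≤Q
    p≈ : p ≈ μ * δ
    p≈ = fromℕ-* M d′
    q≈ : q ≈ μ * κ + 1#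
    q≈ = ≈-trans (fromℕ-+ (M ℕ.* k′) 1) (+-cong (fromℕ-* M k′) fromℕ-1)

    0<K : 0# < K
    0<K = <-≤-trans 0<q (≤-excess (*-nonneg (*-nonneg (+-nonneg (+-nonneg 0≤1 0≤1) 0≤1) 0≤p) (+-nonneg 0≤1 0≤κ)) ≈-refl)
    0<1+K : 0# < 1# + K
    0<1+K = <-≤-trans 0<1 (≤-excess (<⇒≤ 0<K) ≈-refl)
    0<τ : 0# < τ
    0<τ = ⁻¹-pos 0<1+K
    τ+τK : τ + τ * K ≈ 1#
    τ+τK = ≈-trans (solve 2 (λ t k → t :+ t :* k := (con (+ 1) :+ k) :* t) ≈-refl τ K) (*-inverse 0<1+K)
    0<τK : 0# < τ * K
    0<τK = *-pos 0<τ 0<K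
    0≤1-τ : 0# ≤ 1# - τ
    0≤1-τ = x≤y⇒0≤y-x (≤-excess (<⇒≤ 0<τK) τ+τK)
    0≤1-τK : 0# ≤ 1# - τ * K
    0≤1-τK = x≤y⇒0≤y-x (≤-excess (<⇒≤ 0<τ) (≈-trans (+-comm _ _) τ+τK))
    0≤1+τ : 0# ≤ 1# + τ
    0≤1+τ = +-nonneg 0≤1 (<⇒≤ 0<τ)
    0<N1+τ : 0# < fromℕ N * (1# + τ)
    0<N1+τ = *-pos (fromℕ-pos (ℕ.≤-trans 1≤Q (ℕ.m≤n+m Q P))) (<-≤-trans 0<1 (≤-excess (<⇒≤ 0<τ) ≈-refl))
    0<σ : 0# < σ
    0<σ = *-pos 0<τ (⁻¹-pos 0<N1+τ)
    0≤σ : 0# ≤ σ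
    0≤σ = <⇒≤ 0<σ
    1≤w : 1# ≤ w
    1≤w = ≤-excess 0≤σ ≈-refl
    w^N≤ : w ^ N ≤ 1# + τ
    w^N≤ = begin
      w ^ N   ≈⟨ *-identityʳ _ ⟨
      w ^ N * 1# ≈⟨ *-congˡ one ⟨
      w ^ N * ((1# - fromℕ N * σ) * (1# + τ)) ≈⟨ solve 3 (λ x s t → x :* (s :* t) := s :* x :* t) ≈-refl (w ^ N) _ _ ⟩
      (1# - fromℕ N * σ) * w ^ N * (1# + τ) ≤⟨ *-monoʳ-≤ 0≤1+τ (power-upper 0≤σ N) ⟩
      1# * (1# + τ) ≈⟨ *-identityˡ _ ⟩
      1# + τ ∎
      where
      one : (1# - fromℕ N * σ) * (1# + τ) ≈ 1#
      one = begin-equality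
        (1# - fromℕ N * σ) * (1# + τ)               ≈⟨ solve 3 (λ n s t → (con (+ 1) :- n :* s) :* (con (+ 1) :+ t) := con (+ 1) :+ t :- s :* (n :* (con (+ 1) :+ t))) ≈-refl (fromℕ N) σ τ ⟩
        1# + τ - σ * (fromℕ N * (1# + τ))           ≈⟨ +-congˡ (-‿cong (*⁻¹-cancel τ 0<N1+τ)) ⟩
        1# + τ - τ                                  ≈⟨ solve 1 (λ t → con (+ 1) :+ t :- t := con (+ 1)) ≈-refl τ ⟩
        1#                                          ∎
    1≤u : 1# ≤ u
    1≤u = 1≤^ Q 1≤w
    1≤v : 1# ≤ v
    1≤v = 1≤^ P 1≤w
    u≤ : u ≤ 1# + τ
    u≤ = ≤-trans (^-monoʳ-≤ 1≤w (ℕ.m≤n+m Q P)) w^N≤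
    v≤ : v ≤ 1# + τ
    v≤ = ≤-trans (^-monoʳ-≤ 1≤w (ℕ.m≤m+n P Q)) w^N≤
    0<u : 0# < u
    0<u = <-≤-trans 0<1 1≤u
    0<v : 0# < v
    0<v = <-≤-trans 0<1 1≤v
    0<α : 0# < α
    0<α = ⁻¹-pos 0<u
    uα : u * α ≈ 1#
    uα = *-inverse 0<u
    vy : v * y ≈ 1#
    vy = *-inverse 0<v
    qσ≤u-1 : q * σ ≤ u - 1#
    qσ≤u-1 = ≤-respˡ-≈ (solve 1 (λ x → con (+ 1) :+ x :- con (+ 1) := x) ≈-refl _) (+-monoˡ-≤ (- 1#) (bernoulli Q 0≤σ))
    1-y≤pσ : 1# - y ≤ p * σ
    1-y≤pσ = ≤-respʳ-≈ (solve 1 (λ x → con (+ 1) :- (con (+ 1) :- x) := x) ≈-refl _)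
      (+-monoʳ-≤ 1# (neg-mono-≤ (*-cancelʳ-≤ 0<v (≤-trans (power-upper 0≤σ P) (≈⇒≥ (≈-trans (*-comm _ _) vy))))))
    0≤d-u : 0# ≤ fromℕ d - u
    0≤d-u = x≤y⇒0≤y-x (≤-trans u≤ (+-monoʳ-≤ 1# (≤-trans (≤-excess (<⇒≤ 0<τK) τ+τK) (1≤fromℕ 1≤d′))))
    0<d-u : 0# < fromℕ d - u
    0<d-u = <-≤-trans 0<τK (≤-excess (+-nonneg (x≤y⇒0≤y-x u≤) (x≤y⇒0≤y-x (1≤fromℕ 1≤d′)))
      (≈-trans (solve 4 (λ r t u m → r :+ (con (+ 1) :+ t :- u :+ (m :- con (+ 1))) := (t :+ r) :- u :+ m) ≈-refl (τ * K) τ u δ)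
        (≈-trans (+-congʳ (+-congʳ τ+τK)) (solve 2 (λ u m → con (+ 1) :- u :+ m := con (+ 1) :+ m :- u) ≈-refl u δ))))
    0<u-1 : 0# < u - 1#
    0<u-1 = <-≤-trans (*-pos 0<q 0<σ) qσ≤u-1
    0≤kv-1 : 0# ≤ fromℕ k * v - 1#
    0≤kv-1 = x≤y⇒0≤y-x (≤-respˡ-≈ (*-identityʳ 1#) (*-mono-≤ (fromℕ-nonneg k) 0≤1 (1≤fromℕ {k} (ℕ.s≤s ℕ.z≤n)) 1≤v))

    -- At `u = v = 1` the two sides are `p κ` and `q δ`. With `p = μ δ` and `q = μ κ + 1` they
    -- differ by exactly `δ`, the gain from the `+ 1` in `Q`, and this absorbs all terms with a
    -- factor `τ`.
    key : p * ((fromℕ k * v - 1#) * u) ≤ q * (fromℕ d - u)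
    key = begin
      p * ((fromℕ k * v - 1#) * u)
        ≤⟨ *-monoˡ-≤ 0≤p (*-mono-≤ (≤-trans 0≤kv-1 kv-1≤) (<⇒≤ 0<u) kv-1≤ u≤) ⟩
      p * (((1# + κ) * (1# + τ) - 1#) * (1# + τ))
        ≤⟨ ≤-excess (+-nonneg (+-nonneg (x≤y⇒0≤y-x (1≤fromℕ 1≤d′)) 0≤1-τK)
             (*-nonneg (*-nonneg (<⇒≤ 0<τ) 0≤p) (+-nonneg (*-nonneg (+-nonneg 0≤1 0≤κ) 0≤1-τ) 0≤1)))
           certificate ⟩
      q * (δ - τ)
        ≤⟨ *-monoˡ-≤ (<⇒≤ 0<q) (≤-excess (x≤y⇒0≤y-x u≤)
             (solve 3 (λ m t u → m :- t :+ (con (+ 1) :+ t :- u) := con (+ 1) :+ m :- u) ≈-refl δ τ u)) ⟩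
      q * (fromℕ d - u) ∎
      where
      kv-1≤ : fromℕ k * v - 1# ≤ (1# + κ) * (1# + τ) - 1#
      kv-1≤ = +-monoˡ-≤ (- 1#) (*-monoˡ-≤ (fromℕ-nonneg k) v≤)
      certificate : p * (((1# + κ) * (1# + τ) - 1#) * (1# + τ))
        + (δ - 1# + (1# - τ * K) + τ * p * ((1# + κ) * (1# - τ) + 1#)) ≈ q * (δ - τ)
      certificate = begin-equality
        p * (((1# + κ) * (1# + τ) - 1#) * (1# + τ)) + (δ - 1# + (1# - τ * K) + τ * p * ((1# + κ) * (1# - τ) + 1#))
          ≈⟨ solve 5 (λ p q κ τ δ → let i = con (+ 1) in
               p :* (((i :+ κ) :* (i :+ τ) :- i) :* (i :+ τ)) :+ (δ :- i :+ (i :- τ :* (q :+ (i :+ i :+ i) :* p :* (i :+ κ))) :+ τ :* p :* ((i :+ κ) :* (i :- τ) :+ i))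
               := p :* κ :+ δ :- q :* τ) ≈-refl p q κ τ δ ⟩
        p * κ + δ - q * τ             ≈⟨ +-congʳ (+-congʳ (*-congʳ p≈)) ⟩
        μ * δ * κ + δ - q * τ         ≈⟨ solve 5 (λ μ δ κ q τ → μ :* δ :* κ :+ δ :- q :* τ := (μ :* κ :+ con (+ 1)) :* δ :- q :* τ) ≈-refl μ δ κ q τ ⟩
        (μ * κ + 1#) * δ - q * τ      ≈⟨ +-congʳ (*-congʳ q≈) ⟨
        q * δ - q * τ                 ≈⟨ solve 3 (λ δ q τ → q :* δ :- q :* τ := q :* (δ :- τ)) ≈-refl δ q τ ⟩
        q * (δ - τ)                   ∎

    -- Off the root, summing over neighbours multiplies `α ^ a` by `A` and `v ^ b` by `B`. The
    -- deficit `e = d + 1 - A` in the first factor has to pay for the excess of `B` over `k + 1` in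
    -- the second.
    A e B : Carrier
    A = u + fromℕ d * α
    e = (u - 1#) * (fromℕ d - u) * α
    B = y + fromℕ k * v

    0<e : 0# < e
    0<e = *-pos (*-pos 0<u-1 0<d-u) 0<α

    A+e : A + e ≈ fromℕ (suc d)
    A+e = begin-equality
      u + fromℕ d * α + (u - 1#) * (fromℕ d - u) * α
        ≈⟨ solve 3 (λ u d α → u :+ d :* α :+ (u :- con (+ 1)) :* (d :- u) :* α := u :+ (d :- u :+ con (+ 1)) :* (u :* α)) ≈-refl u (fromℕ d) α ⟩
      u + (fromℕ d - u + 1#) * (u * α)  ≈⟨ +-congˡ (≈-trans (*-congˡ uα) (*-identityʳ _)) ⟩
      u + (fromℕ d - u + 1#)            ≈⟨ solve 2 (λ u d → u :+ (d :- u :+ con (+ 1)) := con (+ 1) :+ d) ≈-refl u (fromℕ d) ⟩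
      1# + fromℕ d                      ∎

    B≤ : B ≤ fromℕ (suc k) + e
    B≤ = begin
      y + fromℕ k * v
        ≈⟨ solve 3 (λ y k v → y :+ k :* v := con (+ 1) :+ k :* con (+ 1) :+ (y :+ k :* v :- con (+ 1) :- k :* con (+ 1))) ≈-refl y (fromℕ k) v ⟩
      1# + fromℕ k * 1# + (y + fromℕ k * v - 1# - fromℕ k * 1#)
        ≈⟨ +-cong (+-congˡ (*-identityʳ _)) (≈-trans (+-congˡ (-‿cong (*-congˡ (≈-sym vy))))
             (solve 3 (λ y k v → y :+ k :* v :- con (+ 1) :- k :* (v :* y) := (con (+ 1) :- y) :* (k :* v :- con (+ 1))) ≈-refl y (fromℕ k) v)) ⟩
      fromℕ (suc k) + (1# - y) * (fromℕ k * v - 1#)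
        ≤⟨ +-monoʳ-≤ _ (*-monoʳ-≤ 0≤kv-1 1-y≤pσ) ⟩
      fromℕ (suc k) + p * σ * (fromℕ k * v - 1#)
        ≈⟨ +-congˡ (≈-trans (≈-sym (*-identityʳ _)) (≈-trans (*-congˡ (≈-sym uα))
             (solve 5 (λ p σ x u α → p :* σ :* x :* (u :* α) := p :* (x :* u) :* (σ :* α)) ≈-refl p σ _ u α))) ⟩
      fromℕ (suc k) + p * ((fromℕ k * v - 1#) * u) * (σ * α)
        ≤⟨ +-monoʳ-≤ _ (*-monoʳ-≤ (*-nonneg 0≤σ (<⇒≤ 0<α)) key) ⟩
      fromℕ (suc k) + q * (fromℕ d - u) * (σ * α)
        ≈⟨ +-congˡ (solve 4 (λ q x σ α → q :* x :* (σ :* α) := q :* σ :* x :* α) ≈-refl q _ σ α) ⟩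
      fromℕ (suc k) + q * σ * (fromℕ d - u) * α
        ≤⟨ +-monoʳ-≤ _ (*-monoʳ-≤ (<⇒≤ 0<α) (*-monoʳ-≤ 0≤d-u qσ≤u-1)) ⟩
      fromℕ (suc k) + e ∎

    -- At `b = 0` no neighbour is nearer, and `v ^ b` alone overshoots by `(k + 1) (v - 1)`. The
    -- value of `C` makes the allowance `C * e` equal to this.
    C : Carrier
    C = fromℕ (suc k) * (v - 1#) * e ⁻¹
    0≤C : 0# ≤ C
    0≤C = *-nonneg (*-nonneg (fromℕ-nonneg (suc k)) (x≤y⇒0≤y-x 1≤v)) (<⇒≤ (⁻¹-pos 0<e))
    C*e : C * e ≈ fromℕ (suc k) * (v - 1#)
    C*e = *⁻¹-cancel _ 0<e

    f h : ℕ → Carrier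
    f a = α ^ a
    h b = v ^ b + C
    0≤f : ∀ a → 0# ≤ f a
    0≤f a = ^-nonneg a (<⇒≤ 0<α)
    0≤h : ∀ b → 0# ≤ h b
    0≤h b = +-nonneg (^-nonneg b (<⇒≤ 0<v)) 0≤C

    sum-f : ∀ a → neighbour-sum d f a ≤ A * f a
    sum-f zero    = begin
      fromℕ (suc d) * (α * 1#)   ≈⟨ solve 2 (λ m a → (con (+ 1) :+ m) :* (a :* con (+ 1)) := a :+ m :* a) ≈-refl (fromℕ d) α ⟩
      α + fromℕ d * α            ≤⟨ +-monoˡ-≤ _ (≤-trans (⁻¹≤1 1≤u) 1≤u) ⟩
      u + fromℕ d * α            ≈⟨ *-identityʳ _ ⟨
      A * 1#                     ∎
    sum-f (suc a) = ≈⇒≤ (begin-equality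
      f a + fromℕ d * (α * (α * f a))           ≈⟨ +-congʳ (≈-trans (*-congʳ uα) (*-identityˡ _)) ⟨
      u * α * f a + fromℕ d * (α * (α * f a))   ≈⟨ solve 4 (λ u m a x → u :* a :* x :+ m :* (a :* (a :* x)) := (u :+ m :* a) :* (a :* x)) ≈-refl u (fromℕ d) α (f a) ⟩
      A * (α * f a)                             ∎)

    sum-h : ∀ b → neighbour-sum k h b ≤ (fromℕ (suc k) + e) * h b
    sum-h zero    = begin
      fromℕ (suc k) * (v * 1# + C)              ≈⟨ solve 3 (λ m v c → m :* (v :* con (+ 1) :+ c) := m :* (v :- con (+ 1)) :+ m :* (con (+ 1) :+ c)) ≈-refl (fromℕ (suc k)) v C ⟩
      fromℕ (suc k) * (v - 1#) + fromℕ (suc k) * (1# + C) ≈⟨ +-congʳ C*e ⟨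
      C * e + fromℕ (suc k) * (1# + C)          ≤⟨ ≤-excess (<⇒≤ 0<e) (solve 3 (λ m e c → c :* e :+ m :* (con (+ 1) :+ c) :+ e := (m :+ e) :* (con (+ 1) :+ c)) ≈-refl (fromℕ (suc k)) e C) ⟩
      (fromℕ (suc k) + e) * (1# + C)            ∎
    sum-h (suc b) = begin
      v ^ b + C + fromℕ k * (v * (v * v ^ b) + C) ≈⟨ +-congʳ (+-congʳ (≈-trans (*-congʳ vy) (*-identityˡ _))) ⟨
      v * y * v ^ b + C + fromℕ k * (v * (v * v ^ b) + C)
        ≈⟨ solve 5 (λ v y x c m → v :* y :* x :+ c :+ m :* (v :* (v :* x) :+ c) := (y :+ m :* v) :* (v :* x) :+ (con (+ 1) :+ m) :* c) ≈-refl v y (v ^ b) C (fromℕ k) ⟩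
      B * (v * v ^ b) + fromℕ (suc k) * C ≤⟨ +-mono-≤ (*-monoʳ-≤ (^-nonneg (suc b) (<⇒≤ 0<v)) B≤)
        (*-monoʳ-≤ 0≤C (≤-excess (<⇒≤ 0<e) ≈-refl)) ⟩
      (fromℕ (suc k) + e) * (v * v ^ b) + (fromℕ (suc k) + e) * C ≈⟨ distribˡ _ _ _ ⟨
      (fromℕ (suc k) + e) * (v * v ^ b + C) ∎

    -- `α ^ a * v ^ b` is `w ^ (P b - Q a)`, which is at least `w ^ n`; Bernoulli turns this into
    -- linear growth.
    growth : ∀ {a b n} → Q ℕ.* a ℕ.+ n ℕ.≤ P ℕ.* b → fromℕ n * σ ≤ f a * h b
    growth {a} {b} {n} le = begin
      fromℕ n * σ                          ≈⟨ ≈-trans (*-congʳ cancel) (*-identityˡ _) ⟨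
      α ^ a * u ^ a * (fromℕ n * σ)        ≈⟨ *-assoc _ _ _ ⟩
      α ^ a * (u ^ a * (fromℕ n * σ))      ≤⟨ *-monoˡ-≤ (0≤f a) (begin
        u ^ a * (fromℕ n * σ)                ≤⟨ *-monoˡ-≤ (^-nonneg a (<⇒≤ 0<u)) (≤-trans (≤-excess 0≤1 (+-comm _ _)) (bernoulli n 0≤σ)) ⟩
        u ^ a * w ^ n                        ≈⟨ *-congʳ (^-assocʳ w Q a) ⟩
        w ^ (Q ℕ.* a) * w ^ n                ≈⟨ ^-homo-* w (Q ℕ.* a) n ⟨
        w ^ (Q ℕ.* a ℕ.+ n)                  ≤⟨ ^-monoʳ-≤ 1≤w le ⟩
        w ^ (P ℕ.* b)                        ≈⟨ ^-assocʳ w P b ⟨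
        v ^ b                                ≤⟨ ≤-excess 0≤C ≈-refl ⟩
        h b                                  ∎) ⟩
      f a * h b                            ∎
      where
      cancel : α ^ a * u ^ a ≈ 1#
      cancel = ≈-trans (≈-sym (^-distrib-* α u a))
        (≈-trans (^-congˡ a (≈-trans (*-comm α u) uα)) (1^n≈1 a))

    escape : EscapeWeight d k P Q
    escape = record
      { weight = λ a b → f a * h b ; rate = σ ; nonneg = λ a b → *-nonneg (0≤f a) (0≤h b)
      ; rate-pos = 0<σ ; growth = growth
      ; superharmonic = λ a b → begin
          neighbour-sum d (λ a → f a * h b) a + neighbour-sum k (λ b → f a * h b) b
            ≈⟨ +-cong (neighbour-sum-*ʳ d f (h b) a) (neighbour-sum-*ˡ k h (f a) b) ⟩
          neighbour-sum d f a * h b + f a * neighbour-sum k h b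
            ≤⟨ +-mono-≤ (*-monoʳ-≤ (0≤h b) (sum-f a)) (*-monoˡ-≤ (0≤f a) (sum-h b)) ⟩
          A * f a * h b + f a * ((fromℕ (suc k) + e) * h b)
            ≈⟨ solve 5 (λ A m e x z → A :* x :* z :+ x :* ((m :+ e) :* z) := (A :+ e :+ m) :* (x :* z)) ≈-refl A (fromℕ (suc k)) e (f a) (h b) ⟩
          (A + e + fromℕ (suc k)) * (f a * h b)
            ≈⟨ *-congʳ (+-congʳ A+e) ⟩
          (fromℕ (suc d) + fromℕ (suc k)) * (f a * h b)
            ≈⟨ *-congʳ (fromℕ-+ (suc d) (suc k)) ⟨
          fromℕ (suc d ℕ.+ suc k) * (f a * h b) ∎ }

  escape-weight : ∀ d k → 1 ℕ.≤ d → 1 ℕ.≤ k → ∀ M →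
    EscapeWeight d k (M ℕ.* (d ℕ.∸ 1)) (M ℕ.* (k ℕ.∸ 1) ℕ.+ 1)
  escape-weight (suc (suc d)) (suc k) _ _ M = Escape.escape {suc d} {k} (ℕ.s≤s ℕ.z≤n) M
  -- The hypothesis of the growth condition forces n = 0 here.
  escape-weight (suc zero) (suc k) _ _ M = record
    { weight = λ _ _ → 0# ; rate = 1# ; nonneg = λ _ _ → ≤-refl ; rate-pos = 0<1
    ; superharmonic = λ { zero zero → ≈⇒≤ (solve 3 (λ x y z → x :* con (+ 0) :+ y :* con (+ 0) := z :* con (+ 0)) ≈-refl _ _ _)
                        ; zero (suc b) → ≈⇒≤ (solve 3 (λ x y z → x :* con (+ 0) :+ (con (+ 0) :+ y :* con (+ 0)) := z :* con (+ 0)) ≈-refl _ _ _)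
                        ; (suc a) zero → ≈⇒≤ (solve 3 (λ x y z → con (+ 0) :+ x :* con (+ 0) :+ y :* con (+ 0) := z :* con (+ 0)) ≈-refl _ _ _)
                        ; (suc a) (suc b) → ≈⇒≤ (solve 3 (λ x y z → con (+ 0) :+ x :* con (+ 0) :+ (con (+ 0) :+ y :* con (+ 0)) := z :* con (+ 0)) ≈-refl _ _ _) }
    ; growth = λ {a} {b} {n} le → ≈⇒≤ (≈-trans (*-congʳ (reflexive (≡.cong fromℕ (n≡0 a b n le)))) (zeroˡ _)) }
    where
    n≡0 : ∀ a b n → (M ℕ.* k ℕ.+ 1) ℕ.* a ℕ.+ n ℕ.≤ M ℕ.* 0 ℕ.* b → n ≡ 0
    n≡0 a b n le = ℕ.n≤0⇒n≡0 (ℕ.≤-trans (ℕ.m≤n+m n _) (ℕ.≤-trans le (ℕ.≤-reflexive (≡.cong (ℕ._* b) (ℕ.*-zeroʳ M)))))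

-- Distances and balls in the product.

module ProductDistance (T-d T-k : Graph) (tree-d : IsTree T-d) (tree-k : IsTree T-k)
  (ρ : Graph.V (T-d □ T-k)) where
  open Graph (T-d □ T-k)
  module D = TreeDistance T-d tree-d (proj₁ ρ)
  module K = TreeDistance T-k tree-k (proj₂ ρ)

  height : V → ℕ
  height (u , v) = D.dist u ℕ.+ K.dist v

  height-ρ : height ρ ≡ 0
  height-ρ = ≡.cong₂ ℕ._+_ D.dist-o K.dist-o

  height-step : ∀ {y x} → y ~ x → height y ℕ.≤ suc (height x)
  height-step {y} {u , v} (inj₁ (e , ≡.refl)) = ℕ.+-monoˡ-≤ (K.dist v) (D.dist-step e)
  height-step {y} {u , v} (inj₂ (≡.refl , e)) =
    ℕ.≤-trans (ℕ.+-monoʳ-≤ (D.dist u) (K.dist-step e)) (ℕ.≤-reflexive (ℕ.+-suc _ _))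

  height-minimal : ∀ {x} (w : Walk x ρ) → height x ℕ.≤ ∣ w ∣
  height-minimal ε       = ℕ.≤-reflexive height-ρ
  height-minimal (e ◅ w) = ℕ.≤-trans (height-step e) (ℕ.s≤s (height-minimal w))

  walk : ∀ x → Walk x ρ
  walk (u , v) = gmap (_, v) (λ e → inj₁ (e , ≡.refl)) (D.path u)
              ◅◅ gmap (proj₁ ρ ,_) (λ e → inj₂ (≡.refl , e)) (K.path v)

  ∣walk∣ : ∀ x → ∣ walk x ∣ ≡ height x
  ∣walk∣ (u , v) = ≡.trans (∣◅◅∣ (gmap (_, v) (λ e → inj₁ (e , ≡.refl)) (D.path u)) _)
    (≡.cong₂ ℕ._+_ (∣gmap∣ (_, v) (λ e → inj₁ (e , ≡.refl)) (D.path u))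
                    (∣gmap∣ (proj₁ ρ ,_) (λ e → inj₂ (≡.refl , e)) (K.path v)))

  Ball⁺ : ∀ {n x} → height x ℕ.< n → Ball (T-d □ T-k) ρ n x
  Ball⁺ {x = x} lt = height x , ((walk x , ∣walk∣ x) , height-minimal) , lt

  Ball⁻ : ∀ {n x} → Ball (T-d □ T-k) ρ n x → height x ℕ.< n
  Ball⁻ (m , ((w , ∣w∣≡m) , _) , m<n) =
    ℕ.≤-<-trans (ℕ.≤-trans (height-minimal w) (ℕ.≤-reflexive ∣w∣≡m)) m<n

-- Neighbour sums of radial functions on an actual tree.

module TreeSums (em : ExcludedMiddle 0ℓ) (ℝ : CompleteOrderedField)
  (T : Graph) (isTree : IsTree T) {d : ℕ} (regular : IsRegular T (d ℕ.+ 1)) where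
  open CompleteOrderedField ℝ
    renaming (refl to ≈-refl; sym to ≈-sym; trans to ≈-trans)
  open RealPowers ℝ using (fromℕ)
  open OrderedField em ℝ
  open ListSums em ℝ
  open RadialFunctions em ℝ
  open Solver
  open ≤-Reasoning
  open Graph T
  private module From o = TreeDistance T isTree o

  length-nbrs : ∀ u → length (nbrs u) ≡ suc d
  length-nbrs u = ≡.trans (regular u) (ℕ.+-comm d 1)

  ∑-nbrs : ∀ o f u → ∑ₗ (nbrs u) (λ y → f (From.dist o y)) ≈ neighbour-sum d f (From.dist o u)
  ∑-nbrs o f u = cases (From.dist o u) ≡.refl
    where
    cases : ∀ a → From.dist o u ≡ a → ∑ₗ (nbrs u) (λ y → f (From.dist o y)) ≈ neighbour-sum d f a
    cases zero eq = begin-equality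
      ∑ₗ (nbrs u) (λ y → f (From.dist o y)) ≈⟨ ∑ₗ-cong (nbrs u) (λ {y} y∈ → reflexive (≡.cong f
        (From.neighbour-of-o o (≡.subst (y ~_) (From.dist≡0⇒≡o o eq) (∈-nbrs⁻ y∈))))) ⟩
      ∑ₗ (nbrs u) (λ _ → f 1)               ≈⟨ ∑ₗ-const (f 1) (nbrs u) ⟩
      fromℕ (length (nbrs u)) * f 1         ≡⟨ ≡.cong (λ n → fromℕ n * f 1) (length-nbrs u) ⟩
      fromℕ (suc d) * f 1                   ∎
    cases (suc a) eq =
      let p , p~u , eq′ = From.parent-exists o eq
          far = ∑ₗ-one-exception {f = λ y → f (From.dist o y)} {f (suc (suc a))} (nbrs-unique u) (∈-nbrs⁺ p~u)
            λ y∈ y≢p → reflexive (≡.cong f (≡.trans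
              (From.farther o p~u (≡.trans eq (≡.cong suc (≡.sym eq′))) (∈-nbrs⁻ y∈) y≢p) (≡.cong suc eq)))
      in begin-equality
      ∑ₗ (nbrs u) (λ y → f (From.dist o y))
        ≈⟨ solve 2 (λ s c → s := s :+ c :- c) ≈-refl _ _ ⟩
      ∑ₗ (nbrs u) (λ y → f (From.dist o y)) + f (suc (suc a)) - f (suc (suc a))
        ≈⟨ +-congʳ far ⟩
      f (From.dist o p) + fromℕ (length (nbrs u)) * f (suc (suc a)) - f (suc (suc a))
        ≡⟨ ≡.cong₂ (λ m n → f m + fromℕ n * f (suc (suc a)) - f (suc (suc a))) eq′ (length-nbrs u) ⟩
      f a + (1# + fromℕ d) * f (suc (suc a)) - f (suc (suc a))
        ≈⟨ solve 3 (λ x n c → x :+ (con (+ 1) :+ n) :* c :- c := x :+ n :* c) ≈-refl _ _ _ ⟩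
      f a + fromℕ d * f (suc (suc a)) ∎

-- Lower and upper transport estimates on the product.

module ProductToppling (em : ExcludedMiddle 0ℓ) (ℝ : CompleteOrderedField)
  {d k : ℕ} (1≤d : 1 ℕ.≤ d) (1≤k : 1 ℕ.≤ k) (T-d T-k : Graph)
  (tree-d : IsRegularTree (d ℕ.+ 1) T-d) (tree-k : IsRegularTree (k ℕ.+ 1) T-k)
  (ρ : Graph.V (T-d □ T-k)) where
  open CompleteOrderedField ℝ
    renaming (refl to ≈-refl; sym to ≈-sym; trans to ≈-trans)
  open RealPowers ℝ using (_^_; fromℕ)
  open OrderedField em ℝ
  open ListSums em ℝ
  open RadialFunctions em ℝ
  open Solver
  open ≤-Reasoning
  open Graph (T-d □ T-k)

  private
    module TD = IsRegularTree tree-d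
    module TK = IsRegularTree tree-k
    module SD = TreeSums em ℝ T-d TD.isTree TD.isRegular
    module SK = TreeSums em ℝ T-k TK.isTree TK.isRegular
    module GD = Graph T-d
    module GK = Graph T-k

  r : ℕ
  r = suc d ℕ.+ suc k

  product-regular : IsRegular (T-d □ T-k) r
  product-regular (u , v) = ≡.trans (List.length-++ (map (_, v) (GD.nbrs u)))
    (≡.cong₂ ℕ._+_ (≡.trans (List.length-map _ (GD.nbrs u)) (SD.length-nbrs u))
                    (≡.trans (List.length-map _ (GK.nbrs v)) (SK.length-nbrs v)))

  open ToppleFunctional em ℝ (T-d □ T-k) {r} (ℕ.s≤s ℕ.z≤n) product-regular
  open Toppling ℝ (T-d □ T-k)
  open ProductDistance T-d T-k TD.isTree TK.isTree ρ

  dist-d : GD.V → GD.V → ℕ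
  dist-d = TreeDistance.dist T-d TD.isTree

  dist-k : GK.V → GK.V → ℕ
  dist-k = TreeDistance.dist T-k TK.isTree

  radial : V → (ℕ → ℕ → Carrier) → V → Carrier
  radial (s , t) g (u , v) = g (dist-d s u) (dist-k t v)

  ∑-nbrs-radial : ∀ (s : V) (g : ℕ → ℕ → Carrier) (x : V) → ∑ₗ (nbrs x) (radial s g) ≈
    neighbour-sum d (λ a → g a (dist-k (proj₂ s) (proj₂ x))) (dist-d (proj₁ s) (proj₁ x)) +
    neighbour-sum k (g (dist-d (proj₁ s) (proj₁ x))) (dist-k (proj₂ s) (proj₂ x))
  ∑-nbrs-radial (s , t) g (u , v) = begin-equality
    ∑ₗ (map (_, v) (GD.nbrs u) ++ map (u ,_) (GK.nbrs v)) F
      ≈⟨ ∑ₗ-++ F (map (_, v) (GD.nbrs u)) _ ⟩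
    ∑ₗ (map (_, v) (GD.nbrs u)) F + ∑ₗ (map (u ,_) (GK.nbrs v)) F
      ≡⟨ ≡.cong₂ _+_ (∑ₗ-map (_, v) F (GD.nbrs u)) (∑ₗ-map (u ,_) F (GK.nbrs v)) ⟩
    ∑ₗ (GD.nbrs u) (λ y → F (y , v)) + ∑ₗ (GK.nbrs v) (λ y → F (u , y))
      ≈⟨ +-cong (SD.∑-nbrs s (λ a → g a (dist-k t v)) u) (SK.∑-nbrs t (g (dist-d s u)) v) ⟩
    neighbour-sum d (λ a → g a (dist-k t v)) (dist-d s u) + neighbour-sum k (g (dist-d s u)) (dist-k t v) ∎
    where
    F : V → Carrier
    F = radial (s , t) g

  radial-superharmonic : ∀ (s : V) {g : ℕ → ℕ → Carrier} → RadialSuperharmonic d k g → Superharmonic (radial s g)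
  radial-superharmonic (s , t) {g} sup (u , v) =
    ≤-trans (≈⇒≤ (∑-nbrs-radial (s , t) g (u , v))) (sup (dist-d s u) (dist-k t v))

  radial-at-centre : ∀ s (g : ℕ → ℕ → Carrier) → radial s g s ≡ g 0 0
  radial-at-centre (s , t) g = ≡.cong₂ g (TreeDistance.dist-o T-d TD.isTree s) (TreeDistance.dist-o T-k TK.isTree t)

  decay : ℕ → ℕ → Carrier
  decay a b = (fromℕ d ⁻¹) ^ a * (fromℕ k ⁻¹) ^ b

  0≤d⁻¹ : 0# ≤ fromℕ d ⁻¹
  0≤d⁻¹ = <⇒≤ (⁻¹-pos (fromℕ-pos 1≤d))

  0≤k⁻¹ : 0# ≤ fromℕ k ⁻¹
  0≤k⁻¹ = <⇒≤ (⁻¹-pos (fromℕ-pos 1≤k))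

  decay-nonneg : ∀ a b → 0# ≤ decay a b
  decay-nonneg a b = *-nonneg (^-nonneg a 0≤d⁻¹) (^-nonneg b 0≤k⁻¹)

  decay-superharmonic : RadialSuperharmonic d k decay
  decay-superharmonic = product-superharmonic (λ a → ^-nonneg a 0≤d⁻¹) (λ b → ^-nonneg b 0≤k⁻¹)
    (geometric 1≤d) (geometric 1≤k)

  decay≤ : ∀ {L} a b → 1 ℕ.≤ L → L ℕ.≤ d ℕ.^ a ℕ.* k ℕ.^ b → decay a b ≤ fromℕ L ⁻¹
  decay≤ {L} a b 1≤L L≤ = ≤-respʳ-≈ (*-identityˡ _) (x*y≤z⇒x≤z*y⁻¹ (fromℕ-pos 1≤L) (begin
    decay a b * fromℕ L                          ≤⟨ *-monoˡ-≤ (decay-nonneg a b) (fromℕ-mono-≤ L≤) ⟩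
    decay a b * fromℕ (d ℕ.^ a ℕ.* k ℕ.^ b)      ≈⟨ *-congˡ (≈-trans (fromℕ-* (d ℕ.^ a) (k ℕ.^ b)) (*-cong (fromℕ-^ d a) (fromℕ-^ k b))) ⟩
    decay a b * (fromℕ d ^ a * fromℕ k ^ b)      ≈⟨ solve 4 (λ x y z w → x :* y :* (z :* w) := z :* x :* (w :* y)) ≈-refl _ _ _ _ ⟩
    fromℕ d ^ a * (fromℕ d ⁻¹) ^ a * (fromℕ k ^ b * (fromℕ k ⁻¹) ^ b) ≈⟨ *-cong (cancel 1≤d a) (cancel 1≤k b) ⟩
    1# * 1#                                      ≈⟨ *-identityˡ 1# ⟩
    1#                                           ∎))
    where
    cancel : ∀ {c} → 1 ℕ.≤ c → ∀ n → fromℕ c ^ n * (fromℕ c ⁻¹) ^ n ≈ 1#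
    cancel {c} 1≤c n = ≈-trans (≈-sym (^-distrib-* (fromℕ c) (fromℕ c ⁻¹) n))
      (≈-trans (^-congˡ n (*-inverse (fromℕ-pos 1≤c))) (1^n≈1 n))

  -- `decay` centred at `w` is 1 at `w` and nonnegative elsewhere, so it dominates the evaluation at
  -- `w`; superharmonicity reduces the bound to its value at `ρ`.
  mass≤decay : ∀ {l μ} → Represents l μ → (∀ {F} → Superharmonic F → E l F ≤ F ρ) →
    ∀ w → mass μ w ≤ decay (D.dist (proj₁ w)) (K.dist (proj₂ w))
  mass≤decay {l} {μ} rep sup w = begin
    mass μ w                         ≈⟨ rep w ⟩
    E l (λ v → indicator v w)        ≤⟨ E-mono {l} {μ} rep (λ {v} _ → pointwise v) ⟩
    E l (radial w decay)             ≤⟨ sup (radial-superharmonic w decay-superharmonic) ⟩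
    radial w decay ρ                 ≡⟨ ≡.cong₂ decay (dist-sym T-d TD.isTree _ _) (dist-sym T-k TK.isTree _ _) ⟩
    decay (D.dist (proj₁ w)) (K.dist (proj₂ w)) ∎
    where
    pointwise : ∀ v → indicator v w ≤ radial w decay v
    pointwise v with v ≟ w
    ... | no  _      = decay-nonneg (dist-d (proj₁ w) (proj₁ v)) (dist-k (proj₂ w) (proj₂ v))
    ... | yes ≡.refl = ≈⇒≥ (≈-trans (reflexive (radial-at-centre w decay)) (*-identityˡ 1#))

  module _ {P Q : ℕ} (W : EscapeWeight d k P Q) where
    open EscapeWeight W renaming (nonneg to weight-nonneg)

    -- After `N` topplings the charge has `N (r + 1) + 1` entries. Outside the ball a vertex either
    -- carries at most `1 / L` by `mass≤decay`, or has `a` too small against `b`, where the escape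
    -- weight bounds the total mass.
    transport-lower : ∀ {p n N L} → 1 ℕ.≤ n → 1 ℕ.≤ L →
      (∀ a b → n ℕ.≤ a ℕ.+ b → ¬ (Q ℕ.* a ℕ.+ n ℕ.≤ P ℕ.* b) → L ℕ.≤ d ℕ.^ a ℕ.* k ℕ.^ b) →
      CanTransport p (Ball (T-d □ T-k) ρ n) (δ ρ) N →
      p ≤ fromℕ (N ℕ.* suc r ℕ.+ 1) * fromℕ L ⁻¹ + (fromℕ n * rate) ⁻¹ * weight 0 0
    transport-lower {p} {n} {N} {L} 1≤n 1≤L far (μ , s , ≡.refl , outside) =
      let l , rep , len , sup = represent-run {point-charge ρ} {δ ρ} {μ} (δ-represents ρ) s
          sup′ = λ {F} (h : Superharmonic F) → ≤-trans (sup {F} h) (≈⇒≤ (E-point ρ F))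
          weighted = sup′ {radial ρ weight} (radial-superharmonic ρ superharmonic)
      -- `outside` gives finite sums above each value below `p`; the claimed bound itself is used as
      -- that value.
      in ≮⇒≥ λ X<p → let vs , vs! , vs∉ , lt = outside _ X<p in
        ≤⇒≯ (≤-trans (outside-mass-bound {l} {μ} rep {F = radial ρ weight} (λ (u , v) → weight-nonneg _ _)
              (<⇒≤ (⁻¹-pos 0<nσ)) (<⇒≤ (⁻¹-pos (fromℕ-pos 1≤L)))
              (λ w w∉ → good⊎bad w (λ lt → w∉ (Ball⁺ lt)) (mass≤decay {l} {μ} rep sup′ w)) vs! vs∉)
            (+-mono-≤ (≈⇒≤ (*-congʳ (reflexive (≡.cong fromℕ len))))
              (*-monoˡ-≤ (<⇒≤ (⁻¹-pos 0<nσ)) (≤-trans weighted (≈⇒≤ (reflexive (radial-at-centre ρ weight))))))) lt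
      where
      0<nσ : 0# < fromℕ n * rate
      0<nσ = *-pos (fromℕ-pos 1≤n) rate-pos
      good⊎bad : ∀ {m} w → ¬ height w ℕ.< n → m ≤ decay (D.dist (proj₁ w)) (K.dist (proj₂ w)) →
        m ≤ fromℕ L ⁻¹ ⊎ 1# ≤ (fromℕ n * rate) ⁻¹ * radial ρ weight w
      good⊎bad (u , v) ≮n m≤ with Q ℕ.* D.dist u ℕ.+ n ℕ.≤? P ℕ.* K.dist v
      ... | no  ¬bad = inj₁ (≤-trans m≤ (decay≤ (D.dist u) (K.dist v) 1≤L (far _ _ (ℕ.≮⇒≥ ≮n) ¬bad)))
      ... | yes bad  = inj₂ (≤-trans (≈⇒≥ (≈-trans (*-comm _ _) (*-inverse 0<nσ)))
        (*-monoˡ-≤ (<⇒≤ (⁻¹-pos 0<nσ)) (growth {D.dist u} {K.dist v} {n} bad)))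

  module _ {P Q : ℕ} (W : EscapeWeight k d P Q) (2≤d : 2 ℕ.≤ d) where
    open EscapeWeight W renaming (nonneg to weight-nonneg)

    private
      sum-radial : ℕ → ℕ → Carrier
      sum-radial a b = fromℕ a + fromℕ b

    -- Off the root one neighbour is nearer and `d` are farther, a gain of `d - 1`; at the root all
    -- `d + 1` are farther, which is 2 more. `c` is the distance in the other factor.
    linear-gain : ∀ {d} → 1 ℕ.≤ d → ∀ {f c} → (∀ a → f a ≈ fromℕ a + c) → ∀ a → 0# ≤ f a →
      fromℕ (suc d) * f a + fromℕ (d ℕ.∸ 1) ≤ neighbour-sum d f a
    linear-gain {suc e} _ {f} {c} f≈ zero 0≤f = ≤-excess (+-nonneg 0≤1 0≤1) (begin-equality
      (1# + (1# + fromℕ e)) * f 0 + fromℕ e + (1# + 1#)       ≈⟨ +-congʳ (+-congʳ (*-congˡ (f≈ 0))) ⟩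
      (1# + (1# + fromℕ e)) * (0# + c) + fromℕ e + (1# + 1#)  ≈⟨ solve 2 (λ e c → let i = con (+ 1) in
        (i :+ (i :+ e)) :* (con (+ 0) :+ c) :+ e :+ (i :+ i) := (i :+ (i :+ e)) :* (i :+ con (+ 0) :+ c)) ≈-refl (fromℕ e) c ⟩
      (1# + (1# + fromℕ e)) * (1# + 0# + c)                   ≈⟨ *-congˡ (f≈ 1) ⟨
      (1# + (1# + fromℕ e)) * f 1                             ∎)
    linear-gain {suc e} _ {f} {c} f≈ (suc a) 0≤f = ≈⇒≤ (begin-equality
      (1# + (1# + fromℕ e)) * f (suc a) + fromℕ e              ≈⟨ +-congʳ (*-congˡ (f≈ (suc a))) ⟩
      (1# + (1# + fromℕ e)) * (1# + fromℕ a + c) + fromℕ e     ≈⟨ solve 3 (λ e a c → let i = con (+ 1) in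
        (i :+ (i :+ e)) :* (i :+ a :+ c) :+ e := a :+ c :+ (i :+ e) :* (i :+ (i :+ a) :+ c)) ≈-refl (fromℕ e) (fromℕ a) c ⟩
      fromℕ a + c + (1# + fromℕ e) * (1# + (1# + fromℕ a) + c) ≈⟨ +-cong (f≈ a) (*-congˡ (f≈ (suc (suc a)))) ⟨
      f a + (1# + fromℕ e) * f (suc (suc a))                   ∎)

    φ : V → Carrier
    φ = radial ρ sum-radial

    φ≈height : ∀ x → φ x ≈ fromℕ (height x)
    φ≈height (u , v) = ≈-sym (fromℕ-+ (D.dist u) (K.dist v))

    -- The first factor alone supplies the gain, as `d - 1 ≥ 1`; the second adds `k - 1 ≥ 0`.
    φ-gain : ∀ x → fromℕ r * φ x + 1# ≤ ∑ₗ (nbrs x) φ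
    φ-gain (u , v) = begin
      fromℕ r * s + 1#
        ≤⟨ +-mono-≤ (≈⇒≤ (*-congʳ (fromℕ-+ (suc d) (suc k)))) (1≤fromℕ (ℕ.∸-monoˡ-≤ 1 2≤d)) ⟩
      (fromℕ (suc d) + fromℕ (suc k)) * s + fromℕ (d ℕ.∸ 1)
        ≈⟨ solve 4 (λ m n s e → (m :+ n) :* s :+ e := m :* s :+ e :+ (n :* s :+ con (+ 0))) ≈-refl _ _ _ _ ⟩
      fromℕ (suc d) * s + fromℕ (d ℕ.∸ 1) + (fromℕ (suc k) * s + 0#)
        ≤⟨ +-monoʳ-≤ _ (+-monoʳ-≤ _ (fromℕ-nonneg (k ℕ.∸ 1))) ⟩
      fromℕ (suc d) * s + fromℕ (d ℕ.∸ 1) + (fromℕ (suc k) * s + fromℕ (k ℕ.∸ 1))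
        ≤⟨ +-mono-≤ (linear-gain 1≤d {λ a → sum-radial a (K.dist v)} (λ a → ≈-refl) (D.dist u) 0≤s)
                    (linear-gain 1≤k {sum-radial (D.dist u)} (λ b → +-comm _ _) (K.dist v) 0≤s) ⟩
      neighbour-sum d (λ a → sum-radial a (K.dist v)) (D.dist u) + neighbour-sum k (sum-radial (D.dist u)) (K.dist v)
        ≈⟨ ∑-nbrs-radial ρ sum-radial (u , v) ⟨
      ∑ₗ (nbrs (u , v)) φ ∎
      where
      s : Carrier
      s = φ (u , v)
      0≤s : 0# ≤ s
      0≤s = +-nonneg (fromℕ-nonneg (D.dist u)) (fromℕ-nonneg (K.dist v))

    module _ (n : ℕ) where
      -- The second condition cuts off large `a`, to keep the eligible vertices few. Mass on the
      -- part cut off is bounded by the escape weight with the two factors exchanged.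
      Near : ℕ → ℕ → Set
      Near a b = a ℕ.+ b ℕ.< n × ¬ (Q ℕ.* b ℕ.+ n ℕ.≤ P ℕ.* a)

      near? : ∀ a b → Dec (Near a b)
      near? a b = em

      R : V → Set
      R (u , v) = Near (D.dist u) (K.dist v)

      block : ℕ → ℕ → List V
      block a b = concatMap (λ u → map (u ,_) (K.sphere 1≤k TK.isRegular b)) (D.sphere 1≤d TD.isRegular a)

      near-blocks : ℕ → List V
      near-blocks a = concatMap (λ b → guarded (near? a b) (block a b)) (upTo n)

      near-list : List V
      near-list = concatMap near-blocks (upTo n)

      ∈-near-list⁺ : ∀ {x} → R x → x ∈ near-list
      ∈-near-list⁺ {u , v} near@(lt , _) =
        ∈-concatMap⁺ near-blocks (lose (∈-upTo⁺ (ℕ.≤-<-trans (ℕ.m≤m+n (D.dist u) (K.dist v)) lt))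
        (∈-concatMap⁺ (λ b → guarded (near? (D.dist u) b) (block (D.dist u) b))
          (lose (∈-upTo⁺ (ℕ.≤-<-trans (ℕ.m≤n+m (K.dist v) (D.dist u)) lt))
          (∈-guarded⁺ (near? (D.dist u) (K.dist v)) near
            (∈-concatMap⁺ (λ u → map (u ,_) (K.sphere 1≤k TK.isRegular (K.dist v)))
              (lose (D.∈-sphere 1≤d TD.isRegular ≡.refl)
                (∈-map⁺ (u ,_) (K.∈-sphere 1≤k TK.isRegular ≡.refl))))))))

      ∈-near-list⁻ : ∀ {x} → x ∈ near-list → R x
      ∈-near-list⁻ {x} x∈ =
        let a , _ , x∈a = find (∈-concatMap⁻ near-blocks {xs = upTo n} x∈)
            b , _ , x∈ab = find (∈-concatMap⁻ (λ b → guarded (near? a b) (block a b)) {xs = upTo n} x∈a)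
            near , x∈block = ∈-guarded⁻ (near? a b) (block a b) x∈ab
            u , u∈ , x∈map = find (∈-concatMap⁻ (λ u → map (u ,_) (K.sphere 1≤k TK.isRegular b))
              {xs = D.sphere 1≤d TD.isRegular a} x∈block)
            v , v∈ , x≡ = ∈-map⁻ (u ,_) x∈map
        in ≡.subst R (≡.sym x≡) (≡.subst₂ Near
             (≡.sym (D.sphere-dist 1≤d TD.isRegular a u∈)) (≡.sym (K.sphere-dist 1≤k TK.isRegular b v∈)) near)

      length-block : ∀ a b → length (block a b) ℕ.≤ suc d ℕ.* suc k ℕ.* (d ℕ.^ a ℕ.* k ℕ.^ b)
      length-block a b = ℕ.≤-trans
        (length-concatMap (λ u → map (u ,_) (K.sphere 1≤k TK.isRegular b)) (suc k ℕ.* k ℕ.^ b)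
          (D.sphere 1≤d TD.isRegular a) λ {u} _ → ℕ.≤-trans
            (ℕ.≤-reflexive (List.length-map (u ,_) (K.sphere 1≤k TK.isRegular b)))
            (K.length-sphere 1≤k TK.isRegular b))
        (ℕ.≤-trans (ℕ.*-monoˡ-≤ _ (D.length-sphere 1≤d TD.isRegular a))
          (ℕ.≤-reflexive (rearrange (suc d) (d ℕ.^ a) (suc k) (k ℕ.^ b))))
        where
        rearrange : ∀ w x y z → w ℕ.* x ℕ.* (y ℕ.* z) ≡ w ℕ.* y ℕ.* (x ℕ.* z)
        rearrange = solve-∀

      module _ {Y : ℕ} (≤Y : ∀ a b → Near a b → d ℕ.^ a ℕ.* k ℕ.^ b ℕ.≤ Y) where
        length-near-list : length near-list ℕ.≤ n ℕ.* (n ℕ.* (suc d ℕ.* suc k ℕ.* Y))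
        length-near-list = bound near-blocks λ a → bound (λ b → guarded (near? a b) (block a b)) λ b →
          length-guarded (near? a b) (block a b) λ near →
            ℕ.≤-trans (length-block a b) (ℕ.*-monoʳ-≤ (suc d ℕ.* suc k) (≤Y a b near))
          where
          bound : ∀ (f : ℕ → List V) {c} → (∀ a → length (f a) ℕ.≤ c) → length (concatMap f (upTo n)) ℕ.≤ n ℕ.* c
          bound f {c} le = ℕ.≤-trans (length-concatMap f c (upTo n) λ {a} _ → le a)
            (ℕ.≤-reflexive (≡.cong (ℕ._* c) (List.length-upTo n)))

        -- When the greedy process stops, mass inside the ball lies on `near-list`, at most `t` per
        -- vertex, or where `a` is too large. `small` keeps the two parts together below `1# - p`,
        -- so `p` is outside.
        transport-upper : ∀ {p t} J → 1 ℕ.≤ n → 0# < t → fromℕ r * fromℕ n < fromℕ J * t →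
          fromℕ (n ℕ.* (n ℕ.* (suc d ℕ.* suc k ℕ.* Y))) * t + (fromℕ n * rate) ⁻¹ * weight 0 0 ≤ 1# - p →
          ∃[ N ] N ℕ.≤ J × CanTransport p (Ball (T-d □ T-k) ρ n) (δ ρ) N
        transport-upper {p} {t} J 1≤n 0<t c<J small =
          let μ , s , len , l , rep , _ , sup , stuck = greedy J {0} {point-charge ρ} {δ ρ} (ℕ.+-identityʳ J)
                (δ-represents ρ) (λ { (here ≡.refl) → ρ∈B }) (E-point ρ _) initial-progress
              ws , ws! , ws∉ , 1≤ = outside-mass-large {l} {μ} rep {Ball (T-d □ T-k) ρ n} {radial ρ weight′}
                (λ (u , v) → weight-nonneg _ _) (<⇒≤ (⁻¹-pos 0<nσ)) (<⇒≤ 0<t) near-list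
                (λ x∈ → stuck _ (∈-near-list⁻ x∈)) (λ {x} _ → cases x) (total-mass l sup)
              leftover = ≤-trans (+-mono-≤ (*-monoʳ-≤ (<⇒≤ 0<t) (fromℕ-mono-≤ length-near-list))
                (*-monoˡ-≤ (<⇒≤ (⁻¹-pos 0<nσ)) (≤-trans (sup {radial ρ weight′} weight-superharmonic)
                  (≤-trans (≈⇒≤ (E-point ρ (radial ρ weight′))) (≈⇒≤ (reflexive (radial-at-centre ρ weight′))))))) small
          in ∣ s ∣ , len , μ , s , ≡.refl , λ q q<p → ws , ws! , ws∉ ,
             <-≤-trans q<p (conclude (≤-trans 1≤ (+-monoʳ-≤ _ leftover)))
          where
          weight′ : ℕ → ℕ → Carrier
          weight′ a b = weight b a
          0<nσ : 0# < fromℕ n * rate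
          0<nσ = *-pos (fromℕ-pos 1≤n) rate-pos
          weight-superharmonic : Superharmonic (radial ρ weight′)
          weight-superharmonic = radial-superharmonic ρ {weight′} (superharmonic-swap {k} {d} {weight} superharmonic)
          -- One layer more than the ball: toppling at height `n - 1` sends mass to height `n`,
          -- where it is not toppled again.
          B : V → Set
          B x = height x ℕ.≤ n
          ρ∈B : B ρ
          ρ∈B = ℕ.≤-trans (ℕ.≤-reflexive height-ρ) ℕ.z≤n
          open Greedy {R} {B} {φ} {fromℕ n} {t} J 0<t (λ x _ → φ-gain x)
            (λ near y~x → ℕ.≤-trans (height-step y~x) (proj₁ near)) (λ near → ℕ.<⇒≤ (proj₁ near))
            (λ {x} x≤n → ≤-trans (≈⇒≤ (φ≈height x)) (fromℕ-mono-≤ x≤n)) c<J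
          initial-progress : fromℕ 0 * t ≤ fromℕ r * E (point-charge ρ) φ
          initial-progress = ≤-trans (≈⇒≤ (zeroˡ t)) (*-nonneg (fromℕ-nonneg r) (≤-trans (fromℕ-nonneg (height ρ))
            (≈⇒≥ (≈-trans (E-point ρ φ) (φ≈height ρ)))))
          cases : ∀ x → ¬ Ball (T-d □ T-k) ρ n x ⊎ x ∈ near-list ⊎ 1# ≤ (fromℕ n * rate) ⁻¹ * radial ρ weight′ x
          cases (u , v) with height (u , v) ℕ.<? n | Q ℕ.* K.dist v ℕ.+ n ℕ.≤? P ℕ.* D.dist u
          ... | no ≮n  | _       = inj₁ λ ball → ≮n (Ball⁻ ball)
          ... | yes <n | no ¬bad = inj₂ (inj₁ (∈-near-list⁺ (<n , ¬bad)))
          ... | yes _  | yes bad = inj₂ (inj₂ (≤-trans (≈⇒≥ (≈-trans (*-comm _ _) (*-inverse 0<nσ)))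
            (*-monoˡ-≤ (<⇒≤ (⁻¹-pos 0<nσ)) (growth {K.dist v} {D.dist u} {n} bad))))
          -- The constant -1 is superharmonic too, so the total mass cannot drop.
          total-mass : ∀ l → (∀ {F} → Superharmonic F → E l F ≤ E (point-charge ρ) F) → 1# ≤ E l (λ _ → 1#)
          total-mass l sup = ≤-excess (x≤y⇒0≤y-x (sup {λ _ → (- 1#) * 1#} λ x → ≈⇒≤ (≈-trans
              (∑ₗ-const _ (nbrs x)) (*-congʳ (reflexive (≡.cong fromℕ (product-regular x)))))))
            (≈-trans (+-congˡ (+-cong (E-point ρ _) (-‿cong (E-*ˡ l (- 1#) _))))
              (solve 1 (λ e → let i = con (+ 1) in i :+ ((:- i) :* i :- (:- i) :* e) := e) ≈-refl _))
          conclude : ∀ {S} → 1# ≤ S + (1# - p) → p ≤ S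
          conclude {S} le = ≤-excess (x≤y⇒0≤y-x le)
            (solve 2 (λ s p → let i = con (+ 1) in p :+ (s :+ (i :- p) :- i) := s) ≈-refl S p)

-- Integer inequalities between powers.

module Exponents where
  open ℕ.≤-Reasoning

  -- `L` is the integer part of the `W`-th root of `Z`, standing in for fractional powers. The
  -- search descends from `Z`, where `Z < (Z + 1) ^ W` is clear.
  integer-root : ∀ W Z → 1 ℕ.≤ W → ∃[ L ] L ℕ.^ W ℕ.≤ Z × Z ℕ.< suc L ℕ.^ W
  integer-root W@(suc W′) Z 1≤W = search Z (ℕ.m≤m*n (suc Z) (suc Z ℕ.^ W′) {{ℕ.m^n≢0 (suc Z) W′}})
    where
    search : ∀ c → Z ℕ.< suc c ℕ.^ W → ∃[ L ] L ℕ.^ W ℕ.≤ Z × Z ℕ.< suc L ℕ.^ W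
    search zero    lt = 0 , ℕ.z≤n , lt
    search (suc c) lt with suc c ℕ.^ W ℕ.≤? Z
    ... | yes le = suc c , le , lt
    ... | no  ≰  = search c (ℕ.≰⇒> ≰)

  root-mono : ∀ {m n} W → m ℕ.^ W ℕ.< n ℕ.^ W → m ℕ.< n
  root-mono {m} {n} W lt with m ℕ.<? n
  ... | yes m<n = m<n
  ... | no  m≮n = contradiction lt (ℕ.≤⇒≯ (ℕ.^-monoˡ-≤ W (ℕ.≮⇒≥ m≮n)))

  n<2^n : ∀ n → n ℕ.< 2 ℕ.^ n
  n<2^n zero    = ℕ.s≤s ℕ.z≤n
  n<2^n (suc n) = begin-strict
    suc n                ≤⟨ n<2^n n ⟩
    2 ℕ.^ n              <⟨ ℕ.m<m+n (2 ℕ.^ n) (ℕ.≤-<-trans ℕ.z≤n (n<2^n n)) ⟩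
    2 ℕ.^ n ℕ.+ 2 ℕ.^ n  ≡⟨ ≡.cong (2 ℕ.^ n ℕ.+_) (ℕ.+-identityʳ (2 ℕ.^ n)) ⟨
    2 ℕ.^ suc n          ∎

  ^-distrib-ℕ* : ∀ m n o → (m ℕ.* n) ℕ.^ o ≡ m ℕ.^ o ℕ.* n ℕ.^ o
  ^-distrib-ℕ* m n zero    = ≡.refl
  ^-distrib-ℕ* m n (suc o) = ≡.trans (≡.cong (m ℕ.* n ℕ.*_) (^-distrib-ℕ* m n o)) (rearrange m n (m ℕ.^ o) (n ℕ.^ o))
    where
    rearrange : ∀ w x y z → w ℕ.* x ℕ.* (y ℕ.* z) ≡ w ℕ.* y ℕ.* (x ℕ.* z)
    rearrange = solve-∀

  -- Write n = q (j + 1) + s with s ≤ j, so that n ≤ (q + 1)(j + 1) and q + 1 ≤ 2 ^ q.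
  power≤exponential : ∀ j n → n ℕ.^ suc j ℕ.≤ suc j ℕ.^ suc j ℕ.* 2 ℕ.^ n
  power≤exponential j n = begin
    n ℕ.^ suc j                                    ≤⟨ ℕ.^-monoˡ-≤ (suc j) n≤ ⟩
    (suc j ℕ.* 2 ℕ.^ q) ℕ.^ suc j                  ≡⟨ ^-distrib-ℕ* (suc j) (2 ℕ.^ q) (suc j) ⟩
    suc j ℕ.^ suc j ℕ.* (2 ℕ.^ q) ℕ.^ suc j        ≡⟨ ≡.cong (suc j ℕ.^ suc j ℕ.*_) (ℕ.^-*-assoc 2 q (suc j)) ⟩
    suc j ℕ.^ suc j ℕ.* 2 ℕ.^ (q ℕ.* suc j)        ≤⟨ ℕ.*-monoʳ-≤ (suc j ℕ.^ suc j) (ℕ.^-monoʳ-≤ 2 (ℕ.m/n*n≤m n (suc j))) ⟩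
    suc j ℕ.^ suc j ℕ.* 2 ℕ.^ n                    ∎
    where
    q : ℕ
    q = n ℕ./ suc j
    n≤ : n ℕ.≤ suc j ℕ.* 2 ℕ.^ q
    n≤ = begin
      n                                  ≡⟨ ℕ.m≡m%n+[m/n]*n n (suc j) ⟩
      n ℕ.% suc j ℕ.+ q ℕ.* suc j        ≤⟨ ℕ.+-monoˡ-≤ (q ℕ.* suc j) (ℕ.<⇒≤ (ℕ.m%n<n n (suc j))) ⟩
      suc q ℕ.* suc j                    ≤⟨ ℕ.*-monoˡ-≤ (suc j) (n<2^n q) ⟩
      2 ℕ.^ q ℕ.* suc j                  ≡⟨ ℕ.*-comm (2 ℕ.^ q) (suc j) ⟩
      suc j ℕ.* 2 ℕ.^ q                  ∎

  -- The estimate for exponent `j + 1` has a factor `n` to spare, which beats every constant once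
  -- `n ≥ n₀`.
  eventually-exponential : ∀ c j → ∃[ n₀ ] (∀ n → n₀ ℕ.≤ n → c ℕ.* n ℕ.^ j ℕ.≤ 2 ℕ.^ n)
  eventually-exponential c j = n₀ , λ n n₀≤n → ℕ.*-cancelˡ-≤ n₀ {{ℕ.m*n≢0 (suc c) (suc j ℕ.^ suc j) {{_}} {{ℕ.m^n≢0 (suc j) (suc j)}}}} (begin
    n₀ ℕ.* (c ℕ.* n ℕ.^ j)                 ≤⟨ ℕ.*-mono-≤ n₀≤n (ℕ.*-monoˡ-≤ (n ℕ.^ j) (ℕ.n≤1+n c)) ⟩
    n ℕ.* (suc c ℕ.* n ℕ.^ j)              ≡⟨ rearrange n (suc c) (n ℕ.^ j) ⟩
    suc c ℕ.* n ℕ.^ suc j                  ≤⟨ ℕ.*-monoʳ-≤ (suc c) (power≤exponential j n) ⟩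
    suc c ℕ.* (suc j ℕ.^ suc j ℕ.* 2 ℕ.^ n) ≡⟨ ℕ.*-assoc (suc c) (suc j ℕ.^ suc j) (2 ℕ.^ n) ⟨
    n₀ ℕ.* 2 ℕ.^ n                         ∎)
    where
    n₀ : ℕ
    n₀ = suc c ℕ.* suc j ℕ.^ suc j
    rearrange : ∀ x y z → x ℕ.* (y ℕ.* z) ≡ y ℕ.* (x ℕ.* z)
    rearrange = solve-∀

  module Growth {e f : ℕ} (1≤e : 1 ℕ.≤ e) (f≤e : f ℕ.≤ e) where
    d k D X : ℕ
    d = suc e
    k = suc f
    D = e ℕ.+ f
    X = d ℕ.^ e ℕ.* k ℕ.^ f

    2≤X : 2 ℕ.≤ X
    2≤X = begin
      2                       ≤⟨ ℕ.s≤s 1≤e ⟩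
      d                       ≡⟨ ℕ.^-identityʳ d ⟨
      d ℕ.^ 1                 ≤⟨ ℕ.^-monoʳ-≤ d 1≤e ⟩
      d ℕ.^ e                 ≤⟨ ℕ.m≤m*n (d ℕ.^ e) (k ℕ.^ f) {{ℕ.m^n≢0 k f}} ⟩
      X                       ∎

    1≤X^ : ∀ j → 1 ℕ.≤ X ℕ.^ j
    1≤X^ j = ℕ.m^n>0 X {{ℕ.>-nonZero (ℕ.≤-trans (ℕ.s≤s ℕ.z≤n) 2≤X)}} j

    -- Replacing a factor `k` by `d` never decreases the product, so a bound on one exponent and one
    -- on their sum suffice. This is where `k ≤ d` enters.
    exchange : ∀ {A B a b} → A ℕ.≤ a → A ℕ.+ B ℕ.≤ a ℕ.+ b → d ℕ.^ A ℕ.* k ℕ.^ B ℕ.≤ d ℕ.^ a ℕ.* k ℕ.^ b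
    exchange {A} {B} {a} {b} A≤a le with ℕ.m≤n⇒∃[o]m+o≡n A≤a
    ... | x , ≡.refl = begin
      d ℕ.^ A ℕ.* k ℕ.^ B                 ≤⟨ ℕ.*-monoʳ-≤ (d ℕ.^ A) (ℕ.^-monoʳ-≤ k B≤x+b) ⟩
      d ℕ.^ A ℕ.* k ℕ.^ (x ℕ.+ b)         ≡⟨ ≡.cong (d ℕ.^ A ℕ.*_) (ℕ.^-distribˡ-+-* k x b) ⟩
      d ℕ.^ A ℕ.* (k ℕ.^ x ℕ.* k ℕ.^ b)   ≤⟨ ℕ.*-monoʳ-≤ (d ℕ.^ A) (ℕ.*-monoˡ-≤ (k ℕ.^ b) (ℕ.^-monoˡ-≤ x (ℕ.s≤s f≤e))) ⟩
      d ℕ.^ A ℕ.* (d ℕ.^ x ℕ.* k ℕ.^ b)   ≡⟨ ℕ.*-assoc (d ℕ.^ A) (d ℕ.^ x) (k ℕ.^ b) ⟨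
      d ℕ.^ A ℕ.* d ℕ.^ x ℕ.* k ℕ.^ b     ≡⟨ ≡.cong (ℕ._* k ℕ.^ b) (ℕ.^-distribˡ-+-* d A x) ⟨
      d ℕ.^ (A ℕ.+ x) ℕ.* k ℕ.^ b         ∎
      where
      B≤x+b : B ℕ.≤ x ℕ.+ b
      B≤x+b = ℕ.+-cancelˡ-≤ A B (x ℕ.+ b) (ℕ.≤-trans le (ℕ.≤-reflexive (ℕ.+-assoc A x b)))

    product-^ : ∀ a b j → (d ℕ.^ a ℕ.* k ℕ.^ b) ℕ.^ j ≡ d ℕ.^ (a ℕ.* j) ℕ.* k ℕ.^ (b ℕ.* j)
    product-^ a b j = ≡.trans (^-distrib-ℕ* (d ℕ.^ a) (k ℕ.^ b) j)
      (≡.cong₂ ℕ._*_ (ℕ.^-*-assoc d a j) (ℕ.^-*-assoc k b j))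

    n≤e*n : ∀ n → n ℕ.≤ e ℕ.* n
    n≤e*n n = ℕ.m≤n*m n e {{ℕ.>-nonZero 1≤e}}

    -- At the ideal point `a = e n / D`, `b = f n / D` the `D`-th power of `dᵃ kᵇ` is `X ^ n`. The
    -- failed inequality yields `e m n ≤ a W`, so with `W / m` slightly above `D` the point is no
    -- worse, and `exchange` does the rest.
    far-growth : ∀ m {n a b} → n ℕ.≤ a ℕ.+ b → ¬ ((suc m ℕ.* f ℕ.+ 1) ℕ.* a ℕ.+ n ℕ.≤ suc m ℕ.* e ℕ.* b) →
      X ℕ.^ (m ℕ.* n) ℕ.≤ (d ℕ.^ a ℕ.* k ℕ.^ b) ℕ.^ (suc m ℕ.* D ℕ.+ 1)
    far-growth m {n} {a} {b} n≤ ≰ = begin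
      X ℕ.^ (m ℕ.* n)                                       ≡⟨ product-^ e f (m ℕ.* n) ⟩
      d ℕ.^ (e ℕ.* (m ℕ.* n)) ℕ.* k ℕ.^ (f ℕ.* (m ℕ.* n))   ≤⟨ exchange first total ⟩
      d ℕ.^ (a ℕ.* W) ℕ.* k ℕ.^ (b ℕ.* W)                   ≡⟨ product-^ a b W ⟨
      (d ℕ.^ a ℕ.* k ℕ.^ b) ℕ.^ W                           ∎
      where
      W : ℕ
      W = suc m ℕ.* D ℕ.+ 1
      first : e ℕ.* (m ℕ.* n) ℕ.≤ a ℕ.* W
      first = ℕ.+-cancelʳ-≤ n _ _ (begin
        -- Passing from `suc m` to `m` frees `e * n ≥ n`, which pays for the offset `n` in the
        -- hypothesis.
        e ℕ.* (m ℕ.* n) ℕ.+ n                  ≤⟨ ℕ.+-monoʳ-≤ _ (n≤e*n n) ⟩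
        e ℕ.* (m ℕ.* n) ℕ.+ e ℕ.* n            ≡⟨ identity₁ e m n ⟩
        suc m ℕ.* e ℕ.* n                      ≤⟨ ℕ.*-monoʳ-≤ (suc m ℕ.* e) n≤ ⟩
        suc m ℕ.* e ℕ.* (a ℕ.+ b)              ≡⟨ ℕ.*-distribˡ-+ (suc m ℕ.* e) a b ⟩
        suc m ℕ.* e ℕ.* a ℕ.+ suc m ℕ.* e ℕ.* b ≤⟨ ℕ.+-monoʳ-≤ (suc m ℕ.* e ℕ.* a) (ℕ.<⇒≤ (ℕ.≰⇒> ≰)) ⟩
        suc m ℕ.* e ℕ.* a ℕ.+ ((suc m ℕ.* f ℕ.+ 1) ℕ.* a ℕ.+ n) ≡⟨ identity₂ e f m n a ⟩
        a ℕ.* W ℕ.+ n                          ∎)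
        where
        identity₁ : ∀ e m n → e ℕ.* (m ℕ.* n) ℕ.+ e ℕ.* n ≡ suc m ℕ.* e ℕ.* n
        identity₁ = solve-∀
        identity₂ : ∀ e f m n a → suc m ℕ.* e ℕ.* a ℕ.+ ((suc m ℕ.* f ℕ.+ 1) ℕ.* a ℕ.+ n)
          ≡ a ℕ.* (suc m ℕ.* (e ℕ.+ f) ℕ.+ 1) ℕ.+ n
        identity₂ = solve-∀
      total : e ℕ.* (m ℕ.* n) ℕ.+ f ℕ.* (m ℕ.* n) ℕ.≤ a ℕ.* W ℕ.+ b ℕ.* W
      total = begin
        e ℕ.* (m ℕ.* n) ℕ.+ f ℕ.* (m ℕ.* n)   ≡⟨ identity e f m n ⟩
        n ℕ.* (m ℕ.* D)                       ≤⟨ ℕ.*-mono-≤ n≤ (ℕ.≤-trans (ℕ.m≤n+m (m ℕ.* D) D) (ℕ.m≤m+n (suc m ℕ.* D) 1)) ⟩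
        (a ℕ.+ b) ℕ.* W                       ≡⟨ ℕ.*-distribʳ-+ W a b ⟩
        a ℕ.* W ℕ.+ b ℕ.* W                   ∎
        where
        identity : ∀ e f m n → e ℕ.* (m ℕ.* n) ℕ.+ f ℕ.* (m ℕ.* n) ≡ n ℕ.* (m ℕ.* (e ℕ.+ f))
        identity = solve-∀

    -- The mirror image of `far-growth`, with `a` bounded above. The offset `n` and the `+ 1` in the
    -- ratio cost `n` each, whence the `2` in `M + 2`.
    near-growth : ∀ M {n a b} → a ℕ.+ b ℕ.< n → ¬ ((M ℕ.* e ℕ.+ 1) ℕ.* b ℕ.+ n ℕ.≤ M ℕ.* f ℕ.* a) →
      (d ℕ.^ a ℕ.* k ℕ.^ b) ℕ.^ (M ℕ.* D ℕ.+ 1) ℕ.≤ X ℕ.^ ((M ℕ.+ 2) ℕ.* n)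
    near-growth M {n} {a} {b} lt ≰ = begin
      (d ℕ.^ a ℕ.* k ℕ.^ b) ℕ.^ W                           ≡⟨ product-^ a b W ⟩
      d ℕ.^ (a ℕ.* W) ℕ.* k ℕ.^ (b ℕ.* W)                   ≤⟨ exchange first total ⟩
      d ℕ.^ (e ℕ.* S) ℕ.* k ℕ.^ (f ℕ.* S)                   ≡⟨ product-^ e f S ⟨
      X ℕ.^ S                                               ∎
      where
      W S : ℕ
      W = M ℕ.* D ℕ.+ 1
      S = (M ℕ.+ 2) ℕ.* n
      first : a ℕ.* W ℕ.≤ e ℕ.* S
      first = begin
        a ℕ.* W                                              ≡⟨ identity₁ e f M a ⟩
        (M ℕ.* e ℕ.+ 1) ℕ.* a ℕ.+ M ℕ.* f ℕ.* a              ≤⟨ ℕ.+-monoʳ-≤ _ (ℕ.<⇒≤ (ℕ.≰⇒> ≰)) ⟩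
        (M ℕ.* e ℕ.+ 1) ℕ.* a ℕ.+ ((M ℕ.* e ℕ.+ 1) ℕ.* b ℕ.+ n) ≡⟨ identity₂ (M ℕ.* e ℕ.+ 1) a b n ⟩
        (M ℕ.* e ℕ.+ 1) ℕ.* (a ℕ.+ b) ℕ.+ n                  ≤⟨ ℕ.+-monoˡ-≤ n (ℕ.*-monoʳ-≤ (M ℕ.* e ℕ.+ 1) (ℕ.<⇒≤ lt)) ⟩
        (M ℕ.* e ℕ.+ 1) ℕ.* n ℕ.+ n                          ≡⟨ identity₃ M e n ⟩
        M ℕ.* e ℕ.* n ℕ.+ 2 ℕ.* n                            ≤⟨ ℕ.+-monoʳ-≤ (M ℕ.* e ℕ.* n) (ℕ.*-monoʳ-≤ 2 (n≤e*n n)) ⟩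
        M ℕ.* e ℕ.* n ℕ.+ 2 ℕ.* (e ℕ.* n)                    ≡⟨ identity₄ M e n ⟩
        e ℕ.* S                                              ∎
        where
        identity₁ : ∀ e f M a → a ℕ.* (M ℕ.* (e ℕ.+ f) ℕ.+ 1) ≡ (M ℕ.* e ℕ.+ 1) ℕ.* a ℕ.+ M ℕ.* f ℕ.* a
        identity₁ = solve-∀
        identity₂ : ∀ q a b n → q ℕ.* a ℕ.+ (q ℕ.* b ℕ.+ n) ≡ q ℕ.* (a ℕ.+ b) ℕ.+ n
        identity₂ = solve-∀
        identity₃ : ∀ M e n → (M ℕ.* e ℕ.+ 1) ℕ.* n ℕ.+ n ≡ M ℕ.* e ℕ.* n ℕ.+ 2 ℕ.* n
        identity₃ = solve-∀
        identity₄ : ∀ M e n → M ℕ.* e ℕ.* n ℕ.+ 2 ℕ.* (e ℕ.* n) ≡ e ℕ.* ((M ℕ.+ 2) ℕ.* n)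
        identity₄ = solve-∀
      total : a ℕ.* W ℕ.+ b ℕ.* W ℕ.≤ e ℕ.* S ℕ.+ f ℕ.* S
      total = begin
        a ℕ.* W ℕ.+ b ℕ.* W               ≡⟨ ℕ.*-distribʳ-+ W a b ⟨
        (a ℕ.+ b) ℕ.* W                   ≤⟨ ℕ.*-monoˡ-≤ W (ℕ.<⇒≤ lt) ⟩
        n ℕ.* (M ℕ.* D ℕ.+ 1)             ≤⟨ ℕ.*-monoʳ-≤ n (ℕ.+-monoʳ-≤ (M ℕ.* D) (ℕ.≤-trans 1≤e (ℕ.≤-trans (ℕ.m≤m+n e f) (ℕ.m≤n*m D 2)))) ⟩
        n ℕ.* (M ℕ.* D ℕ.+ 2 ℕ.* D)       ≡⟨ identity n M e f ⟩
        e ℕ.* S ℕ.+ f ℕ.* S               ∎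
        where
        identity : ∀ n M e f → n ℕ.* (M ℕ.* (e ℕ.+ f) ℕ.+ 2 ℕ.* (e ℕ.+ f)) ≡ e ℕ.* ((M ℕ.+ 2) ℕ.* n) ℕ.+ f ℕ.* ((M ℕ.+ 2) ℕ.* n)
        identity = solve-∀

-- Two-sided bounds, uniform in the trees.

module ToppleNumberBounds (em : ExcludedMiddle 0ℓ) (ℝ : CompleteOrderedField)
  {e f : ℕ} (1≤e : 1 ℕ.≤ e) (f≤e : f ℕ.≤ e) where
  open CompleteOrderedField ℝ
    renaming (refl to ≈-refl; sym to ≈-sym; trans to ≈-trans)
  open RealPowers ℝ using (fromℕ)
  open OrderedField em ℝ
  open RadialFunctions em ℝ
  open Solver
  open Exponents
  open Growth 1≤e f≤e

  r : ℕ
  r = suc d ℕ.+ suc k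

  1≤D : 1 ℕ.≤ D
  1≤D = ℕ.≤-trans 1≤e (ℕ.m≤m+n e f)

  2^≤X^ : ∀ n → 2 ℕ.^ n ℕ.≤ X ℕ.^ n
  2^≤X^ n = ℕ.^-monoˡ-≤ n 2≤X

  split-half : ∀ {x} → 0# < x → ∃[ h ] 0# < h × h + h ≈ x
  split-half {x} 0<x = x * two⁻¹ , *-pos 0<x (⁻¹-pos 0<2) ,
    ≈-trans (solve 2 (λ x t → x :* t :+ x :* t := x :* t :* (con (+ 1) :+ con (+ 1))) ≈-refl x two⁻¹) (*⁻¹-cancel x 0<2)
    where
    0<2 : 0# < 1# + 1#
    0<2 = <-≤-trans 0<1 (≤-excess 0≤1 ≈-refl)
    two⁻¹ : Carrier
    two⁻¹ = (1# + 1#) ⁻¹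

  reciprocal-bound : ∀ {h} → 0# < h → ∃[ H ] 1 ℕ.≤ H × 1# ≤ fromℕ H * h
  reciprocal-bound {h} 0<h = let H , lt = archimedean (h ⁻¹) in
    suc H , ℕ.s≤s ℕ.z≤n , ≤-respˡ-≈ (≈-trans (*-comm _ _) (*-inverse 0<h))
      (*-monoʳ-≤ (<⇒≤ 0<h) (≤-trans (<⇒≤ lt) (fromℕ-mono-≤ (ℕ.n≤1+n H))))

  eventually-small : ∀ {σ h} → 0# < σ → 0# < h → ∀ w →
    ∃[ n₀ ] (∀ n → n₀ ℕ.≤ n → 1 ℕ.≤ n → (fromℕ n * σ) ⁻¹ * w ≤ h)
  eventually-small {σ} {h} 0<σ 0<h w = let n₀ , lt = archimedean (w * (σ * h) ⁻¹) in
    n₀ , λ n n₀≤n 1≤n → ≤-respˡ-≈ (*-comm _ _) (x≤y*z⇒x*y⁻¹≤z (*-pos (fromℕ-pos 1≤n) 0<σ) (begin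
      w                       ≤⟨ x*y⁻¹≤z⇒x≤z*y (*-pos 0<σ 0<h) (≤-trans (<⇒≤ lt) (fromℕ-mono-≤ n₀≤n)) ⟩
      fromℕ n * (σ * h)       ≈⟨ solve 3 (λ n s h → n :* (s :* h) := h :* (n :* s)) ≈-refl _ _ _ ⟩
      h * (fromℕ n * σ)       ∎))
    where open ≤-Reasoning

  module _ {p : Carrier} (0<p : 0# < p) (p<1 : p < 1#) where

    Transports : ℕ → (T-d T-k : Graph) → Graph.V (T-d □ T-k) → ℕ → Set
    Transports n T-d T-k ρ = Toppling.CanTransport ℝ (T-d □ T-k) p (Ball (T-d □ T-k) ρ n) (Toppling.δ ℝ (T-d □ T-k) ρ)

    ForAllTrees : (∀ T-d T-k → Graph.V (T-d □ T-k) → Set) → Set₁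
    ForAllTrees P = ∀ T-d T-k → IsRegularTree (d ℕ.+ 1) T-d → IsRegularTree (k ℕ.+ 1) T-k → ∀ ρ → P T-d T-k ρ

    -- In logarithms: `log N / n` is at least `E / (3 + E)` times `log θ`. Half of `p` is conceded
    -- to the vertices with a bad ratio; the other half `h`, with `H ≥ 1 / h`, forces
    -- `L ≤ H (N (r + 1) + 1)`.
    lower-bound : ∀ E → ∃[ n₀ ] (∀ n → n₀ ℕ.≤ n → ForAllTrees λ T-d T-k ρ →
      ∀ N → Transports n T-d T-k ρ N → 1 ℕ.≤ N × X ℕ.^ (E ℕ.* n) ℕ.≤ N ℕ.^ ((3 ℕ.+ E) ℕ.* D))
    lower-bound E =
      let h , 0<h , h+h = split-half 0<p
          H , _ , 1≤Hh = reciprocal-bound 0<h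
          n₁ , small = eventually-small (EscapeWeight.rate-pos weights) 0<h (EscapeWeight.weight weights 0 0)
          n₂ , expo = eventually-exponential ((H ℕ.* (suc r ℕ.+ 1) ℕ.+ 1) ℕ.^ W) 0
      -- The threshold is fixed before any tree is given: the weight and the constants depend only
      -- on `d`, `k`, `p` and `E`.
      in 1 ℕ.+ (n₁ ℕ.+ n₂) , λ n n₀≤n T-d T-k tree-d tree-k ρ N can →
        -- The largest `L` that `far-growth` can place below `dᵃ kᵇ`.
        let L , L^W≤ , <L^W = integer-root W (X ℕ.^ (m ℕ.* n)) 1≤W
            1≤n = ℕ.≤-trans (ℕ.m≤m+n 1 (n₁ ℕ.+ n₂)) n₀≤n
            n₁+n₂≤n = ℕ.≤-trans (ℕ.m≤n+m (n₁ ℕ.+ n₂) 1) n₀≤n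
            1≤L = ℕ.s≤s⁻¹ (root-mono {1} {suc L} W (ℕ.≤-<-trans
              (ℕ.≤-trans (ℕ.≤-reflexive (ℕ.^-zeroˡ W)) (1≤X^ (m ℕ.* n))) <L^W))
            open ProductToppling em ℝ {d} {k} (ℕ.s≤s ℕ.z≤n) (ℕ.s≤s ℕ.z≤n) T-d T-k tree-d tree-k ρ using (transport-lower)
            p≤ = transport-lower weights {p} {n} {N} {L} 1≤n 1≤L
              (λ a b n≤ ≰ → ℕ.s≤s⁻¹ (root-mono {L} {suc (d ℕ.^ a ℕ.* k ℕ.^ b)} W (ℕ.≤-<-trans (ℕ.≤-trans L^W≤ (far-growth m {n} {a} {b} n≤ ≰))
                (ℕ.^-monoˡ-< W {{ℕ.>-nonZero 1≤W}} (ℕ.n<1+n _))))) can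
        in conclude n N H L (ℕ.≤-trans (ℕ.≤-reflexive (≡.sym (ℕ.*-identityʳ _))) (expo n (ℕ.≤-trans (ℕ.m≤n+m n₂ n₁) n₁+n₂≤n)))
             <L^W (count-bound N H L 1≤L 0<h 1≤Hh (+-cancelˡ-≤ h (≤-trans (≈⇒≤ h+h) (≤-trans p≤
               (≤-trans (+-monoʳ-≤ _ (small n (ℕ.≤-trans (ℕ.m≤m+n n₁ n₂) n₁+n₂≤n) 1≤n)) (≈⇒≤ (+-comm _ _)))))))
      where
      m W : ℕ
      -- One above `E`: the additional `X ^ n` absorbs the constant factor `K ^ W`.
      m = suc E
      W = suc m ℕ.* D ℕ.+ 1
      1≤W : 1 ℕ.≤ W
      1≤W = ℕ.m≤n+m 1 (suc m ℕ.* D)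
      weights : EscapeWeight d k (suc m ℕ.* e) (suc m ℕ.* f ℕ.+ 1)
      weights = escape-weight d k (ℕ.s≤s ℕ.z≤n) (ℕ.s≤s ℕ.z≤n) (suc m)

      count-bound : ∀ N H L {h} → 1 ℕ.≤ L → 0# < h → 1# ≤ fromℕ H * h → h ≤ fromℕ (N ℕ.* suc r ℕ.+ 1) * fromℕ L ⁻¹ →
        L ℕ.≤ H ℕ.* (N ℕ.* suc r ℕ.+ 1)
      count-bound N H L {h} 1≤L 0<h 1≤Hh h≤ = fromℕ-cancel-≤ {L} {H ℕ.* (N ℕ.* suc r ℕ.+ 1)} (begin
        fromℕ L                              ≈⟨ *-identityˡ _ ⟨
        1# * fromℕ L                         ≤⟨ *-monoʳ-≤ (fromℕ-nonneg L) 1≤Hh ⟩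
        fromℕ H * h * fromℕ L                ≈⟨ *-assoc _ _ _ ⟩
        fromℕ H * (h * fromℕ L)              ≤⟨ *-monoˡ-≤ (fromℕ-nonneg H) (x≤z*y⁻¹⇒x*y≤z (fromℕ-pos 1≤L) h≤) ⟩
        fromℕ H * fromℕ (N ℕ.* suc r ℕ.+ 1)  ≈⟨ fromℕ-* H _ ⟨
        fromℕ (H ℕ.* (N ℕ.* suc r ℕ.+ 1))    ∎)
        where open ≤-Reasoning

      conclude : ∀ n N H L → (H ℕ.* (suc r ℕ.+ 1) ℕ.+ 1) ℕ.^ W ℕ.≤ 2 ℕ.^ n → X ℕ.^ (m ℕ.* n) ℕ.< suc L ℕ.^ W →
        L ℕ.≤ H ℕ.* (N ℕ.* suc r ℕ.+ 1) → 1 ℕ.≤ N × X ℕ.^ (E ℕ.* n) ℕ.≤ N ℕ.^ ((3 ℕ.+ E) ℕ.* D)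
      -- Without topplings `L` would stay bounded, which fails for large `n`. `1 ≤ N` is what later
      -- allows a logarithm of `N`.
      conclude n zero H L K^W≤ <L^W L≤ = contradiction (begin-strict
        X ℕ.^ n                  ≤⟨ ℕ.^-monoʳ-≤ X {{ℕ.>-nonZero (ℕ.≤-trans (ℕ.s≤s ℕ.z≤n) 2≤X)}} (ℕ.m≤n*m n m) ⟩
        X ℕ.^ (m ℕ.* n)          <⟨ <L^W ⟩
        suc L ℕ.^ W              ≤⟨ ℕ.^-monoˡ-≤ W L<K ⟩
        K ℕ.^ W                  ≤⟨ K^W≤ ⟩
        2 ℕ.^ n                  ≤⟨ 2^≤X^ n ⟩
        X ℕ.^ n                  ∎) (ℕ.<-irrefl ≡.refl)
        where
        open ℕ.≤-Reasoning
        K : ℕ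
        K = H ℕ.* (suc r ℕ.+ 1) ℕ.+ 1
        L<K : suc L ℕ.≤ K
        L<K = begin
          suc L                      ≡⟨ ℕ.+-comm 1 L ⟩
          L ℕ.+ 1                    ≤⟨ ℕ.+-monoˡ-≤ 1 L≤ ⟩
          H ℕ.* 1 ℕ.+ 1              ≤⟨ ℕ.+-monoˡ-≤ 1 (ℕ.*-monoʳ-≤ H (ℕ.m≤n+m 1 (suc r))) ⟩
          K                          ∎
      conclude n N@(suc N′) H L K^W≤ <L^W L≤ = ℕ.s≤s ℕ.z≤n , ℕ.≤-trans
        (ℕ.*-cancelˡ-≤ (X ℕ.^ n) {{ℕ.>-nonZero (1≤X^ n)}} (begin
          X ℕ.^ n ℕ.* X ℕ.^ (E ℕ.* n)   ≡⟨ ℕ.^-distribˡ-+-* X n (E ℕ.* n) ⟨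
          X ℕ.^ (m ℕ.* n)               ≤⟨ ℕ.<⇒≤ <L^W ⟩
          suc L ℕ.^ W                   ≤⟨ ℕ.^-monoˡ-≤ W L<KN ⟩
          (K ℕ.* N) ℕ.^ W               ≡⟨ ^-distrib-ℕ* K N W ⟩
          K ℕ.^ W ℕ.* N ℕ.^ W           ≤⟨ ℕ.*-monoˡ-≤ (N ℕ.^ W) (ℕ.≤-trans K^W≤ (2^≤X^ n)) ⟩
          X ℕ.^ n ℕ.* N ℕ.^ W           ∎))
        (ℕ.^-monoʳ-≤ N W≤)
        where
        open ℕ.≤-Reasoning
        K : ℕ
        K = H ℕ.* (suc r ℕ.+ 1) ℕ.+ 1
        L<KN : suc L ℕ.≤ K ℕ.* N
        L<KN = begin
          suc L                                      ≡⟨ ℕ.+-comm 1 L ⟩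
          L ℕ.+ 1                                    ≤⟨ ℕ.+-mono-≤ L≤ (ℕ.s≤s (ℕ.z≤n {N′})) ⟩
          H ℕ.* (N ℕ.* suc r ℕ.+ 1) ℕ.+ N            ≤⟨ ℕ.+-monoˡ-≤ N (ℕ.*-monoʳ-≤ H (ℕ.+-monoʳ-≤ (N ℕ.* suc r) (ℕ.s≤s (ℕ.z≤n {N′})))) ⟩
          H ℕ.* (N ℕ.* suc r ℕ.+ N) ℕ.+ N            ≡⟨ identity H N (suc r) ⟩
          K ℕ.* N                                    ∎
          where
          identity : ∀ H N s → H ℕ.* (N ℕ.* s ℕ.+ N) ℕ.+ N ≡ (H ℕ.* (s ℕ.+ 1) ℕ.+ 1) ℕ.* N
          identity = solve-∀
        W≤ : W ℕ.≤ (3 ℕ.+ E) ℕ.* D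
        W≤ = ℕ.≤-trans (ℕ.+-monoʳ-≤ (suc m ℕ.* D) 1≤D) (ℕ.≤-reflexive (ℕ.+-comm (suc m ℕ.* D) D))

    -- `Y` bounds `dᵃ kᵇ` at the eligible vertices and `Z` their number. The threshold `1 / (H Z)`
    -- keeps their total mass at most `h = (1 - p) / 2`, and `J = r n H Z + 1` is just enough for
    -- the greedy process.
    upper-bound : ∀ E → ∃[ n₀ ] (∀ n → n₀ ℕ.≤ n → ForAllTrees λ T-d T-k ρ →
      ∃[ J ] (∃[ N ] N ℕ.≤ J × Transports n T-d T-k ρ N) × J ℕ.^ (E ℕ.* D) ℕ.≤ X ℕ.^ ((3 ℕ.+ E) ℕ.* n))
    upper-bound E =
      let h , 0<h , h+h = split-half (0<y-x p<1)
          H , 1≤H , 1≤Hh = reciprocal-bound 0<h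
          n₁ , small = eventually-small (EscapeWeight.rate-pos weights) 0<h (EscapeWeight.weight weights 0 0)
          -- `J` is of order `n ^ 3 * Y`: two factors `n` from the pairs `(a , b)`, one from the
          -- bound on the height.
          n₂ , expo = eventually-exponential ((r ℕ.* H ℕ.* c₀ ℕ.+ 1) ℕ.^ W) (3 ℕ.* W)
      in 1 ℕ.+ (n₁ ℕ.+ n₂) , λ n n₀≤n T-d T-k tree-d tree-k ρ →
        let Y , Y^W≤ , <Y^W = integer-root W (X ℕ.^ ((E ℕ.+ 2) ℕ.* n)) 1≤W
            1≤n = ℕ.≤-trans (ℕ.m≤m+n 1 (n₁ ℕ.+ n₂)) n₀≤n
            n₁+n₂≤n = ℕ.≤-trans (ℕ.m≤n+m (n₁ ℕ.+ n₂) 1) n₀≤n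
            1≤Y = ℕ.s≤s⁻¹ (root-mono {1} {suc Y} W (ℕ.≤-<-trans
              (ℕ.≤-trans (ℕ.≤-reflexive (ℕ.^-zeroˡ W)) (1≤X^ ((E ℕ.+ 2) ℕ.* n))) <Y^W))
            Z = n ℕ.* (n ℕ.* (c₀ ℕ.* Y))
            1≤HZ = ℕ.*-mono-≤ 1≤H (ℕ.*-mono-≤ 1≤n (ℕ.*-mono-≤ 1≤n (ℕ.*-mono-≤ (ℕ.s≤s (ℕ.z≤n {k ℕ.+ d ℕ.* suc k})) 1≤Y)))
            J = r ℕ.* n ℕ.* (H ℕ.* Z) ℕ.+ 1
            open ProductToppling em ℝ {d} {k} (ℕ.s≤s ℕ.z≤n) (ℕ.s≤s ℕ.z≤n) T-d T-k tree-d tree-k ρ using (transport-upper)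
        in J , transport-upper weights (ℕ.s≤s 1≤e) n {Y}
             (λ a b (lt , ≰) → ℕ.s≤s⁻¹ (root-mono {d ℕ.^ a ℕ.* k ℕ.^ b} {suc Y} W (ℕ.≤-<-trans (near-growth E {n} {a} {b} lt ≰) <Y^W)))
             {p} {fromℕ (H ℕ.* Z) ⁻¹} J 1≤n (⁻¹-pos (fromℕ-pos 1≤HZ)) (enough-steps n (H ℕ.* Z) 1≤HZ)
             (≤-trans (+-mono-≤ (threshold-small H Z 1≤HZ 1≤Hh) (small n (ℕ.≤-trans (ℕ.m≤m+n n₁ n₂) n₁+n₂≤n) 1≤n)) (≈⇒≤ h+h)) ,
           conclude n H Y 1≤n 1≤Y (expo n (ℕ.≤-trans (ℕ.m≤n+m n₂ n₁) n₁+n₂≤n)) Y^W≤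
      where
      W c₀ : ℕ
      W = E ℕ.* D ℕ.+ 1
      c₀ = suc d ℕ.* suc k
      1≤W : 1 ℕ.≤ W
      1≤W = ℕ.m≤n+m 1 (E ℕ.* D)
      weights : EscapeWeight k d (E ℕ.* f) (E ℕ.* e ℕ.+ 1)
      weights = escape-weight k d (ℕ.s≤s ℕ.z≤n) (ℕ.s≤s ℕ.z≤n) E

      enough-steps : ∀ n s → 1 ℕ.≤ s → fromℕ r * fromℕ n < fromℕ (r ℕ.* n ℕ.* s ℕ.+ 1) * fromℕ s ⁻¹
      enough-steps n s 1≤s = begin-strict
        fromℕ r * fromℕ n                            ≈⟨ +-identityˡ _ ⟨
        0# + fromℕ r * fromℕ n                       <⟨ +-mono-<-≤ (⁻¹-pos (fromℕ-pos 1≤s)) ≤-refl ⟩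
        fromℕ s ⁻¹ + fromℕ r * fromℕ n               ≈⟨ +-congˡ (≈-trans (≈-sym (*-identityʳ _)) (*-congˡ (≈-sym (*-inverse (fromℕ-pos 1≤s))))) ⟩
        fromℕ s ⁻¹ + fromℕ r * fromℕ n * (fromℕ s * fromℕ s ⁻¹)
          ≈⟨ solve 4 (λ r n s t → t :+ r :* n :* (s :* t) := (r :* n :* s :+ con (+ 1)) :* t) ≈-refl _ _ _ _ ⟩
        (fromℕ r * fromℕ n * fromℕ s + 1#) * fromℕ s ⁻¹
          ≈⟨ *-congʳ (≈-trans (fromℕ-+ (r ℕ.* n ℕ.* s) 1) (+-cong (≈-trans (fromℕ-* (r ℕ.* n) s) (*-congʳ (fromℕ-* r n))) fromℕ-1)) ⟨
        fromℕ (r ℕ.* n ℕ.* s ℕ.+ 1) * fromℕ s ⁻¹     ∎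
        where open ≤-Reasoning

      threshold-small : ∀ H Z {h} → 1 ℕ.≤ H ℕ.* Z → 1# ≤ fromℕ H * h → fromℕ Z * fromℕ (H ℕ.* Z) ⁻¹ ≤ h
      threshold-small H Z {h} 1≤HZ 1≤Hh = x≤y*z⇒x*y⁻¹≤z (fromℕ-pos 1≤HZ) (begin
        fromℕ Z                     ≈⟨ *-identityˡ _ ⟨
        1# * fromℕ Z                ≤⟨ *-monoʳ-≤ (fromℕ-nonneg Z) 1≤Hh ⟩
        fromℕ H * h * fromℕ Z       ≈⟨ solve 3 (λ a b c → a :* b :* c := b :* (a :* c)) ≈-refl _ _ _ ⟩
        h * (fromℕ H * fromℕ Z)     ≈⟨ *-congˡ (fromℕ-* H Z) ⟨
        h * fromℕ (H ℕ.* Z)         ∎)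
        where open ≤-Reasoning

      conclude : ∀ n H Y → 1 ℕ.≤ n → 1 ℕ.≤ Y →
        (r ℕ.* H ℕ.* c₀ ℕ.+ 1) ℕ.^ W ℕ.* n ℕ.^ (3 ℕ.* W) ℕ.≤ 2 ℕ.^ n → Y ℕ.^ W ℕ.≤ X ℕ.^ ((E ℕ.+ 2) ℕ.* n) →
        (r ℕ.* n ℕ.* (H ℕ.* (n ℕ.* (n ℕ.* (c₀ ℕ.* Y)))) ℕ.+ 1) ℕ.^ (E ℕ.* D) ℕ.≤ X ℕ.^ ((3 ℕ.+ E) ℕ.* n)
      conclude n H Y 1≤n 1≤Y small Y^W≤ = begin
        J ℕ.^ (E ℕ.* D)                              ≤⟨ ℕ.^-monoʳ-≤ J {{ℕ.>-nonZero (ℕ.m≤n+m 1 (r ℕ.* n ℕ.* (H ℕ.* (n ℕ.* (n ℕ.* (c₀ ℕ.* Y))))))}} (ℕ.m≤m+n (E ℕ.* D) 1) ⟩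
        J ℕ.^ W                                      ≤⟨ ℕ.^-monoˡ-≤ W J≤ ⟩
        (K ℕ.* n ℕ.^ 3 ℕ.* Y) ℕ.^ W                  ≡⟨ ^-distrib-ℕ* (K ℕ.* n ℕ.^ 3) Y W ⟩
        (K ℕ.* n ℕ.^ 3) ℕ.^ W ℕ.* Y ℕ.^ W            ≡⟨ ≡.cong (ℕ._* Y ℕ.^ W) (≡.trans (^-distrib-ℕ* K (n ℕ.^ 3) W) (≡.cong (K ℕ.^ W ℕ.*_) (ℕ.^-*-assoc n 3 W))) ⟩
        K ℕ.^ W ℕ.* n ℕ.^ (3 ℕ.* W) ℕ.* Y ℕ.^ W      ≤⟨ ℕ.*-mono-≤ (ℕ.≤-trans small (2^≤X^ n)) Y^W≤ ⟩
        X ℕ.^ n ℕ.* X ℕ.^ ((E ℕ.+ 2) ℕ.* n)          ≡⟨ ℕ.^-distribˡ-+-* X n ((E ℕ.+ 2) ℕ.* n) ⟨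
        X ℕ.^ (n ℕ.+ (E ℕ.+ 2) ℕ.* n)                ≡⟨ ≡.cong (X ℕ.^_) (identity n E) ⟩
        X ℕ.^ ((3 ℕ.+ E) ℕ.* n)                      ∎
        where
        open ℕ.≤-Reasoning
        J K : ℕ
        J = r ℕ.* n ℕ.* (H ℕ.* (n ℕ.* (n ℕ.* (c₀ ℕ.* Y)))) ℕ.+ 1
        K = r ℕ.* H ℕ.* c₀ ℕ.+ 1
        identity : ∀ n E → n ℕ.+ (E ℕ.+ 2) ℕ.* n ≡ (3 ℕ.+ E) ℕ.* n
        identity = solve-∀
        J≤ : J ℕ.≤ K ℕ.* n ℕ.^ 3 ℕ.* Y
        J≤ = begin
          r ℕ.* n ℕ.* (H ℕ.* (n ℕ.* (n ℕ.* (c₀ ℕ.* Y)))) ℕ.+ 1                   ≤⟨ ℕ.+-monoʳ-≤ _ (ℕ.*-mono-≤ (ℕ.m^n>0 n {{ℕ.>-nonZero 1≤n}} 3) 1≤Y) ⟩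
          r ℕ.* n ℕ.* (H ℕ.* (n ℕ.* (n ℕ.* (c₀ ℕ.* Y)))) ℕ.+ n ℕ.^ 3 ℕ.* Y       ≡⟨ rearrange r n H c₀ Y ⟩
          K ℕ.* n ℕ.^ 3 ℕ.* Y                                                    ∎
          where
          rearrange : ∀ r n H c Y → r ℕ.* n ℕ.* (H ℕ.* (n ℕ.* (n ℕ.* (c ℕ.* Y)))) ℕ.+ n ℕ.* (n ℕ.* (n ℕ.* 1)) ℕ.* Y
            ≡ (r ℕ.* H ℕ.* c ℕ.+ 1) ℕ.* (n ℕ.* (n ℕ.* (n ℕ.* 1))) ℕ.* Y
          rearrange = solve-∀

-- From integer inequalities to the exponent of `θ`.

module GrowthRate (em : ExcludedMiddle 0ℓ) (ℝ : CompleteOrderedField)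
  {e f : ℕ} (1≤e : 1 ℕ.≤ e) (f≤e : f ℕ.≤ e) where
  open CompleteOrderedField ℝ
    renaming (refl to ≈-refl; sym to ≈-sym; trans to ≈-trans)
  open RealPowers ℝ
  open OrderedField em ℝ
  open RealPowersProperties em ℝ
  open Solver
  open ≤-Reasoning
  open Exponents.Growth 1≤e f≤e

  private
    D′ : ℕ
    D′ = d ℕ.+ k ℕ.∸ 2

    D′≡D : D′ ≡ D
    D′≡D = ≡.cong (ℕ._∸ 1) (ℕ.+-suc e f)

    1≤D : 1 ℕ.≤ D
    1≤D = ℕ.≤-trans 1≤e (ℕ.m≤m+n e f)

    1≤D′ : 1 ℕ.≤ D′
    1≤D′ = ≡.subst (1 ℕ.≤_) (≡.sym D′≡D) 1≤D

  Θ : Carrier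
  Θ = θ d k

  Θ^D : Θ ^ D ≈ fromℕ X
  Θ^D = begin-equality
    Θ ^ D                                              ≡⟨ ≡.cong (Θ ^_) D′≡D ⟨
    Θ ^ D′                                             ≈⟨ ^-distrib-* _ _ D′ ⟩
    (fromℕ d ^ᴿ (fromℕ e * fromℕ D′ ⁻¹)) ^ D′ * (fromℕ k ^ᴿ (fromℕ f * fromℕ D′ ⁻¹)) ^ D′
      ≈⟨ *-cong (fromℕ^ᴿ-^ {d} (ℕ.s≤s ℕ.z≤n) e D′ 1≤D′) (fromℕ^ᴿ-^ {k} (ℕ.s≤s ℕ.z≤n) f D′ 1≤D′) ⟩
    fromℕ d ^ e * fromℕ k ^ f                          ≈⟨ *-cong (fromℕ-^ d e) (fromℕ-^ k f) ⟨
    fromℕ (d ℕ.^ e) * fromℕ (k ℕ.^ f)                  ≈⟨ fromℕ-* (d ℕ.^ e) (k ℕ.^ f) ⟨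
    fromℕ X                                            ∎

  1<Θ : 1# < Θ
  1<Θ = ≤-trans (≈⇒≥ (*-identityˡ 1#)) (*-mono-≤ (≤-trans 0≤1 1≤a) 0≤1 1≤a
      (1≤fromℕ^ᴿ {k} (ℕ.s≤s ℕ.z≤n) f D′ 1≤D′)) ,
    λ 1≈Θ → ≤⇒≯ (begin
      fromℕ X   ≈⟨ Θ^D ⟨
      Θ ^ D     ≈⟨ ^-congˡ D 1≈Θ ⟨
      1# ^ D    ≈⟨ 1^n≈1 D ⟩
      1#        ≈⟨ fromℕ-1 ⟨
      fromℕ 1   ∎) (fromℕ-mono-< 2≤X)
    where
    1≤a : 1# ≤ fromℕ d ^ᴿ (fromℕ e * fromℕ D′ ⁻¹)
    1≤a = 1≤fromℕ^ᴿ {d} (ℕ.s≤s ℕ.z≤n) e D′ 1≤D′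

  Θ^[D*j] : ∀ j → Θ ^ (D ℕ.* j) ≈ fromℕ (X ℕ.^ j)
  Θ^[D*j] j = ≈-trans (≈-sym (^-assocʳ Θ D j)) (≈-trans (^-congˡ j Θ^D) (≈-sym (fromℕ-^ X j)))

  -- `o` is `log N / n - 1` to base `Θ`. As `Θ ^ D` is `X`, the hypotheses put `log N / n` between
  -- `E / (3 + E)` and `(6 + E) / (3 + E)`, both `3 / (3 + E) ≤ η` away from 1.
  exponent : ∀ {η n N} E → 1 ℕ.≤ n → 1 ℕ.≤ N → fromℕ 3 ≤ η * fromℕ (3 ℕ.+ E) →
    X ℕ.^ (E ℕ.* n) ℕ.≤ N ℕ.^ ((3 ℕ.+ E) ℕ.* D) → N ℕ.^ ((3 ℕ.+ E) ℕ.* D) ℕ.≤ X ℕ.^ ((6 ℕ.+ E) ℕ.* n) →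
    ∃[ o ] - η ≤ o × o ≤ η × fromℕ N ≈ Θ ^ᴿ (fromℕ n * (1# + o))
  exponent {η} {n} {N} E 1≤n 1≤N 3≤ηE lower upper = o ,
    *-cancelʳ-≤ 0<T (begin
      - η * (fn * (fE * fD))      ≈⟨ solve 4 (λ x n E D → (:- x) :* (n :* (E :* D)) := :- (x :* E :* (D :* n))) ≈-refl η fn fE fD ⟩
      - (η * fE * (fD * fn))      ≤⟨ neg-mono-≤ (*-monoʳ-≤ (*-nonneg (fromℕ-nonneg D) (fromℕ-nonneg n)) 3≤ηE) ⟩
      - (fromℕ 3 * (fD * fn))     ≈⟨ solve 3 (λ n a D → let i = con (+ 1) in
          :- ((i :+ (i :+ (i :+ con (+ 0)))) :* (D :* n)) := D :* (a :* n) :- n :* ((i :+ (i :+ (i :+ a))) :* D)) ≈-refl fn (fromℕ E) fD ⟩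
      fD * (fromℕ E * fn) - T     ≤⟨ +-monoˡ-≤ (- T) low ⟩
      y * (fE * fD) - T           ≈⟨ o*T ⟨
      o * T                       ∎) ,
    *-cancelʳ-≤ 0<T (begin
      o * T                       ≈⟨ o*T ⟩
      y * (fE * fD) - T           ≤⟨ +-monoˡ-≤ (- T) high ⟩
      fD * (fromℕ (6 ℕ.+ E) * fn) - T ≈⟨ solve 3 (λ n a D → let i = con (+ 1) in
          D :* ((i :+ (i :+ (i :+ (i :+ (i :+ (i :+ a)))))) :* n) :- n :* ((i :+ (i :+ (i :+ a))) :* D)
          := (i :+ (i :+ (i :+ con (+ 0)))) :* (D :* n)) ≈-refl fn (fromℕ E) fD ⟩
      fromℕ 3 * (fD * fn)         ≤⟨ *-monoʳ-≤ (*-nonneg (fromℕ-nonneg D) (fromℕ-nonneg n)) 3≤ηE ⟩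
      η * fE * (fD * fn)          ≈⟨ solve 4 (λ x n E D → x :* E :* (D :* n) := x :* (n :* (E :* D))) ≈-refl η fn fE fD ⟩
      η * T                       ∎) ,
    ≈-sym (^ᴿ-log 1<Θ 1≤z (begin-equality
      fn * (1# + o)               ≈⟨ solve 3 (λ n y i → n :* (con (+ 1) :+ (y :* i :- con (+ 1))) := y :* i :* n) ≈-refl fn y (fn ⁻¹) ⟩
      y * fn ⁻¹ * fn              ≈⟨ *⁻¹-cancel y 0<n ⟩
      y                           ∎))
    where
    M : ℕ
    M = 3 ℕ.+ E
    fn fD fE z y o T : Carrier
    fn = fromℕ n
    fD = fromℕ D
    fE = fromℕ M
    z = fromℕ N
    0<n : 0# < fn
    0<n = fromℕ-pos 1≤n
    1≤z : 1# ≤ z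
    1≤z = 1≤fromℕ 1≤N
    y = log 1<Θ 1≤z
    o = y * fn ⁻¹ - 1#
    T = fn * (fE * fD)
    0<T : 0# < T
    0<T = *-pos 0<n (*-pos (fromℕ-pos {M} (ℕ.s≤s ℕ.z≤n)) (fromℕ-pos 1≤D))
    1≤MD : 1 ℕ.≤ M ℕ.* D
    1≤MD = ℕ.≤-trans 1≤D (ℕ.m≤m+n D _)
    fromℕ-D* : ∀ j → fromℕ (D ℕ.* (j ℕ.* n)) ≈ fD * (fromℕ j * fn)
    fromℕ-D* j = ≈-trans (fromℕ-* D (j ℕ.* n)) (*-congˡ (fromℕ-* j n))
    low : fD * (fromℕ E * fn) ≤ y * (fE * fD)
    low = begin
      fD * (fromℕ E * fn)             ≈⟨ fromℕ-D* E ⟨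
      fromℕ (D ℕ.* (E ℕ.* n))         ≤⟨ ≤log 1<Θ 1≤z {D ℕ.* (E ℕ.* n)} {M ℕ.* D} 1≤MD (begin
        Θ ^ (D ℕ.* (E ℕ.* n))           ≈⟨ Θ^[D*j] (E ℕ.* n) ⟩
        fromℕ (X ℕ.^ (E ℕ.* n))         ≤⟨ fromℕ-mono-≤ lower ⟩
        fromℕ (N ℕ.^ (M ℕ.* D))         ≈⟨ fromℕ-^ N (M ℕ.* D) ⟩
        z ^ (M ℕ.* D)                   ∎) ⟩
      y * fromℕ (M ℕ.* D)             ≈⟨ *-congˡ (fromℕ-* M D) ⟩
      y * (fE * fD)                   ∎
    high : y * (fE * fD) ≤ fD * (fromℕ (6 ℕ.+ E) * fn)
    high = begin
      y * (fE * fD)                   ≈⟨ *-congˡ (fromℕ-* M D) ⟨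
      y * fromℕ (M ℕ.* D)             ≤⟨ log≤ 1<Θ 1≤z {D ℕ.* ((6 ℕ.+ E) ℕ.* n)} {M ℕ.* D} 1≤MD (begin
        z ^ (M ℕ.* D)                   ≈⟨ fromℕ-^ N (M ℕ.* D) ⟨
        fromℕ (N ℕ.^ (M ℕ.* D))         ≤⟨ fromℕ-mono-≤ upper ⟩
        fromℕ (X ℕ.^ ((6 ℕ.+ E) ℕ.* n)) ≈⟨ Θ^[D*j] ((6 ℕ.+ E) ℕ.* n) ⟨
        Θ ^ (D ℕ.* ((6 ℕ.+ E) ℕ.* n))   ∎) ⟩
      fromℕ (D ℕ.* ((6 ℕ.+ E) ℕ.* n)) ≈⟨ fromℕ-D* (6 ℕ.+ E) ⟩
      fD * (fromℕ (6 ℕ.+ E) * fn)     ∎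
    o*T : o * T ≈ y * (fE * fD) - T
    o*T = begin-equality
      (y * fn ⁻¹ - 1#) * (fn * (fE * fD)) ≈⟨ solve 4 (λ y i n m → (y :* i :- con (+ 1)) :* (n :* m) := y :* i :* n :* m :- n :* m) ≈-refl y (fn ⁻¹) fn (fE * fD) ⟩
      y * fn ⁻¹ * fn * (fE * fD) - T      ≈⟨ +-congʳ (*-congʳ (*⁻¹-cancel y 0<n)) ⟩
      y * (fE * fD) - T                   ∎

-- The minimal number of topplings and the limit.

least : ExcludedMiddle 0ℓ → (P : ℕ → Set) → ∀ n → P n → ∃[ m ] P m × (∀ i → P i → m ℕ.≤ i)
least em P n Pn = search n 0 (ℕ.+-identityʳ n) λ _ _ → ℕ.z≤n
  where
  search : ∀ c m → c ℕ.+ m ≡ n → (∀ i → P i → m ℕ.≤ i) → ∃[ m ] P m × (∀ i → P i → m ℕ.≤ i)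
  search c m eq below with em {P m}
  search c       m eq below | yes Pm = m , Pm , below
  search zero    m ≡.refl below | no ¬Pm = contradiction Pn ¬Pm
  search (suc c) m eq below | no ¬Pm = search c (suc m) (≡.trans (ℕ.+-suc c m) eq)
    λ i Pi → ℕ.≤∧≢⇒< (below i Pi) λ { ≡.refl → ¬Pm Pi }

theorem1p7 :
  ExcludedMiddle 0ℓ →
  (ℝ : CompleteOrderedField) →
  let open CompleteOrderedField ℝ
      open RealPowers ℝ
  in
  (d k : ℕ) → k ℕ.≤ d → 1 ℕ.≤ k → 3 ℕ.≤ d ℕ.+ k →
  (p : Carrier) → 0# < p → p < 1# →
  (ε : Carrier) → 0# < ε →
  ∃[ n₀ ]
    ((n : ℕ) → n₀ ℕ.≤ n →
     (T-d T-k : Graph) → IsRegularTree (d ℕ.+ 1) T-d → IsRegularTree (k ℕ.+ 1) T-k →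
     (ρ : Graph.V (T-d □ T-k)) →
     let open Toppling ℝ (T-d □ T-k) in
     ∃[ N ] IsToppleNumber p (Ball (T-d □ T-k) ρ n) (δ ρ) N
       × ∃[ o ] - ε ≤ o × o ≤ ε
           × fromℕ N ≈ θ d k ^ᴿ (fromℕ n * (1# + o)))
theorem1p7 em ℝ (suc (suc e)) (suc f) (ℕ.s≤s f≤e) _ _ p 0<p p<1 η 0<η =
  let E₀ , lt = archimedean (fromℕ 3 * η ⁻¹)
      n₁ , lower = lower-bound 0<p p<1 E₀
      -- The shift by 3 gives both bounds the same power `(3 + E₀) D` of the toppling number.
      n₂ , upper = upper-bound 0<p p<1 (3 ℕ.+ E₀)
  in 1 ℕ.+ (n₁ ℕ.+ n₂) , λ n n₀≤n T-d T-k tree-d tree-k ρ →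
    let n₁+n₂≤n = ℕ.≤-trans (ℕ.n≤1+n (n₁ ℕ.+ n₂)) n₀≤n
        J , (N₀ , N₀≤J , can) , J≤ = upper n (ℕ.≤-trans (ℕ.m≤n+m n₂ n₁) n₁+n₂≤n) T-d T-k tree-d tree-k ρ
        N , canN , minimal = least em (Transports 0<p p<1 n T-d T-k ρ) N₀ can
        1≤N , ≤N = lower n (ℕ.≤-trans (ℕ.m≤m+n n₁ n₂) n₁+n₂≤n) T-d T-k tree-d tree-k ρ N canN
    in N , (canN , minimal) ,
       exponent {η} {n} {N} E₀ (ℕ.≤-trans (ℕ.m≤m+n 1 (n₁ ℕ.+ n₂)) n₀≤n) 1≤N
         (three≤η*E {E₀} lt) ≤N
         (ℕ.≤-trans (ℕ.^-monoˡ-≤ ((3 ℕ.+ E₀) ℕ.* (suc e ℕ.+ f)) (ℕ.≤-trans (minimal N₀ can) N₀≤J)) J≤)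
  where
  open CompleteOrderedField ℝ using (_<_; _≤_; _*_; _⁻¹; ≤-trans)
  open RealPowers ℝ using (fromℕ)
  open OrderedField em ℝ
  open ToppleNumberBounds em ℝ {suc e} {f} (ℕ.s≤s ℕ.z≤n) f≤e
  open GrowthRate em ℝ {suc e} {f} (ℕ.s≤s ℕ.z≤n) f≤e

  three≤η*E : ∀ {E₀} → fromℕ 3 * η ⁻¹ < fromℕ E₀ → fromℕ 3 ≤ η * fromℕ (3 ℕ.+ E₀)
  three≤η*E {E₀} lt = ≤-trans (x*y⁻¹≤z⇒x≤z*y 0<η (≤-trans (<⇒≤ lt) (fromℕ-mono-≤ (ℕ.m≤n+m E₀ 3))))
    (≈⇒≤ (CompleteOrderedField.*-comm ℝ _ _))
theorem1p7 em ℝ (suc zero) (suc zero) _ _ (ℕ.s≤s (ℕ.s≤s ()))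
theorem1p7 em ℝ (suc zero) (suc (suc f)) (ℕ.s≤s ()) _ _
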